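{- Let $c\in\mathbb{N}$. \textsc{Max Weight Independent Set} admits a PTAS when restricted to $n$-vertex graphs given together with a grid representation $\mathcal{R}=(\mathcal{G},\mathcal{P},x)$ such that each path in $\mathcal{P}$ has a constant number of bends and the horizontal part of each path in $\mathcal{P}$ has length at most $c$. More precisely, for every $0<\varepsilon<1$ a solution of weight at least $(1-\varepsilon)$ times the optimum can be computed in time $O(c\lceil\frac1\varepsilon\rceil\cdot n^{\lceil\frac1\varepsilon\rceil c+3})$ if $x=v$, and in time $O(c\lceil\frac1\varepsilon\rceil\cdot n^{3\lceil\frac1\varepsilon\rceil c+2})$ if $x=e$.
   Context: \textsc{Max Weight Independent Set}: given a graph $G$ and $w\colon V(G)\to\mathbb{Q}_+$, find an independent set of maximum total weight. A grid representation of $G$ is a triple $(\mathcal{G},\mathcal{P},x)$ where $\mathcal{G}$ is a rectangular grid, $\mathcal{P}=\{P_u\}_{u\in V(G)}$ is a collection of paths on the grid in bijection with $V(G)$, and $x\in\{v,e\}$; if $x=v$, distinct $u,w$ are adjacent iff $P_u,P_w$ share a grid-point; if $x=e$, iff they share a grid-edge. A bend is a $90$-degree turn at a grid-point; the horizontal part of a path is its projection onto the $x$-axis. Paths are encoded by their endpoints and bend-points. A PTAS is an algorithm that, given an instance and $\varepsilon>0$, returns a solution of weight at least $(1-\varepsilon)$ times the optimum in time $n^{O(f(1/\varepsilon))}$. -}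

module Defs where

open import Data.Bool using (Bool; true; false; if_then_else_; not; _∧_)
open import Data.Fin using (Fin; toℕ)
open import Data.Fin.Subset using (Subset; _∈_)
import Data.Integer as ℤ
open import Data.List using (List; []; _∷_; _++_; map; concatMap; foldr; length; zip; drop; head; allFin)
open import Data.List.Extrema.Nat using (max; min)
open import Data.List.NonEmpty as List⁺ using (List⁺)
import Data.List.Membership.Propositional as List∈
open import Data.List.Relation.Unary.All using (All)
open import Data.List.Relation.Unary.Linked using (Linked)
open import Data.List.Relation.Unary.Unique.Propositional using (Unique)
open import Data.Maybe using (fromMaybe)
open import Data.Nat using (ℕ; suc; _+_; _*_; _∸_; _^_; _≤_; _<_; _≡ᵇ_; _≤ᵇ_; _<ᵇ_; ∣_-_∣)
open import Data.Product using (Σ; ∃-syntax; _×_; _,_; proj₁; proj₂)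
open import Data.Rational as ℚ using (ℚ; 0ℚ; 1ℚ; Positive)
import Data.Rational.Properties as ℚₚ
open import Data.Sum using (_⊎_)
open import Data.Vec as Vec using ()
open import Function.Bundles using (_⇔_)
open import Relation.Binary.PropositionalEquality using (_≡_; _≢_)

record Graph (n : ℕ) : Set where
  field
    adj     : Fin n → Fin n → Bool
    adj-sym : ∀ u v → adj u v ≡ adj v u
    adj-irr : ∀ u → adj u u ≡ false

  Adjacent : Fin n → Fin n → Set
  Adjacent u v = adj u v ≡ true

open Graph public

Independent : ∀ {n} → Graph n → Subset n → Set
Independent G S = ∀ u v → u ∈ S → v ∈ S → adj G u v ≡ false

totalWeight : ∀ {n} → (Fin n → ℚ) → Subset n → ℚ
totalWeight {n} w S =
  foldr ℚ._+_ 0ℚ (map (λ u → if Vec.lookup S u then w u else 0ℚ) (allFin n))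

IsMaxWeightIndependent : ∀ {n} → Graph n → (Fin n → ℚ) → Subset n → Set
IsMaxWeightIndependent G w S =
  Independent G S × (∀ T → Independent G T → totalWeight w T ℚ.≤ totalWeight w S)

Point : Set
Point = ℕ × ℕ

GridAdjacent : Point → Point → Set
GridAdjacent (x , y) (x′ , y′) = ∣ x - x′ ∣ + ∣ y - y′ ∣ ≡ 1

-- `width` and `height` count columns and rows of grid-points.
record Grid : Set where
  field
    width  : ℕ
    height : ℕ

  _isOn : Point → Set
  (x , y) isOn = x < width × y < height

-- A path of the grid graph, as the sequence of all grid-points it visits.
-- A single grid-point is a path (without edges).
record GridPath (𝒢 : Grid) : Set where
  open Grid 𝒢
  field
    points⁺ : List⁺ Point

  points : List Point
  points = List⁺.toList points⁺

  field
    onGrid : All _isOn points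
    linked : Linked GridAdjacent points
    simple : Unique points

  edges : List (Point × Point)
  edges = zip points (drop 1 points)

  start end : Point
  start = List⁺.head points⁺
  end   = List⁺.last points⁺

open GridPath public using (points; edges; start; end)

-- If p, q, r are consecutive on a path, the path turns by 90 degrees at q
-- exactly when p and r differ in both coordinates.
isTurn : Point → Point → Bool
isTurn (x , y) (x′ , y′) = not (x ≡ᵇ x′) ∧ not (y ≡ᵇ y′)

turningPoints : List Point → List Point
turningPoints (p ∷ q ∷ r ∷ ps) =
  if isTurn p r then q ∷ turningPoints (q ∷ r ∷ ps) else turningPoints (q ∷ r ∷ ps)
turningPoints _ = []

module _ {𝒢 : Grid} where

  bendPoints : GridPath 𝒢 → List Point
  bendPoints P = turningPoints (points P)

  bends : GridPath 𝒢 → ℕ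
  bends P = length (bendPoints P)

  -- The projection of a path onto the x-axis is the interval between the
  -- least and the greatest x-coordinate.
  horizontalLength : GridPath 𝒢 → ℕ
  horizontalLength P = max x₀ xs ∸ min x₀ xs
    where
    x₀ = proj₁ (start P)
    xs = map proj₁ (points P)

  SharePoint : GridPath 𝒢 → GridPath 𝒢 → Set
  SharePoint P Q = ∃[ p ] (p List∈.∈ points P × p List∈.∈ points Q)

  -- Grid-edges are undirected, while `edges` lists them in order of traversal.
  _onEdgesOf_ : Point × Point → GridPath 𝒢 → Set
  (p , q) onEdgesOf P = ((p , q) List∈.∈ edges P) ⊎ ((q , p) List∈.∈ edges P)

  ShareEdge : GridPath 𝒢 → GridPath 𝒢 → Set
  ShareEdge P Q = ∃[ e ] (e onEdgesOf P × e onEdgesOf Q)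

data Mode : Set where
  x=v x=e : Mode

Meet : Mode → ∀ {𝒢} → GridPath 𝒢 → GridPath 𝒢 → Set
Meet x=v = SharePoint
Meet x=e = ShareEdge

record GridRepresentation {n : ℕ} (G : Graph n) : Set where
  field
    grid      : Grid
    path      : Fin n → GridPath grid
    mode      : Mode
    adj⇔meet  : ∀ u w → u ≢ w → Adjacent G u w ⇔ Meet mode (path u) (path w)

record Instance (n : ℕ) : Set where
  field
    graph    : Graph n
    weight   : Fin n → ℚ
    weight≥0 : ∀ u → 0ℚ ℚ.≤ weight u
    rep      : GridRepresentation graph

  open GridRepresentation rep public

open Instance public

Class : Set₁
Class = ∀ {n} → Instance n → Set

FewBendsShort : (b c : ℕ) → Class
FewBendsShort b c I = ∀ u → bends (path I u) ≤ b × horizontalLength (path I u) ≤ c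

-- Model of computation: random access machine with structured control flow.
--
-- There are two sorts of cells, each with registers and indirectly addressed
-- memory: natural numbers (with +, ∸, ≤) and rational weights (with +, ≤).
-- Every instruction and every evaluation of a test costs one unit.  There is
-- no multiplication: unit-cost products of unbounded numbers would make the
-- model unreasonably strong.

Reg : Set
Reg = ℕ

data Instr : Set where
  const        : Reg → ℕ → Instr            -- rᵢ := k
  add sub      : Reg → Reg → Reg → Instr    -- rᵢ := rⱼ + rₖ,  rᵢ := rⱼ ∸ rₖ
  load         : Reg → Reg → Instr          -- rᵢ := mem[rⱼ]
  store        : Reg → Reg → Instr          -- mem[rᵢ] := rⱼ
  wzero        : Reg → Instr                -- wᵢ := 0
  wadd         : Reg → Reg → Reg → Instr    -- wᵢ := wⱼ + wₖ
  wload        : Reg → Reg → Instr          -- wᵢ := wmem[rⱼ]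
  wstore       : Reg → Reg → Instr          -- wmem[rᵢ] := wⱼ

data Test : Set where
  leq  : Reg → Reg → Test                   -- rᵢ ≤ rⱼ
  wleq : Reg → Reg → Test                   -- wᵢ ≤ wⱼ

data Program : Set where
  instr         : Instr → Program
  _⨾_           : Program → Program → Program
  ifte          : Test → Program → Program → Program
  while         : Test → Program → Program

infixr 5 _⨾_

record State : Set where
  constructor state
  field
    reg  : ℕ → ℕ
    mem  : ℕ → ℕ
    wreg : ℕ → ℚ
    wmem : ℕ → ℚ

open State public

_[_↦_] : {A : Set} → (ℕ → A) → ℕ → A → (ℕ → A)
(f [ i ↦ a ]) j = if j ≡ᵇ i then a else f j

step : Instr → State → State
step (const i k)  σ = record σ { reg  = reg σ [ i ↦ k ] }
step (add i j k)  σ = record σ { reg  = reg σ [ i ↦ reg σ j + reg σ k ] }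
step (sub i j k)  σ = record σ { reg  = reg σ [ i ↦ reg σ j ∸ reg σ k ] }
step (load i j)   σ = record σ { reg  = reg σ [ i ↦ mem σ (reg σ j) ] }
step (store i j)  σ = record σ { mem  = mem σ [ reg σ i ↦ reg σ j ] }
step (wzero i)    σ = record σ { wreg = wreg σ [ i ↦ 0ℚ ] }
step (wadd i j k) σ = record σ { wreg = wreg σ [ i ↦ wreg σ j ℚ.+ wreg σ k ] }
step (wload i j)  σ = record σ { wreg = wreg σ [ i ↦ wmem σ (reg σ j) ] }
step (wstore i j) σ = record σ { wmem = wmem σ [ reg σ i ↦ wreg σ j ] }

test : Test → State → Bool
test (leq i j)  σ = reg σ i ≤ᵇ reg σ j
test (wleq i j) σ = wreg σ i ℚ.≤ᵇ wreg σ j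

-- `Run p σ t τ`: started in σ, p halts in τ after exactly t time units.
data Run : Program → State → ℕ → State → Set where
  run-instr   : ∀ {i σ} → Run (instr i) σ 1 (step i σ)
  run-seq     : ∀ {p q σ τ υ s t} → Run p σ s τ → Run q τ t υ → Run (p ⨾ q) σ (s + t) υ
  run-if-yes  : ∀ {b p q σ τ t} → test b σ ≡ true → Run p σ t τ → Run (ifte b p q) σ (suc t) τ
  run-if-no   : ∀ {b p q σ τ t} → test b σ ≡ false → Run q σ t τ → Run (ifte b p q) σ (suc t) τ
  run-done    : ∀ {b p σ} → test b σ ≡ false → Run (while b p) σ 1 σ
  run-loop    : ∀ {b p σ τ υ s t} → test b σ ≡ true → Run p σ s τ → Run (while b p) τ t υ →
                Run (while b p) σ (suc (s + t)) υ

encodePoint : Point → List ℕ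
encodePoint (x , y) = x ∷ y ∷ []

-- Number of bends, followed by first endpoint, bend-points in order, last endpoint.
encodePath : {𝒢 : Grid} → GridPath 𝒢 → List ℕ
encodePath P = bends P ∷ concatMap encodePoint (start P ∷ bendPoints P ++ end P ∷ [])

encodeMode : Mode → ℕ
encodeMode x=v = 0
encodeMode x=e = 1

encodeBool : Bool → ℕ
encodeBool b = if b then 1 else 0

-- n, ε as numerator and denominator, mode, size of the grid, adjacency matrix
-- row by row, paths.
encode : ∀ {n} → Instance n → ℚ → List ℕ
encode {n} I ε =
  n ∷ ℤ.∣ ℚ.↥ ε ∣ ∷ ℚ.↧ₙ ε ∷ encodeMode (mode I) ∷
  Grid.width (grid I) ∷ Grid.height (grid I) ∷
  concatMap (λ u → map (λ w → encodeBool (adj (graph I) u w)) (allFin n)) (allFin n) ++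
  concatMap (λ u → encodePath (path I u)) (allFin n)

contents : {A : Set} → A → List A → ℕ → A
contents default xs a = fromMaybe default (head (drop a xs))

initial : ∀ {n} → Instance n → ℚ → State
initial {n} I ε = state
  (λ _ → 0)
  (contents 0 (encode I ε))
  (λ _ → 0ℚ)
  (contents 0ℚ (map (weight I) (allFin n)))

-- Vertex u is in the returned set iff memory cell u is nonzero.
output : ∀ n → State → Subset n
output n τ = Vec.tabulate (λ u → 0 <ᵇ mem τ (toℕ u))

IsApproxSolution : ∀ {n} → Instance n → ℚ → Subset n → Set
IsApproxSolution I ε S =
  Independent (graph I) S ×
  (∀ T → IsMaxWeightIndependent (graph I) (weight I) T →
     (1ℚ ℚ.- ε) ℚ.* totalWeight (weight I) T ℚ.≤ totalWeight (weight I) S)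

SolvesInTime : Program → ∀ {n} → Instance n → ℚ → ℕ → Set
SolvesInTime prog {n} I ε t =
  ∃[ τ ] (Run prog (initial I ε) t τ × IsApproxSolution I ε (output n τ))

inverse : (ε : ℚ) → .{{Positive ε}} → ℚ
inverse ε = (ℚ.1/ ε) {{ℚₚ.pos⇒nonZero ε}}

⌈1/_⌉ : (ε : ℚ) → .{{Positive ε}} → ℕ
⌈1/ ε ⌉ = ℤ.∣ ℚ.ceiling (inverse ε) ∣

-- For n ≤ 1 every power of n is at most 1, so the time bound n^f(1/ε) is
-- only meaningful for n ≥ 2; there f also absorbs constant factors.
IsPTAS : Class → Program → Set
IsPTAS 𝒞 prog =
  Σ (ℚ → ℕ) λ f →
    (ε : ℚ) → .{{_ : Positive ε}} →
    ∀ {n} (I : Instance n) → 𝒞 I →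
    ∃[ t ] (SolvesInTime prog I ε t × (2 ≤ n → t ≤ n ^ f (inverse ε)))

-- `timeBound x c k n` with k = ⌈1/ε⌉.
timeBound : Mode → (c k n : ℕ) → ℕ
timeBound x=v c k n = c * k * n ^ (k * c + 3)
timeBound x=e c k n = c * k * n ^ (3 * k * c + 2)

{-# OPTIONS --safe #-}

-- Shifting.  Cuts g₀ < g₁ < … are placed greedily at occupied columns, at least c
-- apart, so that each path crosses at most one cut and the columns occupied between
-- consecutive cuts lie in a window of length c; since coordinates are not bounded in
-- terms of n, multiples of c cannot be used instead.  For k = ⌈1/ε⌉ and an offset o < k,
-- drop the paths crossing a cut gᵢ with i ≡ o (mod k).  A path is dropped for at most one
-- offset, so for some offset the optimum loses at most 1/k of its weight.
--
-- The remaining paths live in strips with at most kc occupied columns.  Process them by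
-- strip and then by lowest row, and remember, of the vertices chosen so far, only the set
-- of unprocessed vertices that are still available.  This set is determined by the chosen
-- vertices with an unprocessed neighbour.  All these paths meet one row of one strip, at
-- distinct grid-points (x = v) or at distinct grid-edges leaving the row to the right or
-- upwards (x = e), so there are at most M of them, with M = kc or M = 2kc.  Hence at most
-- n^M + 1 sets occur at each of the n stages.  They are stored as bit masks that directly
-- address the table, which makes merging equal sets free.
module Submission where

open import Defs
open import Data.Bool using (Bool; true; false; if_then_else_; not; _∧_; _∨_; T)
open import Data.Bool.ListAction using (any)
open import Data.Bool.Properties as Boolₚ using (∨-zeroʳ)
open import Data.Empty using (⊥; ⊥-elim)
open import Data.Fin as Fin using (Fin; zero; suc; toℕ; fromℕ<)
open import Data.Fin.Patterns
import Data.Fin.Properties as Finₚ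
open import Data.Fin.Subset using (Subset)
import Data.Integer as ℤ
import Data.Integer.Properties as ℤₚ
open import Data.List using (List; []; _∷_; _++_; length; map; concatMap; foldr; upTo; filter; replicate; cartesianProductWith; cartesianProduct; zip; drop; initLast; _∷ʳ′_; tabulate; allFin)
import Data.List.Extrema.Nat as Extrema
open import Data.List.Membership.Propositional using (_∈_; _∉_)
open import Data.List.Membership.Propositional.Properties
open import Data.List.NonEmpty as List⁺ using (_∷_)
open import Data.List.Properties using (length-++; length-map; length-upTo; length-replicate; length-tabulate)
open import Data.List.Relation.Unary.All as All using (All; []; _∷_)
import Data.List.Relation.Unary.All.Properties as Allₚ
open import Data.List.Relation.Unary.AllPairs using ([]; _∷_)
open import Data.List.Relation.Unary.Any using (here; there)
open import Data.List.Relation.Unary.Linked using (Linked; _∷_)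
open import Data.List.Relation.Unary.Unique.Propositional using (Unique)
import Data.List.Relation.Unary.Unique.Propositional.Properties as Uniqueₚ
open import Data.Nat using (ℕ; zero; suc; _+_; _*_; _∸_; _^_; _/_; _%_; _≤_; _<_; _≡ᵇ_; _≤ᵇ_; _<ᵇ_; z≤n; s≤s; ∣_-_∣; NonZero; >-nonZero)
open import Data.Nat.Coprimality using (1-coprimeTo) renaming (sym to coprime-sym)
open import Data.Nat.DivMod using (m≡m%n+[m/n]*n; m%n<n)
open import Data.Nat.Properties
open import Data.List.Membership.DecPropositional _≟_ using (_∈?_)
open import Data.Nat.Tactic.RingSolver using (solve-∀)
open import Data.Product using (Σ; ∃-syntax; _×_; _,_; proj₁; proj₂)
open import Data.Rational as ℚ using (ℚ; 0ℚ; 1ℚ; Positive)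
import Data.Rational.Properties as ℚₚ
import Data.Rational.Unnormalised as ℚᵘ
import Data.Rational.Unnormalised.Properties as ℚᵘₚ
open import Data.Sum using (_⊎_; inj₁; inj₂; swap)
open import Data.Unit using (⊤; tt)
open import Data.Vec using (lookup; _[_]=_)
import Data.Vec.Properties as Vecₚ
open import Function using (_∘_)
open import Function.Bundles using (Equivalence; _⇔_)
open import Relation.Binary.Definitions using (tri<; tri≈; tri>)
open import Relation.Binary.PropositionalEquality
open import Relation.Nullary using (¬_; Dec; yes; no; contradiction)

-- A structured language and its compilation to the machine

-- Remembering only the available set loses nothing: two choices with the same available set admit
-- the same continuations, so the heavier one may represent both. Geometry enters the dynamic
-- program solely through `Narrow`. There a column of a strip is named by the phase of its window, k
-- values, and its offset in the window, c values, whatever its coordinate; this is the origin of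
-- kc. Each stage spends time of order n on each set, so n stages and k offsets cost k n^(M+2) up to
-- a constant. The machine has no multiplication, division or shift. Products, powers and the
-- ceiling of 1/ε come from loops of additions and subtractions, and masks are read by comparison
-- with powers of two. Memory behind the input is initially zero and costs nothing until touched, so
-- every stage can have its own table of 2^n cells. The input gives only endpoints and bends,
-- whereas adjacency concerns all points of a path; `hull` bridges the two. The algorithm is written
-- in a small language with bounded loops and exact costs, which a verified compiler translates.

data Expr : Set where
  lit     : ℕ → Expr
  var     : ℕ → Expr
  _⊕_ _⊖_ : Expr → Expr → Expr
  inp     : Expr → Expr
  _at_    : Fin 8 → Expr → Expr

data WExpr : Set where
  wnil  : WExpr
  wvar  : ℕ → WExpr
  winp  : Expr → WExpr
  wtab  : Expr → WExpr
  _⊞_   : WExpr → WExpr → WExpr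

data Cmd : Set where
  skip   : Cmd
  _≔_    : ℕ → Expr → Cmd
  _[_]≔_ : Fin 8 → Expr → Expr → Cmd
  out    : Expr → Expr → Cmd
  _≔ʷ_   : ℕ → WExpr → Cmd
  tab[_]≔_ : Expr → WExpr → Cmd
  _⨟_    : Cmd → Cmd → Cmd
  if≤    : Expr → Expr → Cmd → Cmd → Cmd
  if≤ʷ   : WExpr → WExpr → Cmd → Cmd → Cmd
  for    : ℕ → Expr → Cmd → Cmd

infixl 7 _⊕_ _⊖_
infixr 8 _at_
infix  6 _≔_ _[_]≔_ _≔ʷ_ tab[_]≔_
infixr 5 _⨟_

-- Variable 0 holds the end of the input; the eight arrays are interleaved
-- in the memory cells behind it.
cell : ℕ → Fin 8 → ℕ → ℕ
cell B a i = B + (toℕ a + i * 8)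

eval : Expr → State → ℕ
eval (lit k)  σ = k
eval (var x)  σ = reg σ x
eval (e ⊕ f)  σ = eval e σ + eval f σ
eval (e ⊖ f)  σ = eval e σ ∸ eval f σ
eval (inp e)  σ = mem σ (eval e σ)
eval (a at e) σ = mem σ (cell (reg σ 0) a (eval e σ))

evalʷ : WExpr → State → ℚ
evalʷ wnil     σ = 0ℚ
evalʷ (wvar x) σ = wreg σ x
evalʷ (winp e) σ = wmem σ (eval e σ)
evalʷ (wtab e) σ = wmem σ (reg σ 0 + eval e σ)
evalʷ (e ⊞ f)  σ = evalʷ e σ ℚ.+ evalʷ f σ

set : ℕ → ℕ → State → State
set x v σ = record σ { reg = reg σ [ x ↦ v ] }

setMem : ℕ → ℕ → State → State
setMem a v σ = record σ { mem = mem σ [ a ↦ v ] }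

setʷ : ℕ → ℚ → State → State
setʷ x v σ = record σ { wreg = wreg σ [ x ↦ v ] }

setMemʷ : ℕ → ℚ → State → State
setMemʷ a v σ = record σ { wmem = wmem σ [ a ↦ v ] }

iter : (State → State) → ℕ → ℕ → ℕ → State → State
iter f x i zero    σ = σ
iter f x i (suc m) σ = iter f x (suc i) m (f (set x i σ))

-- A round costs five units besides the body: the test, two instructions that set the variable and
-- two that advance the counter. The base case is the failing test.
iterCost : (State → State) → (State → ℕ) → ℕ → ℕ → ℕ → State → ℕ
iterCost f c x i zero    σ = 1
iterCost f c x i (suc m) σ =
  suc ((1 + (1 + (c (set x i σ) + 2))) + iterCost f c x (suc i) m (f (set x i σ)))

⟦_⟧ : Cmd → State → State
⟦ skip ⟧          σ = σ
⟦ x ≔ e ⟧         σ = set x (eval e σ) σ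
⟦ a [ e ]≔ f ⟧    σ = setMem (cell (reg σ 0) a (eval e σ)) (eval f σ) σ
⟦ out e f ⟧       σ = setMem (eval e σ) (eval f σ) σ
⟦ x ≔ʷ e ⟧        σ = setʷ x (evalʷ e σ) σ
⟦ tab[ e ]≔ f ⟧   σ = setMemʷ (reg σ 0 + eval e σ) (evalʷ f σ) σ
⟦ p ⨟ q ⟧         σ = ⟦ q ⟧ (⟦ p ⟧ σ)
⟦ if≤ e f p q ⟧   σ = if eval e σ ≤ᵇ eval f σ then ⟦ p ⟧ σ else ⟦ q ⟧ σ
⟦ if≤ʷ e f p q ⟧  σ = if evalʷ e σ ℚ.≤ᵇ evalʷ f σ then ⟦ p ⟧ σ else ⟦ q ⟧ σ
⟦ for x e p ⟧     σ = iter ⟦ p ⟧ x 0 (eval e σ) σ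

costE : Expr → ℕ
costE (lit k)  = 1
costE (var x)  = 2
costE (e ⊕ f)  = costE e + (costE f + 1)
costE (e ⊖ f)  = costE e + (costE f + 1)
costE (inp e)  = costE e + 1
costE (a at e) = costE e + (6 + 1)

costW : WExpr → ℕ
costW wnil     = 1
costW (wvar x) = 2
costW (winp e) = costE e + 1
costW (wtab e) = costE e + 2
costW (e ⊞ f)  = costW e + (costW f + 1)

cost : Cmd → State → ℕ
cost skip            σ = 1
cost (x ≔ e)         σ = costE e + 2
cost (a [ e ]≔ f)    σ = costE e + (6 + (costE f + 1))
cost (out e f)       σ = costE e + (costE f + 1)
cost (x ≔ʷ e)        σ = costW e + 2
cost (tab[ e ]≔ f)   σ = costE e + (1 + (costW f + 1))
cost (p ⨟ q)         σ = cost p σ + cost q (⟦ p ⟧ σ)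
cost (if≤ e f p q)   σ = costE e + (costE f + suc (if eval e σ ≤ᵇ eval f σ then cost p σ else cost q σ))
cost (if≤ʷ e f p q)  σ = costW e + (costW f + suc (if evalʷ e σ ℚ.≤ᵇ evalʷ f σ then cost p σ else cost q σ))
cost (for x e p)     σ = costE e + (1 + iterCost ⟦ p ⟧ (cost p) x 0 (eval e σ) σ)

-- Variables live in even registers, temporaries in odd ones.
vr tr : ℕ → Reg
vr x = x + x
tr d = suc (d + d)

-- Three doublings yield the factor 8 of `cell`, since there is no product instruction.
toCell : ℕ → Fin 8 → Program
toCell d a =
  instr (add (tr d) (tr d) (tr d)) ⨾ instr (add (tr d) (tr d) (tr d)) ⨾ instr (add (tr d) (tr d) (tr d)) ⨾
  instr (const (tr (suc d)) (toℕ a)) ⨾ instr (add (tr d) (tr (suc d)) (tr d)) ⨾ instr (add (tr d) (vr 0) (tr d))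

compE : ℕ → Expr → Program
compE d (lit k)  = instr (const (tr d) k)
-- There is no move instruction; a copy is the sum with a fresh zero.
compE d (var x)  = instr (const (tr d) 0) ⨾ instr (add (tr d) (tr d) (vr x))
compE d (e ⊕ f)  = compE d e ⨾ compE (suc d) f ⨾ instr (add (tr d) (tr d) (tr (suc d)))
compE d (e ⊖ f)  = compE d e ⨾ compE (suc d) f ⨾ instr (sub (tr d) (tr d) (tr (suc d)))
compE d (inp e)  = compE d e ⨾ instr (load (tr d) (tr d))
compE d (a at e) = compE d e ⨾ toCell d a ⨾ instr (load (tr d) (tr d))

compW : ℕ → WExpr → Program
compW d wnil     = instr (wzero (tr d))
compW d (wvar x) = instr (wzero (tr d)) ⨾ instr (wadd (tr d) (tr d) (vr x))
compW d (winp e) = compE d e ⨾ instr (wload (tr d) (tr d))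
compW d (wtab e) = compE d e ⨾ instr (add (tr d) (vr 0) (tr d)) ⨾ instr (wload (tr d) (tr d))
compW d (e ⊞ f)  = compW d e ⨾ compW (suc d) f ⨾ instr (wadd (tr d) (tr d) (tr (suc d)))

comp : ℕ → Cmd → Program
comp d skip            = instr (const (tr d) 0)
comp d (x ≔ e)         = compE d e ⨾ instr (const (tr (suc d)) 0) ⨾ instr (add (vr x) (tr d) (tr (suc d)))
comp d (a [ e ]≔ f)    = compE d e ⨾ toCell d a ⨾ compE (suc d) f ⨾ instr (store (tr d) (tr (suc d)))
comp d (out e f)       = compE d e ⨾ compE (suc d) f ⨾ instr (store (tr d) (tr (suc d)))
comp d (x ≔ʷ e)        = compW d e ⨾ instr (wzero (tr (suc d))) ⨾ instr (wadd (vr x) (tr d) (tr (suc d)))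
comp d (tab[ e ]≔ f)   = compE d e ⨾ instr (add (tr d) (vr 0) (tr d)) ⨾ compW (suc d) f ⨾ instr (wstore (tr d) (tr (suc d)))
comp d (p ⨟ q)         = comp d p ⨾ comp d q
comp d (if≤ e f p q)   = compE d e ⨾ compE (suc d) f ⨾ ifte (leq (tr d) (tr (suc d))) (comp d p) (comp d q)
comp d (if≤ʷ e f p q)  = compW d e ⨾ compW (suc d) f ⨾ ifte (wleq (tr d) (tr (suc d))) (comp d p) (comp d q)
-- The counter runs from 1 up to the bound, because `leq` is the only comparison of naturals, and
-- the variable receives the counter minus 1. Counter and bound are temporaries, so the body may
-- overwrite `x` and the variables of `e` without disturbing the loop.
comp d (for x e p)     = compE d e ⨾ instr (const (tr (suc d)) 1) ⨾
  while (leq (tr (suc d)) (tr d))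
    (instr (const (tr (2 + d)) 1) ⨾ instr (sub (vr x) (tr (suc d)) (tr (2 + d))) ⨾ comp (2 + d) p ⨾
     instr (const (tr (2 + d)) 1) ⨾ instr (add (tr (suc d)) (tr (suc d)) (tr (2 + d))))

-- Correctness and exact cost of the compilation

T⇒true : ∀ {b} → T b → b ≡ true
T⇒true {true} _ = refl

true⇒T : ∀ {b} → b ≡ true → T b
true⇒T refl = tt

≡ᵇ-refl : ∀ i → (i ≡ᵇ i) ≡ true
≡ᵇ-refl i = T⇒true (≡⇒≡ᵇ i i refl)

≢⇒≡ᵇ : ∀ {i j} → i ≢ j → (i ≡ᵇ j) ≡ false
≢⇒≡ᵇ {i} {j} i≢j with i ≡ᵇ j in eq
... | false = refl
... | true  = contradiction (≡ᵇ⇒≡ i j (true⇒T eq)) i≢j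

≤⇒≤ᵇ-true : ∀ {i j} → i ≤ j → (i ≤ᵇ j) ≡ true
≤⇒≤ᵇ-true = T⇒true ∘ ≤⇒≤ᵇ

>⇒≤ᵇ-false : ∀ {i j} → j < i → (i ≤ᵇ j) ≡ false
>⇒≤ᵇ-false {i} {j} j<i with i ≤ᵇ j in eq
... | false = refl
... | true  = contradiction (≤ᵇ⇒≤ i j (true⇒T eq)) (<⇒≱ j<i)

≤ᵇ-true⇒≤ : ∀ {i j} → (i ≤ᵇ j) ≡ true → i ≤ j
≤ᵇ-true⇒≤ {i} {j} eq = ≤ᵇ⇒≤ i j (true⇒T eq)

≤ᵇ-false⇒> : ∀ {i j} → (i ≤ᵇ j) ≡ false → j < i
≤ᵇ-false⇒> {i} {j} eq with j <? i
... | yes j<i = j<i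
... | no  j≮i with trans (sym eq) (≤⇒≤ᵇ-true (≮⇒≥ j≮i))
...   | ()

module _ {A : Set} (f : ℕ → A) where

  upd-same : ∀ i {a} → (f [ i ↦ a ]) i ≡ a
  upd-same i rewrite ≡ᵇ-refl i = refl

  upd-diff : ∀ {i j a} → j ≢ i → (f [ i ↦ a ]) j ≡ f j
  upd-diff j≢i rewrite ≢⇒≡ᵇ j≢i = refl

double-injective : ∀ {x y} → x + x ≡ y + y → x ≡ y
double-injective {zero}  {zero}  _  = refl
double-injective {suc x} {suc y} eq rewrite +-suc x x | +-suc y y =
  cong suc (double-injective (suc-injective (suc-injective eq)))

vr≢tr : ∀ x d → vr x ≢ tr d
vr≢tr (suc x) (suc d) eq rewrite +-suc x x | +-suc d d =
  vr≢tr x d (suc-injective (suc-injective eq))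
vr≢tr (suc x) zero eq rewrite +-suc x x with eq
... | ()

tr≢tr : ∀ {d e} → d < e → tr d ≢ tr e
tr≢tr d<e eq = <⇒≢ d<e (double-injective (suc-injective eq))

-- Temporaries form a stack: code at depth `d` spoils only those from `d` on, so a left operand held
-- at depth `d` survives the evaluation of the right operand at depth `suc d`.
record Keep (d : ℕ) (s s′ : State) : Set where
  field
    vars  : ∀ x → reg s′ (vr x) ≡ reg s (vr x)
    temps : ∀ {e} → e < d → reg s′ (tr e) ≡ reg s (tr e)
    mems  : mem s′ ≡ mem s
    wvars : ∀ x → wreg s′ (vr x) ≡ wreg s (vr x)
    wtemps : ∀ {e} → e < d → wreg s′ (tr e) ≡ wreg s (tr e)
    wmems : wmem s′ ≡ wmem s

keep-trans : ∀ {d s s′ s″} → Keep d s s′ → Keep d s′ s″ → Keep d s s″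
keep-trans p q = record
  { vars  = λ x → trans (Q.vars x) (P.vars x)
  ; temps = λ e<d → trans (Q.temps e<d) (P.temps e<d)
  ; mems  = trans Q.mems P.mems
  ; wvars = λ x → trans (Q.wvars x) (P.wvars x)
  ; wtemps = λ e<d → trans (Q.wtemps e<d) (P.wtemps e<d)
  ; wmems = trans Q.wmems P.wmems
  }
  where module P = Keep p; module Q = Keep q

keep-weaken : ∀ {d s s′} → Keep (suc d) s s′ → Keep d s s′
keep-weaken p = record
  { vars = vars; temps = temps ∘ m<n⇒m<1+n; mems = mems
  ; wvars = wvars; wtemps = wtemps ∘ m<n⇒m<1+n; wmems = wmems }
  where open Keep p

keep-set : ∀ {d e v s} → d ≤ e → Keep d s (set (tr e) v s)
keep-set {e = e} {s = s} d≤e = record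
  { vars = λ x → upd-diff (reg s) (vr≢tr x e)
  ; temps = λ e′<d → upd-diff (reg s) (tr≢tr (<-≤-trans e′<d d≤e))
  ; mems = refl; wvars = λ _ → refl; wtemps = λ _ → refl; wmems = refl }

keep-setʷ : ∀ {d e v s} → d ≤ e → Keep d s (setʷ (tr e) v s)
keep-setʷ {e = e} {s = s} d≤e = record
  { vars = λ _ → refl; temps = λ _ → refl; mems = refl
  ; wvars = λ x → upd-diff (wreg s) (vr≢tr x e)
  ; wtemps = λ e′<d → upd-diff (wreg s) (tr≢tr (<-≤-trans e′<d d≤e))
  ; wmems = refl }

-- The source state has no temporaries, hence odd registers are unconstrained.
record Sim (σ s : State) : Set where
  field
    vars  : ∀ x → reg s (vr x) ≡ reg σ x
    mems  : mem s ≡ mem σ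
    wvars : ∀ x → wreg s (vr x) ≡ wreg σ x
    wmems : wmem s ≡ wmem σ

sim-keep : ∀ {d σ s s′} → Sim σ s → Keep d s s′ → Sim σ s′
sim-keep S K = record
  { vars  = λ x → trans (K.vars x) (S.vars x)
  ; mems  = trans K.mems S.mems
  ; wvars = λ x → trans (K.wvars x) (S.wvars x)
  ; wmems = trans K.wmems S.wmems }
  where module K = Keep K; module S = Sim S

sim-set : ∀ {σ s v v′} x → v ≡ v′ → Sim σ s → Sim (set x v′ σ) (set (vr x) v s)
sim-set {σ} {s} x refl S = record
  { vars = vars′; mems = Sim.mems S; wvars = Sim.wvars S; wmems = Sim.wmems S }
  where
  vars′ : ∀ y → (reg s [ vr x ↦ _ ]) (vr y) ≡ (reg σ [ x ↦ _ ]) y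
  vars′ y with y ≟ x
  ... | yes refl = trans (upd-same (reg s) (vr x)) (sym (upd-same (reg σ) x))
  ... | no y≢x = trans (upd-diff (reg s) (y≢x ∘ double-injective))
                   (trans (Sim.vars S y) (sym (upd-diff (reg σ) y≢x)))

sim-setʷ : ∀ {σ s v v′} x → v ≡ v′ → Sim σ s → Sim (setʷ x v′ σ) (setʷ (vr x) v s)
sim-setʷ {σ} {s} x refl S = record
  { vars = Sim.vars S; mems = Sim.mems S; wvars = vars′; wmems = Sim.wmems S }
  where
  vars′ : ∀ y → (wreg s [ vr x ↦ _ ]) (vr y) ≡ (wreg σ [ x ↦ _ ]) y
  vars′ y with y ≟ x
  ... | yes refl = trans (upd-same (wreg s) (vr x)) (sym (upd-same (wreg σ) x))
  ... | no y≢x = trans (upd-diff (wreg s) (y≢x ∘ double-injective))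
                   (trans (Sim.wvars S y) (sym (upd-diff (wreg σ) y≢x)))

sim-setMem : ∀ {σ s a a′ v v′} → a ≡ a′ → v ≡ v′ → Sim σ s → Sim (setMem a′ v′ σ) (setMem a v s)
sim-setMem {a = a} {v = v} refl refl S = record
  { vars = Sim.vars S; mems = cong (_[ a ↦ v ]) (Sim.mems S); wvars = Sim.wvars S; wmems = Sim.wmems S }

sim-setMemʷ : ∀ {σ s a a′ v v′} → a ≡ a′ → v ≡ v′ → Sim σ s → Sim (setMemʷ a′ v′ σ) (setMemʷ a v s)
sim-setMemʷ {a = a} {v = v} refl refl S = record
  { vars = Sim.vars S; mems = Sim.mems S; wvars = Sim.wvars S; wmems = cong (_[ a ↦ v ]) (Sim.wmems S) }

record Computes (p : Program) (d t v : ℕ) (s : State) : Set where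
  constructor computes
  field
    {final} : State
    run   : Run p s t final
    value : reg final (tr d) ≡ v
    keep  : Keep d s final

record Computesʷ (p : Program) (d t : ℕ) (v : ℚ) (s : State) : Set where
  constructor computes
  field
    {final} : State
    run   : Run p s t final
    value : wreg final (tr d) ≡ v
    keep  : Keep d s final

toCell-correct : ∀ d a {B i s} → reg s (vr 0) ≡ B → reg s (tr d) ≡ i →
                 Computes (toCell d a) d 6 (cell B a i) s
toCell-correct d a {s = s} refl refl = computes
  (run-seq run-instr (run-seq run-instr (run-seq run-instr (run-seq run-instr (run-seq run-instr run-instr)))))
  value keep
  where
  open ≡-Reasoning
  s₁ = step (add (tr d) (tr d) (tr d)) s
  s₂ = step (add (tr d) (tr d) (tr d)) s₁
  s₃ = step (add (tr d) (tr d) (tr d)) s₂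
  s₄ = step (const (tr (suc d)) (toℕ a)) s₃
  s₅ = step (add (tr d) (tr (suc d)) (tr d)) s₄
  s₆ = step (add (tr d) (vr 0) (tr d)) s₅

  keep₅ : Keep d s s₅
  keep₅ = keep-trans (keep-set ≤-refl) (keep-trans (keep-set ≤-refl) (keep-trans (keep-set ≤-refl)
            (keep-trans (keep-set (n≤1+n d)) (keep-set ≤-refl))))
  keep : Keep d s s₆
  keep = keep-trans keep₅ (keep-set ≤-refl)

  i = reg s (tr d)
  v₁ : reg s₁ (tr d) ≡ i + i
  v₁ = upd-same (reg s) (tr d)
  v₂ : reg s₂ (tr d) ≡ (i + i) + (i + i)
  v₂ = trans (upd-same (reg s₁) (tr d)) (cong₂ _+_ v₁ v₁)
  v₃ : reg s₃ (tr d) ≡ ((i + i) + (i + i)) + ((i + i) + (i + i))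
  v₃ = trans (upd-same (reg s₂) (tr d)) (cong₂ _+_ v₂ v₂)
  v₄ : reg s₄ (tr d) ≡ ((i + i) + (i + i)) + ((i + i) + (i + i))
  v₄ = trans (upd-diff (reg s₃) (tr≢tr (n<1+n d))) v₃
  v₅ : reg s₅ (tr d) ≡ toℕ a + (((i + i) + (i + i)) + ((i + i) + (i + i)))
  v₅ = trans (upd-same (reg s₄) (tr d)) (cong₂ _+_ (upd-same (reg s₃) (tr (suc d))) v₄)
  eight : ∀ i → ((i + i) + (i + i)) + ((i + i) + (i + i)) ≡ i * 8
  eight = solve-∀
  value : reg s₆ (tr d) ≡ cell (reg s (vr 0)) a i
  value = trans (upd-same (reg s₅) (tr d))
    (cong₂ _+_ (Keep.vars keep₅ 0) (trans v₅ (cong (toℕ a +_) (eight i))))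

compE-correct : ∀ d e {σ s} → Sim σ s → Computes (compE d e) d (costE e) (eval e σ) s
compE-correct d (lit k) {s = s} S = computes run-instr (upd-same (reg s) (tr d)) (keep-set ≤-refl)
compE-correct d (var x) {s = s} S = computes (run-seq run-instr run-instr)
  (trans (upd-same (reg s₁) (tr d)) (cong₂ _+_ (upd-same (reg s) (tr d)) (trans (Keep.vars k x) (Sim.vars S x))))
  (keep-trans k (keep-set ≤-refl))
  where
  s₁ = step (const (tr d) 0) s
  k : Keep d s s₁
  k = keep-set ≤-refl
compE-correct d (e ⊕ f) {σ} S with compE-correct d e S
... | computes {s₁} r₁ v₁ k₁ with compE-correct (suc d) f (sim-keep S k₁)
...   | computes {s₂} r₂ v₂ k₂ = computes (run-seq r₁ (run-seq r₂ run-instr))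
  (trans (upd-same (reg s₂) (tr d)) (cong₂ _+_ (trans (Keep.temps k₂ (n<1+n d)) v₁) v₂))
  (keep-trans k₁ (keep-trans (keep-weaken k₂) (keep-set ≤-refl)))
compE-correct d (e ⊖ f) S with compE-correct d e S
... | computes {s₁} r₁ v₁ k₁ with compE-correct (suc d) f (sim-keep S k₁)
...   | computes {s₂} r₂ v₂ k₂ = computes (run-seq r₁ (run-seq r₂ run-instr))
  (trans (upd-same (reg s₂) (tr d)) (cong₂ _∸_ (trans (Keep.temps k₂ (n<1+n d)) v₁) v₂))
  (keep-trans k₁ (keep-trans (keep-weaken k₂) (keep-set ≤-refl)))
compE-correct d (inp e) S with compE-correct d e S
... | computes {s₁} r₁ v₁ k₁ = computes (run-seq r₁ run-instr)
  (trans (upd-same (reg s₁) (tr d)) (cong₂ (λ m i → m i) (Sim.mems (sim-keep S k₁)) v₁))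
  (keep-trans k₁ (keep-set ≤-refl))
compE-correct d (a at e) S with compE-correct d e S
... | computes {s₁} r₁ v₁ k₁ with toCell-correct d a (Sim.vars (sim-keep S k₁) 0) v₁
...   | computes {s₂} r₂ v₂ k₂ = computes (run-seq r₁ (run-seq r₂ run-instr))
  (trans (upd-same (reg s₂) (tr d)) (cong₂ (λ m i → m i) (Sim.mems (sim-keep S (keep-trans k₁ k₂))) v₂))
  (keep-trans k₁ (keep-trans k₂ (keep-set ≤-refl)))

compW-correct : ∀ d e {σ s} → Sim σ s → Computesʷ (compW d e) d (costW e) (evalʷ e σ) s
compW-correct d wnil {s = s} S = computes run-instr (upd-same (wreg s) (tr d)) (keep-setʷ ≤-refl)
compW-correct d (wvar x) {s = s} S = computes (run-seq run-instr run-instr)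
  (trans (upd-same (wreg s₁) (tr d))
    (trans (cong₂ ℚ._+_ (upd-same (wreg s) (tr d)) (trans (Keep.wvars k x) (Sim.wvars S x))) (ℚₚ.+-identityˡ _)))
  (keep-trans k (keep-setʷ ≤-refl))
  where
  s₁ = step (wzero (tr d)) s
  k : Keep d s s₁
  k = keep-setʷ ≤-refl
compW-correct d (winp e) S with compE-correct d e S
... | computes {s₁} r₁ v₁ k₁ = computes (run-seq r₁ run-instr)
  (trans (upd-same (wreg s₁) (tr d)) (cong₂ (λ m i → m i) (Sim.wmems (sim-keep S k₁)) v₁))
  (keep-trans k₁ (keep-setʷ ≤-refl))
compW-correct d (wtab e) S with compE-correct d e S
... | computes {s₁} r₁ v₁ k₁ = computes (run-seq r₁ (run-seq run-instr run-instr))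
  (trans (upd-same (wreg s₁) (tr d))
    (cong₂ (λ m i → m i) (Sim.wmems S₁)
      (trans (upd-same (reg s₁) (tr d)) (cong₂ _+_ (Sim.vars S₁ 0) v₁))))
  (keep-trans k₁ (keep-trans (keep-set ≤-refl) (keep-setʷ ≤-refl)))
  where S₁ = sim-keep S k₁
compW-correct d (e ⊞ f) S with compW-correct d e S
... | computes {s₁} r₁ v₁ k₁ with compW-correct (suc d) f (sim-keep S k₁)
...   | computes {s₂} r₂ v₂ k₂ = computes (run-seq r₁ (run-seq r₂ run-instr))
  (trans (upd-same (wreg s₂) (tr d)) (cong₂ ℚ._+_ (trans (Keep.wtemps k₂ (n<1+n d)) v₁) v₂))
  (keep-trans k₁ (keep-trans (keep-weaken k₂) (keep-setʷ ≤-refl)))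

-- What must survive a whole command is the counters and bounds of the enclosing loops, and these
-- are natural temporaries.
record Simulates (p : Program) (d t : ℕ) (σ s : State) : Set where
  constructor simulates
  field
    {final} : State
    run   : Run p s t final
    sim   : Sim σ final
    temps : ∀ {e} → e < d → reg final (tr e) ≡ reg s (tr e)

comp-correct : ∀ d p {σ s} → Sim σ s → Simulates (comp d p) d (cost p σ) (⟦ p ⟧ σ) s
iteration : ℕ → ℕ → Cmd → Program
iteration d x p =
  instr (const (tr (2 + d)) 1) ⨾ instr (sub (vr x) (tr (suc d)) (tr (2 + d))) ⨾ comp (2 + d) p ⨾
  instr (const (tr (2 + d)) 1) ⨾ instr (add (tr (suc d)) (tr (suc d)) (tr (2 + d)))

iteration-correct : ∀ d x p i {σ s} → Sim σ s → reg s (tr (suc d)) ≡ suc i →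
  Σ (Simulates (iteration d x p) (suc d) (1 + (1 + (cost p (set x i σ) + 2))) (⟦ p ⟧ (set x i σ)) s)
    λ r → reg (Simulates.final r) (tr (suc d)) ≡ suc (suc i)
-- Stated for a loop resumed at round `i`, so that the induction on the `m` remaining rounds goes
-- through.
loop-correct : ∀ d x p i m {σ s} → Sim σ s → reg s (tr (suc d)) ≡ suc i → reg s (tr d) ≡ i + m →
               Simulates (while (leq (tr (suc d)) (tr d)) (iteration d x p))
                 d (iterCost ⟦ p ⟧ (cost p) x i m σ) (iter ⟦ p ⟧ x i m σ) s

comp-correct d skip S = simulates run-instr (sim-keep S k) (Keep.temps k)
  where k = keep-set {d} ≤-refl
comp-correct d (x ≔ e) S with compE-correct d e S
... | computes {s₁} r₁ v₁ k₁ = simulates (run-seq r₁ (run-seq run-instr run-instr))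
  (sim-set x (trans (cong₂ _+_ (trans (upd-diff (reg s₁) (tr≢tr (n<1+n d))) v₁) (upd-same (reg s₁) (tr (suc d)))) (+-identityʳ _))
    (sim-keep S k₂))
  (λ {e} e<d → trans (upd-diff (reg (set (tr (suc d)) 0 s₁)) (vr≢tr x e ∘ sym)) (Keep.temps k₂ e<d))
  where k₂ = keep-trans k₁ (keep-set {d} {suc d} {0} (n≤1+n d))
comp-correct d (a [ e ]≔ f) {σ} S with compE-correct d e S
... | computes {s₁} r₁ v₁ k₁ with toCell-correct d a (Sim.vars (sim-keep S k₁) 0) v₁
...   | computes {s₂} r₂ v₂ k₂ with compE-correct (suc d) f (sim-keep S (keep-trans k₁ k₂))
...     | computes {s₃} r₃ v₃ k₃ = simulates (run-seq r₁ (run-seq r₂ (run-seq r₃ run-instr)))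
  (sim-setMem (trans (Keep.temps k₃ (n<1+n d)) v₂) v₃ (sim-keep S k))
  (Keep.temps k)
  where k = keep-trans k₁ (keep-trans k₂ (keep-weaken k₃))
comp-correct d (out e f) S with compE-correct d e S
... | computes {s₁} r₁ v₁ k₁ with compE-correct (suc d) f (sim-keep S k₁)
...   | computes {s₂} r₂ v₂ k₂ = simulates (run-seq r₁ (run-seq r₂ run-instr))
  (sim-setMem (trans (Keep.temps k₂ (n<1+n d)) v₁) v₂ (sim-keep S k))
  (Keep.temps k)
  where k = keep-trans k₁ (keep-weaken k₂)
comp-correct d (x ≔ʷ e) S with compW-correct d e S
... | computes {s₁} r₁ v₁ k₁ = simulates (run-seq r₁ (run-seq run-instr run-instr))
  (sim-setʷ x (trans (cong₂ ℚ._+_ (trans (upd-diff (wreg s₁) (tr≢tr (n<1+n d))) v₁) (upd-same (wreg s₁) (tr (suc d)))) (ℚₚ.+-identityʳ _))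
    (sim-keep S k₂))
  (Keep.temps k₂)
  where k₂ = keep-trans k₁ (keep-setʷ {d} {suc d} {0ℚ} (n≤1+n d))
comp-correct d (tab[ e ]≔ f) S with compE-correct d e S
... | computes {s₁} r₁ v₁ k₁ with compW-correct (suc d) f (sim-keep (sim-keep S k₁) (keep-set {d} {d} {reg s₁ (vr 0) + reg s₁ (tr d)} ≤-refl))
...   | computes {s₂} r₂ v₂ k₂ = simulates (run-seq r₁ (run-seq run-instr (run-seq r₂ run-instr)))
  (sim-setMemʷ (trans (Keep.temps k₂ (n<1+n d)) (trans (upd-same (reg s₁) (tr d)) (cong₂ _+_ (Sim.vars (sim-keep S k₁) 0) v₁)))
    v₂ (sim-keep S k))
  (Keep.temps k)
  where k = keep-trans k₁ (keep-trans (keep-set ≤-refl) (keep-weaken k₂))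
comp-correct d (p ⨟ q) S with comp-correct d p S
... | simulates r₁ S₁ t₁ with comp-correct d q S₁
...   | simulates r₂ S₂ t₂ = simulates (run-seq r₁ r₂) S₂ (λ e<d → trans (t₂ e<d) (t₁ e<d))
comp-correct d (if≤ e f p q) {σ} S with compE-correct d e S
... | computes {s₁} r₁ v₁ k₁ with compE-correct (suc d) f (sim-keep S k₁)
...   | computes {s₂} r₂ v₂ k₂ with eval e σ ≤ᵇ eval f σ in eq
...     | true with comp-correct d p (sim-keep S (keep-trans k₁ (keep-weaken k₂)))
...       | simulates r₃ S₃ t₃ = simulates
  (run-seq r₁ (run-seq r₂ (run-if-yes (trans (cong₂ _≤ᵇ_ (trans (Keep.temps k₂ (n<1+n d)) v₁) v₂) eq) r₃)))
  S₃ (λ e<d → trans (t₃ e<d) (Keep.temps (keep-trans k₁ (keep-weaken k₂)) e<d))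
comp-correct d (if≤ e f p q) {σ} S
    | computes {s₁} r₁ v₁ k₁ | computes {s₂} r₂ v₂ k₂ | false with comp-correct d q (sim-keep S (keep-trans k₁ (keep-weaken k₂)))
...       | simulates r₃ S₃ t₃ = simulates
  (run-seq r₁ (run-seq r₂ (run-if-no (trans (cong₂ _≤ᵇ_ (trans (Keep.temps k₂ (n<1+n d)) v₁) v₂) eq) r₃)))
  S₃ (λ e<d → trans (t₃ e<d) (Keep.temps (keep-trans k₁ (keep-weaken k₂)) e<d))
comp-correct d (if≤ʷ e f p q) {σ} S with compW-correct d e S
... | computes {s₁} r₁ v₁ k₁ with compW-correct (suc d) f (sim-keep S k₁)
...   | computes {s₂} r₂ v₂ k₂ with evalʷ e σ ℚ.≤ᵇ evalʷ f σ in eq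
...     | true with comp-correct d p (sim-keep S (keep-trans k₁ (keep-weaken k₂)))
...       | simulates r₃ S₃ t₃ = simulates
  (run-seq r₁ (run-seq r₂ (run-if-yes (trans (cong₂ ℚ._≤ᵇ_ (trans (Keep.wtemps k₂ (n<1+n d)) v₁) v₂) eq) r₃)))
  S₃ (λ e<d → trans (t₃ e<d) (Keep.temps (keep-trans k₁ (keep-weaken k₂)) e<d))
comp-correct d (if≤ʷ e f p q) {σ} S
    | computes {s₁} r₁ v₁ k₁ | computes {s₂} r₂ v₂ k₂ | false with comp-correct d q (sim-keep S (keep-trans k₁ (keep-weaken k₂)))
...       | simulates r₃ S₃ t₃ = simulates
  (run-seq r₁ (run-seq r₂ (run-if-no (trans (cong₂ ℚ._≤ᵇ_ (trans (Keep.wtemps k₂ (n<1+n d)) v₁) v₂) eq) r₃)))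
  S₃ (λ e<d → trans (t₃ e<d) (Keep.temps (keep-trans k₁ (keep-weaken k₂)) e<d))
comp-correct d (for x e p) {σ} S with compE-correct d e S
... | computes {s₁} r₁ v₁ k₁ with loop-correct d x p 0 (eval e σ)
          (sim-keep (sim-keep S k₁) k₂) (upd-same (reg s₁) (tr (suc d)))
          (trans (Keep.temps k₂ (n<1+n d)) v₁)
      where k₂ = keep-set {suc d} {suc d} {1} {s₁} ≤-refl
...   | simulates r₃ S₃ t₃ = simulates (run-seq r₁ (run-seq run-instr r₃)) S₃
  (λ e<d → trans (t₃ e<d) (Keep.temps (keep-trans k₁ (keep-set (n≤1+n d))) e<d))

loop-correct d x p i zero {s = s} S ic im = simulates
  (run-done (trans (cong₂ _≤ᵇ_ ic (trans im (+-identityʳ i))) (>⇒≤ᵇ-false (n<1+n i)))) S (λ _ → refl)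
loop-correct d x p i (suc m) {σ} {s} S ic im with iteration-correct d x p i S ic
... | simulates {s₁} r₁ S₁ t₁ , ic₁ with loop-correct d x p (suc i) m S₁ ic₁ (trans (t₁ (n<1+n d)) (trans im (+-suc i m)))
...   | simulates r₂ S₂ t₂ = simulates
  (run-loop (trans (cong₂ _≤ᵇ_ ic im) (≤⇒≤ᵇ-true (≤-trans (s≤s (m≤m+n i m)) (≤-reflexive (sym (+-suc i m))))))
    r₁ r₂)
  S₂ (λ e<d → trans (t₂ e<d) (t₁ (m<n⇒m<1+n e<d)))

iteration-correct d x p i {σ} {s} S ic with comp-correct (2 + d) p S₂
  where
  s₁ = set (tr (2 + d)) 1 s
  k₁ : Keep (2 + d) s s₁
  k₁ = keep-set ≤-refl
  S₂ : Sim (set x i σ) (step (sub (vr x) (tr (suc d)) (tr (2 + d))) s₁)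
  S₂ = sim-set x (cong₂ _∸_ (trans (Keep.temps k₁ (n<1+n _)) ic) (upd-same (reg s) (tr (2 + d)))) (sim-keep S k₁)
... | simulates {s₃} r₃ S₃ t₃ =
  simulates (run-seq run-instr (run-seq run-instr (run-seq r₃ (run-seq run-instr run-instr))))
    (sim-keep S₃ k₄) (λ {e} e<d → trans (Keep.temps k₄ e<d) (back e (<⇒≤ e<d)))
  , trans (upd-same (reg s₄) (tr (suc d))) (trans (cong₂ _+_ ic₄ (upd-same (reg s₃) (tr (2 + d)))) (+-comm _ 1))
  where
  s₁ = set (tr (2 + d)) 1 s
  s₄ = set (tr (2 + d)) 1 s₃
  k₄ : Keep (suc d) s₃ (step (add (tr (suc d)) (tr (suc d)) (tr (2 + d))) s₄)
  k₄ = keep-trans (keep-set (n≤1+n _)) (keep-set ≤-refl)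
  back : ∀ e → e ≤ suc d → reg s₃ (tr e) ≡ reg s (tr e)
  back e e≤ = trans (t₃ (s≤s e≤)) (trans (upd-diff (reg s₁) (vr≢tr x e ∘ sym)) (upd-diff (reg s) (tr≢tr (s≤s e≤))))
  ic₄ : reg s₄ (tr (suc d)) ≡ suc i
  ic₄ = trans (upd-diff (reg s₃) (tr≢tr (n<1+n (suc d)))) (trans (back (suc d) ≤-refl) ic)

-- Footprints and specifications of commands

arr : State → Fin 8 → ℕ → ℕ
arr σ a i = mem σ (cell (reg σ 0) a i)

tab : State → ℕ → ℚ
tab σ i = wmem σ (reg σ 0 + i)

-- Uniqueness of division with remainder. It separates the interleaved arrays, with `H` equal to 8,
-- and later splits a key into strip and row, with `H` the height of the grid.
digits-injective : ∀ {H r r′} a a′ → r < H → r′ < H → r + a * H ≡ r′ + a′ * H → a ≡ a′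
digits-injective zero zero _ _ _ = refl
digits-injective {H} {r} {r′} zero (suc a′) r<H _ eq =
  contradiction (≤-trans (m≤m+n H (a′ * H)) (≤-trans (m≤n+m (H + a′ * H) r′) (≤-reflexive (trans (sym eq) (+-identityʳ r))))) (<⇒≱ r<H)
digits-injective {H} {r} {r′} (suc a) zero _ r′<H eq =
  contradiction (≤-trans (m≤m+n H (a * H)) (≤-trans (m≤n+m (H + a * H) r) (≤-reflexive (trans eq (+-identityʳ r′))))) (<⇒≱ r′<H)
digits-injective {H} {r} {r′} (suc a) (suc a′) r<H r′<H eq =
  cong suc (digits-injective a a′ r<H r′<H (+-cancelˡ-≡ H _ _ (trans (sym (shift r H a)) (trans eq (shift r′ H a′)))))
  where
  shift : ∀ r H a → r + (1 + a) * H ≡ H + (r + a * H)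
  shift = solve-∀

cell-injective : ∀ B {a b} i j → cell B a i ≡ cell B b j → a ≡ b × i ≡ j
cell-injective B {a} {b} i j eq = Finₚ.toℕ-injective (+-cancelʳ-≡ (i * 8) _ _ (trans eq′ (cong (λ j → toℕ b + j * 8) (sym i≡j)))) , i≡j
  where
  eq′ : toℕ a + i * 8 ≡ toℕ b + j * 8
  eq′ = +-cancelˡ-≡ B _ _ eq
  i≡j : i ≡ j
  i≡j = digits-injective i j (Finₚ.toℕ<n a) (Finₚ.toℕ<n b) eq′

module _ (m : ℕ → ℕ) (B : ℕ) (a : Fin 8) (i : ℕ) {v : ℕ} where

  store-same : ∀ {j} → j ≡ i → (m [ cell B a i ↦ v ]) (cell B a j) ≡ v
  store-same refl = upd-same m (cell B a i)

  store-index : ∀ {j} → j ≢ i → (m [ cell B a i ↦ v ]) (cell B a j) ≡ m (cell B a j)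
  store-index {j} j≢i = upd-diff m (j≢i ∘ proj₂ ∘ cell-injective B {a} {a} j i)

  store-array : ∀ {b} j → b ≢ a → (m [ cell B a i ↦ v ]) (cell B b j) ≡ m (cell B b j)
  store-array {b} j b≢a = upd-diff m (b≢a ∘ proj₁ ∘ cell-injective B {b} {a} j i)

  store-below : ∀ {j} → j < B → (m [ cell B a i ↦ v ]) j ≡ m j
  store-below j<B = upd-diff m (<⇒≢ (<-≤-trans j<B (m≤m+n B _)))

-- The fields are Booleans, so that for a concrete command every side condition of a frame is closed
-- by `refl`. `clean` says that neither register 0, to which all array addresses are relative, nor a
-- raw address is written.
record Footprint : Set where
  field
    modifies  : ℕ → Bool
    modifiesʷ : ℕ → Bool
    stores    : Fin 8 → Bool
    storesʷ   : Bool
    clean     : Bool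

open Footprint

∅ : Footprint
∅ = record { modifies = λ _ → false; modifiesʷ = λ _ → false; stores = λ _ → false; storesʷ = false; clean = true }

_∪_ : Footprint → Footprint → Footprint
F ∪ G = record
  { modifies  = λ x → modifies F x ∨ modifies G x
  ; modifiesʷ = λ x → modifiesʷ F x ∨ modifiesʷ G x
  ; stores    = λ a → stores F a ∨ stores G a
  ; storesʷ   = storesʷ F ∨ storesʷ G
  ; clean     = clean F ∧ clean G }

assigns : ℕ → Footprint
assigns x = record ∅ { modifies = λ y → y ≡ᵇ x; clean = not (0 ≡ᵇ x) }

foot : Cmd → Footprint
foot skip            = ∅
foot (x ≔ e)         = assigns x
foot (a [ e ]≔ f)    = record ∅ { stores = λ b → toℕ b ≡ᵇ toℕ a }
foot (out e f)       = record ∅ { stores = λ _ → true; clean = false }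
foot (x ≔ʷ e)        = record ∅ { modifiesʷ = λ y → y ≡ᵇ x }
foot (tab[ e ]≔ f)   = record ∅ { storesʷ = true }
foot (p ⨟ q)         = foot p ∪ foot q
foot (if≤ e f p q)   = foot p ∪ foot q
foot (if≤ʷ e f p q)  = foot p ∪ foot q
foot (for x e p)     = assigns x ∪ foot p

record Frame (F : Footprint) (σ τ : State) : Set where
  field
    regs  : ∀ x → modifies F x ≡ false → reg τ x ≡ reg σ x
    wregs : ∀ x → modifiesʷ F x ≡ false → wreg τ x ≡ wreg σ x
    base  : clean F ≡ true → reg τ 0 ≡ reg σ 0
    arrs  : clean F ≡ true → ∀ a → stores F a ≡ false → ∀ i → arr τ a i ≡ arr σ a i
    inps  : clean F ≡ true → ∀ {j} → j < reg σ 0 → mem τ j ≡ mem σ j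
    tabs  : clean F ≡ true → storesʷ F ≡ false → ∀ i → tab τ i ≡ tab σ i
    winps : clean F ≡ true → ∀ {j} → j < reg σ 0 → wmem τ j ≡ wmem σ j

frame-refl : ∀ {F σ} → Frame F σ σ
frame-refl = record
  { regs = λ _ _ → refl; wregs = λ _ _ → refl; base = λ _ → refl; arrs = λ _ _ _ _ → refl
  ; inps = λ _ _ → refl; tabs = λ _ _ _ → refl; winps = λ _ _ → refl }

frame-trans : ∀ {F σ τ υ} → Frame F σ τ → Frame F τ υ → Frame F σ υ
frame-trans p q = record
  { regs  = λ x f → trans (Q.regs x f) (P.regs x f)
  ; wregs = λ x f → trans (Q.wregs x f) (P.wregs x f)
  ; base  = λ c → trans (Q.base c) (P.base c)
  ; arrs  = λ c a f i → trans (Q.arrs c a f i) (P.arrs c a f i)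
  ; inps  = λ c j< → trans (Q.inps c (subst (_ <_) (sym (P.base c)) j<)) (P.inps c j<)
  ; tabs  = λ c f i → trans (Q.tabs c f i) (P.tabs c f i)
  ; winps = λ c j< → trans (Q.winps c (subst (_ <_) (sym (P.base c)) j<)) (P.winps c j<) }
  where module P = Frame p; module Q = Frame q

∨-falseˡ : ∀ {a b} → a ∨ b ≡ false → a ≡ false
∨-falseˡ {false} _ = refl

∨-falseʳ : ∀ {a b} → a ∨ b ≡ false → b ≡ false
∨-falseʳ {false} eq = eq

∧-trueˡ : ∀ {a b} → a ∧ b ≡ true → a ≡ true
∧-trueˡ {true} _ = refl

∧-trueʳ : ∀ {a b} → a ∧ b ≡ true → b ≡ true
∧-trueʳ {true} eq = eq

frame-∪ˡ : ∀ {F G σ τ} → Frame F σ τ → Frame (F ∪ G) σ τ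
frame-∪ˡ {F} {G} p = record
  { regs = λ x → regs x ∘ ∨-falseˡ; wregs = λ x → wregs x ∘ ∨-falseˡ; base = base ∘ ∧-trueˡ
  ; arrs = λ c a → arrs (∧-trueˡ c) a ∘ ∨-falseˡ; inps = λ c → inps (∧-trueˡ c)
  ; tabs = λ c → tabs (∧-trueˡ c) ∘ ∨-falseˡ; winps = λ c → winps (∧-trueˡ c) }
  where open Frame p

frame-∪ʳ : ∀ {F G σ τ} → Frame G σ τ → Frame (F ∪ G) σ τ
frame-∪ʳ {F} {G} p = record
  { regs = λ x → regs x ∘ ∨-falseʳ {modifies F x}; wregs = λ x → wregs x ∘ ∨-falseʳ {modifiesʷ F x}
  ; base = base ∘ ∧-trueʳ {clean F}
  ; arrs = λ c a → arrs (∧-trueʳ {clean F} c) a ∘ ∨-falseʳ {stores F a}; inps = λ c → inps (∧-trueʳ {clean F} c)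
  ; tabs = λ c → tabs (∧-trueʳ {clean F} c) ∘ ∨-falseʳ {storesʷ F}; winps = λ c → winps (∧-trueʳ {clean F} c) }
  where open Frame p

≡ᵇ-false⇒≢ : ∀ {i j} → (i ≡ᵇ j) ≡ false → i ≢ j
≡ᵇ-false⇒≢ {i} eq refl with trans (sym eq) (≡ᵇ-refl i)
... | ()

not-true⇒false : ∀ {b} → not b ≡ true → b ≡ false
not-true⇒false {false} _ = refl

frame-set : ∀ x v σ → Frame (assigns x) σ (set x v σ)
frame-set x v σ = record
  { regs = λ y f → upd-diff (reg σ) (≡ᵇ-false⇒≢ f); wregs = λ _ _ → refl
  ; base = base
  ; arrs = λ c a _ i → cong (λ B → mem σ (cell B a i)) (base c)
  ; inps = λ _ _ → refl
  ; tabs = λ c _ i → cong (λ B → wmem σ (B + i)) (base c); winps = λ _ _ → refl }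
  where
  base : not (0 ≡ᵇ x) ≡ true → reg (set x v σ) 0 ≡ reg σ 0
  base c = upd-diff (reg σ) {x} {0} (≡ᵇ-false⇒≢ (not-true⇒false c))

frame-iter : ∀ {F} f x → (∀ σ → Frame F σ (f σ)) → ∀ i m σ → Frame (assigns x ∪ F) σ (iter f x i m σ)
frame-iter f x fr i zero    σ = frame-refl
frame-iter f x fr i (suc m) σ =
  frame-trans (frame-∪ˡ (frame-set x i σ)) (frame-trans (frame-∪ʳ {assigns x} (fr (set x i σ))) (frame-iter f x fr (suc i) m _))

-- Established once for all commands, so that a specification has to mention only what changes;
-- `weaken`, `andThen` and `forSpec` pass the frame on.
frame : ∀ p σ → Frame (foot p) σ (⟦ p ⟧ σ)
frame skip σ = frame-refl
frame (x ≔ e) σ = frame-set x (eval e σ) σ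
frame (a [ e ]≔ f) σ = record
  { regs = λ _ _ → refl; wregs = λ _ _ → refl; base = λ _ → refl
  ; arrs = λ _ b f i → store-array (mem σ) (reg σ 0) a (eval e σ) i (λ b≡a → ≡ᵇ-false⇒≢ f (cong toℕ b≡a))
  ; inps = λ _ → store-below (mem σ) (reg σ 0) a (eval e σ)
  ; tabs = λ _ _ _ → refl; winps = λ _ _ → refl }
frame (out e f) σ = record
  { regs = λ _ _ → refl; wregs = λ _ _ → refl; base = λ _ → refl; arrs = λ ()
  ; inps = λ (); tabs = λ (); winps = λ () }
frame (x ≔ʷ e) σ = record
  { regs = λ _ _ → refl; wregs = λ y f → upd-diff (wreg σ) (≡ᵇ-false⇒≢ f); base = λ _ → refl
  ; arrs = λ _ _ _ _ → refl; inps = λ _ _ → refl; tabs = λ _ _ _ → refl; winps = λ _ _ → refl }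
frame (tab[ e ]≔ f) σ = record
  { regs = λ _ _ → refl; wregs = λ _ _ → refl; base = λ _ → refl
  ; arrs = λ _ _ _ _ → refl; inps = λ _ _ → refl; tabs = λ _ ()
  ; winps = λ _ j< → upd-diff (wmem σ) (<⇒≢ (<-≤-trans j< (m≤m+n _ _))) }
frame (p ⨟ q) σ = frame-trans (frame-∪ˡ (frame p σ)) (frame-∪ʳ {foot p} (frame q (⟦ p ⟧ σ)))
frame (if≤ e f p q) σ with eval e σ ≤ᵇ eval f σ
... | true  = frame-∪ˡ (frame p σ)
... | false = frame-∪ʳ {foot p} (frame q σ)
frame (if≤ʷ e f p q) σ with evalʷ e σ ℚ.≤ᵇ evalʷ f σ
... | true  = frame-∪ˡ (frame p σ)
... | false = frame-∪ʳ {foot p} (frame q σ)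
frame (for x e p) σ = frame-iter ⟦ p ⟧ x (frame p) 0 (eval e σ) σ

-- All loops are bounded, so `⟦_⟧` is a total function and a specification can speak about its
-- value; `comp-correct` turns this into a halting run.
record Spec (p : Cmd) (σ : State) (t : ℕ) (Q : State → Set) : Set where
  constructor spec
  field
    time : cost p σ ≤ t
    post : Q (⟦ p ⟧ σ)

now : ∀ {p σ Q} → Q (⟦ p ⟧ σ) → Spec p σ (cost p σ) Q
now q = spec ≤-refl q

weaken : ∀ {p σ t t′ Q Q′} → t ≤ t′ → (∀ τ → Frame (foot p) σ τ → Q τ → Q′ τ) → Spec p σ t Q → Spec p σ t′ Q′
weaken {p} {σ} t≤t′ Q⇒Q′ (spec c q) = spec (≤-trans c t≤t′) (Q⇒Q′ _ (frame p σ) q)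

within : ∀ {p σ t t′ Q} → t ≤ t′ → Spec p σ t Q → Spec p σ t′ Q
within t≤t′ (spec c q) = spec (≤-trans c t≤t′) q

andThen : ∀ {p q σ t t′ Q Q′} → Spec p σ t Q →
          (∀ τ → Frame (foot p) σ τ → Q τ → Spec q τ t′ Q′) → Spec (p ⨟ q) σ (t + t′) Q′
andThen {p} {σ = σ} (spec c q) next with next _ (frame p σ) q
... | spec c′ q′ = spec (+-mono-≤ c c′) q′

first : ∀ {p q σ t Q} → Spec q (⟦ p ⟧ σ) t Q → Spec (p ⨟ q) σ (cost p σ + t) Q
first (spec c q) = spec (+-monoʳ-≤ _ c) q

branch : ∀ {e f p q σ t Q} →
         (eval e σ ≤ eval f σ → Spec p σ t Q) → (eval f σ < eval e σ → Spec q σ t Q) →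
         Spec (if≤ e f p q) σ (costE e + (costE f + suc t)) Q
branch {e} {f} {p} {q} {σ} {t} {Q} P R = spec (proj₁ both) (proj₂ both)
  where
  both : costE e + (costE f + suc (if eval e σ ≤ᵇ eval f σ then cost p σ else cost q σ)) ≤ costE e + (costE f + suc t)
         × Q (if eval e σ ≤ᵇ eval f σ then ⟦ p ⟧ σ else ⟦ q ⟧ σ)
  both with eval e σ ≤ᵇ eval f σ in eq
  ... | true  = let spec c r = P (≤ᵇ-true⇒≤ eq)  in +-monoʳ-≤ (costE e) (+-monoʳ-≤ (costE f) (s≤s c)) , r
  ... | false = let spec c r = R (≤ᵇ-false⇒> eq) in +-monoʳ-≤ (costE e) (+-monoʳ-≤ (costE f) (s≤s c)) , r

branchʷ : ∀ {e f p q σ t Q} →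
         (evalʷ e σ ℚ.≤ evalʷ f σ → Spec p σ t Q) → (evalʷ f σ ℚ.≤ evalʷ e σ → Spec q σ t Q) →
         Spec (if≤ʷ e f p q) σ (costW e + (costW f + suc t)) Q
branchʷ {e} {f} {p} {q} {σ} {t} {Q} P R = spec (proj₁ both) (proj₂ both)
  where
  f≤e : (evalʷ e σ ℚ.≤ᵇ evalʷ f σ) ≡ false → evalʷ f σ ℚ.≤ evalʷ e σ
  f≤e eq with ℚₚ.≤-total (evalʷ f σ) (evalʷ e σ)
  ... | inj₁ le = le
  ... | inj₂ ge with trans (sym eq) (T⇒true (ℚₚ.≤⇒≤ᵇ ge))
  ...   | ()
  both : costW e + (costW f + suc (if evalʷ e σ ℚ.≤ᵇ evalʷ f σ then cost p σ else cost q σ)) ≤ costW e + (costW f + suc t)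
         × Q (if evalʷ e σ ℚ.≤ᵇ evalʷ f σ then ⟦ p ⟧ σ else ⟦ q ⟧ σ)
  both with evalʷ e σ ℚ.≤ᵇ evalʷ f σ in eq
  ... | true  = let spec c r = P (ℚₚ.≤ᵇ⇒≤ (true⇒T eq)) in +-monoʳ-≤ (costW e) (+-monoʳ-≤ (costW f) (s≤s c)) , r
  ... | false = let spec c r = R (f≤e eq) in +-monoʳ-≤ (costW e) (+-monoʳ-≤ (costW f) (s≤s c)) , r

-- Every round also receives the frame from the state before the loop, so the invariant need not
-- repeat facts that the loop cannot affect.
forSpec : ∀ {x e p σ} N t (Inv : ℕ → State → Set) → eval e σ ≡ N → Inv 0 σ →
          (∀ i τ → i < N → Frame (foot (for x e p)) σ τ → Inv i τ → Spec p (set x i τ) t (Inv (suc i))) →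
          Spec (for x e p) σ (costE e + 2 + N * (5 + t)) (Inv N)
forSpec {x} {e} {p} {σ} N t Inv refl init step =
  spec (≤-trans (+-monoʳ-≤ (costE e) (s≤s (proj₁ all))) (≤-reflexive (sym (+-assoc (costE e) 2 _)))) (proj₂ all)
  where
  go : ∀ m i τ → i + m ≡ N → Frame (foot (for x e p)) σ τ → Inv i τ →
       iterCost ⟦ p ⟧ (cost p) x i m τ ≤ suc (m * (5 + t)) × Inv N (iter ⟦ p ⟧ x i m τ)
  go zero i τ i≡N fr inv = ≤-refl , subst (λ i → Inv i τ) (trans (sym (+-identityʳ i)) i≡N) inv
  go (suc m) i τ i+m≡N fr inv with step i τ i<N fr inv
    where
    i<N : i < N
    i<N = ≤-trans (s≤s (m≤m+n i m)) (≤-reflexive (trans (sym (+-suc i m)) i+m≡N))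
  ... | spec c inv′ with go m (suc i) (⟦ p ⟧ (set x i τ)) (trans (sym (+-suc i m)) i+m≡N)
        (frame-trans fr (frame-trans (frame-∪ˡ (frame-set x i τ)) (frame-∪ʳ {assigns x} (frame p (set x i τ))))) inv′
  ...   | c′ , q = ≤-trans (s≤s (+-mono-≤ (s≤s (s≤s (+-monoˡ-≤ 2 c))) c′)) (≤-reflexive (arith t (m * (5 + t)))) , q
    where
    arith : ∀ t r → 1 + ((2 + (t + 2)) + (1 + r)) ≡ 1 + ((5 + t) + r)
    arith = solve-∀
  all = go N 0 σ refl frame-refl init

-- Bit masks, weights, and sets of available vertices

bool-ext : ∀ {a b} → (a ≡ true → b ≡ true) → (b ≡ true → a ≡ true) → a ≡ b
bool-ext {true}  {true}  _ _ = refl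
bool-ext {true}  {false} f _ = sym (f refl)
bool-ext {false} {true}  _ g = g refl
bool-ext {false} {false} _ _ = refl

true≢false : ∀ {a} → a ≡ true → a ≢ false
true≢false refl ()

≢true⇒false : ∀ {a} → a ≢ true → a ≡ false
≢true⇒false {true}  ≢ = contradiction refl ≢
≢true⇒false {false} _ = refl

≢false⇒true : ∀ {a} → a ≢ false → a ≡ true
≢false⇒true {true}  _ = refl
≢false⇒true {false} ≢ = contradiction refl ≢

false⇒not-true : ∀ {b} → b ≡ false → not b ≡ true
false⇒not-true refl = refl

∧-intro : ∀ {a b} → a ≡ true → b ≡ true → a ∧ b ≡ true
∧-intro refl refl = refl

≡ᵇ-true⇒≡ : ∀ {i j} → (i ≡ᵇ j) ≡ true → i ≡ j
≡ᵇ-true⇒≡ {i} {j} eq = ≡ᵇ⇒≡ i j (true⇒T eq)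

<suc⇒<⊎≡ : ∀ {u m} → u < suc m → u < m ⊎ u ≡ m
<suc⇒<⊎≡ (s≤s u≤m) = m≤n⇒m<n∨m≡n u≤m

-- Each step deletes from `ys` the partner of the head, which by injectivity no later element needs.
-- A relation is used instead of a function because the partners come from existence proofs.
pigeonhole : {A B : Set} (R : A → B → Set) (xs : List A) (ys : List B) → Unique xs →
             (∀ {x} → x ∈ xs → ∃[ y ] (y ∈ ys × R x y)) →
             (∀ {x x′ y} → R x y → R x′ y → x ≡ x′) → length xs ≤ length ys
pigeonhole R [] ys _ _ _ = z≤n
pigeonhole {A} {B} R (x ∷ xs) ys (x∉xs ∷ unique) total inj with total (here refl)
... | y , y∈ys , xRy with ∈-∃++ y∈ys
...   | as , bs , refl = ≤-trans (s≤s (pigeonhole R xs (as ++ bs) unique total′ inj))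
          (≤-reflexive (trans (cong suc (length-++ as)) (trans (sym (+-suc (length as) (length bs))) (sym (length-++ as)))))
  where
  total′ : ∀ {x′} → x′ ∈ xs → ∃[ y ] (y ∈ as ++ bs × R x′ y)
  total′ {x′} x′∈xs with total (there x′∈xs)
  ... | y′ , y′∈ , x′Ry′ with ∈-++⁻ as y′∈
  ...   | inj₁ ∈as = y′ , ∈-++⁺ˡ ∈as , x′Ry′
  ...   | inj₂ (here refl) = contradiction (inj xRy x′Ry′) (All.lookup x∉xs x′∈xs)
  ...   | inj₂ (there ∈bs) = y′ , ∈-++⁺ʳ as ∈bs , x′Ry′

length-cartesianProductWith : {A B C : Set} (f : A → B → C) (xs : List A) (ys : List B) →
                              length (cartesianProductWith f xs ys) ≡ length xs * length ys
length-cartesianProductWith f [] ys = refl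
length-cartesianProductWith f (x ∷ xs) ys = trans (length-++ (map (f x) ys))
  (cong₂ _+_ (length-map (f x) ys) (length-cartesianProductWith f xs ys))

any-intro : {A : Set} (p : A → Bool) {x : A} {xs : List A} → x ∈ xs → p x ≡ true → any p xs ≡ true
any-intro p (here refl) px rewrite px = refl
any-intro p {xs = y ∷ _} (there x∈) px rewrite any-intro p x∈ px = ∨-zeroʳ (p y)

any-elim : {A : Set} (p : A → Bool) (xs : List A) → any p xs ≡ true → ∃[ x ] (x ∈ xs × p x ≡ true)
any-elim p (x ∷ xs) eq with p x in px
... | true  = x , here refl , px
... | false with any-elim p xs eq
...   | y , y∈ , py = y , there y∈ , py

any< : ℕ → (ℕ → Bool) → Bool
any< zero    p = false
any< (suc m) p = p m ∨ any< m p

any<-intro : ∀ {m u} (p : ℕ → Bool) → u < m → p u ≡ true → any< m p ≡ true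
any<-intro {suc m} p u<m pu with <suc⇒<⊎≡ u<m
... | inj₂ refl rewrite pu = refl
... | inj₁ u<m′ rewrite any<-intro p u<m′ pu = ∨-zeroʳ (p m)

any<-elim : ∀ m (p : ℕ → Bool) → any< m p ≡ true → ∃[ u ] (u < m × p u ≡ true)
any<-elim (suc m) p eq with p m in pm
... | true  = m , n<1+n m , pm
... | false with any<-elim m p eq
...   | u , u<m , pu = u , m<n⇒m<1+n u<m , pu

bit : Bool → ℕ → ℕ
bit b m = if b then 2 ^ m else 0

mask : ℕ → (ℕ → Bool) → ℕ
mask zero    f = 0
mask (suc m) f = mask m f + bit (f m) m

ins : ℕ → (ℕ → Bool) → ℕ → Bool
ins v f u = (u ≡ᵇ v) ∨ f u

ins-other : ∀ {u v} f → u ≢ v → ins v f u ≡ f u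
ins-other f u≢v rewrite ≢⇒≡ᵇ u≢v = refl

ins-same : ∀ v {f} → ins v f v ≡ true
ins-same v rewrite ≡ᵇ-refl v = refl

ins-elim : ∀ {u v} f → ins v f u ≡ true → u ≡ v ⊎ f u ≡ true
ins-elim {u} {v} f eq with u ≡ᵇ v in u≡v
... | true  = inj₁ (≡ᵇ-true⇒≡ u≡v)
... | false = inj₂ eq

mask<2^ : ∀ m f → mask m f < 2 ^ m
mask<2^ zero    f = s≤s z≤n
mask<2^ (suc m) f with f m
... | true  = ≤-trans (+-monoˡ-≤ (2 ^ m) (mask<2^ m f)) (+-monoʳ-≤ (2 ^ m) (m≤m+n (2 ^ m) 0))
... | false = ≤-trans (s≤s (≤-reflexive (+-identityʳ _))) (≤-trans (mask<2^ m f) (m≤m+n (2 ^ m) _))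

mask-cong : ∀ m {f g} → (∀ u → u < m → f u ≡ g u) → mask m f ≡ mask m g
mask-cong zero    _  = refl
mask-cong (suc m) eq = cong₂ (λ x b → x + bit b m) (mask-cong m (λ u u<m → eq u (m<n⇒m<1+n u<m))) (eq m (n<1+n m))

-- The lower bits add up to less than `2 ^ m`. This lets the program read a mask from the top by
-- comparing and subtracting, without shifts.
top-bit : ∀ m f → 2 ^ m ≤ mask (suc m) f → f m ≡ true
top-bit m f le with f m
... | true  = refl
... | false = contradiction le (<⇒≱ (≤-trans (s≤s (≤-reflexive (+-identityʳ _))) (mask<2^ m f)))

no-top-bit : ∀ m f → mask (suc m) f < 2 ^ m → f m ≡ false
no-top-bit m f lt with f m
... | true  = contradiction (m≤n+m (2 ^ m) (mask m f)) (<⇒≱ lt)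
... | false = refl

mask-injective : ∀ m {f g} → mask m f ≡ mask m g → ∀ u → u < m → f u ≡ g u
mask-injective (suc m) {f} {g} eq u u<m = go (<suc⇒<⊎≡ u<m)
  where
  fm≡gm : f m ≡ g m
  fm≡gm = bool-ext (λ fm → top-bit m g (≤-trans (has f fm) (≤-reflexive eq)))
                   (λ gm → top-bit m f (≤-trans (has g gm) (≤-reflexive (sym eq))))
    where
    has : ∀ h → h m ≡ true → 2 ^ m ≤ mask (suc m) h
    has h hm rewrite hm = m≤n+m (2 ^ m) (mask m h)
  go : u < m ⊎ u ≡ m → f u ≡ g u
  go (inj₂ refl) = fm≡gm
  go (inj₁ u<m) = mask-injective m {f} {g} (+-cancelʳ-≡ (bit (g m) m) _ _
    (trans (cong (λ b → mask m f + bit b m) (sym fm≡gm)) eq)) u u<m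

mask-ins : ∀ {m v} f → v < m → f v ≡ false → mask m (ins v f) ≡ mask m f + 2 ^ v
mask-ins {suc m} {v} f v<m fv with <suc⇒<⊎≡ v<m
... | inj₂ refl rewrite ≡ᵇ-refl v | fv =
  cong (_+ 2 ^ v) (trans (mask-cong v (λ u u<v → ins-other f (<⇒≢ u<v))) (sym (+-identityʳ _)))
... | inj₁ v<m′ rewrite ≢⇒≡ᵇ (>⇒≢ v<m′) | mask-ins f v<m′ fv =
  trans (+-assoc (mask m f) _ _) (trans (cong (mask m f +_) (+-comm (2 ^ v) _)) (sym (+-assoc (mask m f) _ _)))

total : ℕ → (ℕ → ℚ) → ℚ
total zero    g = 0ℚ
total (suc m) g = total m g ℚ.+ g m

total-cong : ∀ m {f g} → (∀ u → u < m → f u ≡ g u) → total m f ≡ total m g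
total-cong zero    _  = refl
total-cong (suc m) eq = cong₂ ℚ._+_ (total-cong m (λ u u<m → eq u (m<n⇒m<1+n u<m))) (eq m (n<1+n m))

total-mono : ∀ m {f g} → (∀ u → u < m → f u ℚ.≤ g u) → total m f ℚ.≤ total m g
total-mono zero    _  = ℚₚ.≤-refl
total-mono (suc m) le = ℚₚ.+-mono-≤ (total-mono m (λ u u<m → le u (m<n⇒m<1+n u<m))) (le m (n<1+n m))

+-interchange : ∀ a b c d → (a ℚ.+ b) ℚ.+ (c ℚ.+ d) ≡ (a ℚ.+ c) ℚ.+ (b ℚ.+ d)
+-interchange a b c d = begin
  (a ℚ.+ b) ℚ.+ (c ℚ.+ d) ≡⟨ ℚₚ.+-assoc a b (c ℚ.+ d) ⟩
  a ℚ.+ (b ℚ.+ (c ℚ.+ d)) ≡⟨ cong (a ℚ.+_) (sym (ℚₚ.+-assoc b c d)) ⟩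
  a ℚ.+ ((b ℚ.+ c) ℚ.+ d) ≡⟨ cong (λ x → a ℚ.+ (x ℚ.+ d)) (ℚₚ.+-comm b c) ⟩
  a ℚ.+ ((c ℚ.+ b) ℚ.+ d) ≡⟨ cong (a ℚ.+_) (ℚₚ.+-assoc c b d) ⟩
  a ℚ.+ (c ℚ.+ (b ℚ.+ d)) ≡⟨ sym (ℚₚ.+-assoc a c (b ℚ.+ d)) ⟩
  (a ℚ.+ c) ℚ.+ (b ℚ.+ d) ∎
  where open ≡-Reasoning

total-+ : ∀ m f g → total m f ℚ.+ total m g ≡ total m (λ u → f u ℚ.+ g u)
total-+ zero    f g = refl
total-+ (suc m) f g = trans (+-interchange (total m f) (f m) (total m g) (g m)) (cong (ℚ._+ (f m ℚ.+ g m)) (total-+ m f g))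

-- `total` grows at its last index, the fold in `totalWeight` at its first.
total-head : ∀ m g → total (suc m) g ≡ g 0 ℚ.+ total m (g ∘ suc)
total-head zero    g = trans (ℚₚ.+-identityˡ (g 0)) (sym (ℚₚ.+-identityʳ (g 0)))
total-head (suc m) g = trans (cong (ℚ._+ g (suc m)) (total-head m g)) (ℚₚ.+-assoc (g 0) _ _)

module _ (w : ℕ → ℚ) where

  part : (ℕ → Bool) → ℕ → ℚ
  part S u = if S u then w u else 0ℚ

  wsum : ℕ → (ℕ → Bool) → ℚ
  wsum m S = total m (part S)

  part-cong : ∀ {S S′ u} → S u ≡ S′ u → part S u ≡ part S′ u
  part-cong {u = u} = cong (λ b → if b then w u else 0ℚ)

  wsum-cong : ∀ m {S S′} → (∀ u → u < m → S u ≡ S′ u) → wsum m S ≡ wsum m S′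
  wsum-cong m {S} {S′} eq = total-cong m (λ u u<m → part-cong {S} {S′} (eq u u<m))

  wsum-ins : ∀ {m v} S → v < m → S v ≡ false → wsum m (ins v S) ≡ wsum m S ℚ.+ w v
  wsum-ins {suc m} {v} S v<m Sv with <suc⇒<⊎≡ v<m
  ... | inj₂ refl rewrite ≡ᵇ-refl v | Sv =
    cong (ℚ._+ w v) (trans (wsum-cong v (λ u u<v → ins-other S (<⇒≢ u<v))) (sym (ℚₚ.+-identityʳ _)))
  ... | inj₁ v<m′ rewrite ≢⇒≡ᵇ (>⇒≢ v<m′) | wsum-ins S v<m′ Sv =
    trans (ℚₚ.+-assoc (wsum m S) _ _) (trans (cong (wsum m S ℚ.+_) (ℚₚ.+-comm (w v) _)) (sym (ℚₚ.+-assoc (wsum m S) _ _)))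

module Available (n : ℕ) (A : ℕ → ℕ → Bool) (K : ℕ → Bool) where

  hit : (ℕ → Bool) → ℕ → Bool
  hit S u = any< n (λ s → S s ∧ A s u)

  available : (ℕ → Bool) → (ℕ → Bool) → ℕ → Bool
  available done S u = K u ∧ not (done u) ∧ not (hit S u)

  IndependentSet : (ℕ → Bool) → Set
  IndependentSet S = ∀ s t → s < n → t < n → S s ≡ true → S t ≡ true → A s t ≡ false

  record Partial (done S : ℕ → Bool) : Set where
    field
      members     : ∀ s → s < n → S s ≡ true → done s ≡ true × K s ≡ true
      independent : IndependentSet S

  available-skip : ∀ v done S u → available (ins v done) S u ≡ available done S u ∧ not (u ≡ᵇ v)
  available-skip v done S u with K u | done u | u ≡ᵇ v | hit S u
  ... | false | _     | _     | _     = refl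
  ... | true  | true  | true  | _     = refl
  ... | true  | true  | false | _     = refl
  ... | true  | false | true  | true  = refl
  ... | true  | false | true  | false = refl
  ... | true  | false | false | true  = refl
  ... | true  | false | false | false = refl

  hit-ins : ∀ {v} S u → v < n → hit (ins v S) u ≡ hit S u ∨ A v u
  hit-ins {v} S u v<n = bool-ext to from
    where
    to : hit (ins v S) u ≡ true → hit S u ∨ A v u ≡ true
    to eq with any<-elim n _ eq
    ... | s , s<n , both with ins-elim {s} {v} S (∧-trueˡ both)
    ...   | inj₁ refl rewrite ∧-trueʳ {ins v S v} both = ∨-zeroʳ (hit S u)
    ...   | inj₂ Ss rewrite any<-intro (λ s → S s ∧ A s u) s<n (∧-intro Ss (∧-trueʳ {ins v S s} both)) = refl
    from : hit S u ∨ A v u ≡ true → hit (ins v S) u ≡ true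
    from eq with hit S u in hu
    ... | false = any<-intro (λ s → ins v S s ∧ A s u) v<n (∧-intro (ins-same v {S}) eq)
    ... | true with any<-elim n _ hu
    ...   | s , s<n , both = any<-intro (λ s → ins v S s ∧ A s u) s<n
              (∧-intro (trans (cong ((s ≡ᵇ v) ∨_) (∧-trueˡ both)) (∨-zeroʳ _)) (∧-trueʳ {S s} both))

  available-take : ∀ {v} done S u → v < n →
                   available (ins v done) (ins v S) u ≡ available done S u ∧ not (u ≡ᵇ v) ∧ not (A v u)
  available-take {v} done S u v<n rewrite hit-ins {v} S u v<n with K u | done u | u ≡ᵇ v | hit S u | A v u
  ... | false | _     | _     | _     | _     = refl
  ... | true  | true  | true  | _     | _     = refl
  ... | true  | true  | false | _     | _     = refl
  ... | true  | false | true  | true  | _     = refl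
  ... | true  | false | true  | false | _     = refl
  ... | true  | false | false | true  | _     = refl
  ... | true  | false | false | false | true  = refl
  ... | true  | false | false | false | false = refl

  -- An independent set has at most `M` members whose edges cross the threshold θ. Both comparisons
  -- with θ are weak, because vertices with key θ can occur among the processed as well as among the
  -- unprocessed ones.
  Narrow : ℕ → (ℕ → ℕ) → Set
  Narrow M key = ∀ θ xs → Unique xs →
    (∀ {s} → s ∈ xs → s < n × K s ≡ true × key s ≤ θ ×
       ∃[ t ] (t < n × K t ≡ true × A s t ≡ true × θ ≤ key t)) →
    (∀ {s t} → s ∈ xs → t ∈ xs → A s t ≡ false) → length xs ≤ M

  tuples : ℕ → List (List ℕ)
  tuples zero    = [] ∷ []
  tuples (suc m) = cartesianProductWith _∷_ (upTo n) (tuples m)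

  length-tuples : ∀ m → length (tuples m) ≡ n ^ m
  length-tuples zero    = refl
  length-tuples (suc m) = trans (length-cartesianProductWith _∷_ (upTo n) (tuples m))
    (cong₂ _*_ (length-upTo n) (length-tuples m))

  ∈-tuples : ∀ {l} → All (_< n) l → l ∈ tuples (length l)
  ∈-tuples []         = here refl
  ∈-tuples (x<n ∷ ps) = ∈-cartesianProductWith⁺ _∷_ (∈-upTo⁺ x<n) (∈-tuples ps)

  -- The available set depends only on the chosen vertices that still have an unprocessed neighbour.
  states≤ : ∀ {M key} → Narrow M key → ∀ done θ →
            (∀ u → u < n → done u ≡ true → key u ≤ θ) → (∀ u → u < n → done u ≡ false → θ ≤ key u) →
            ∀ L → Unique L → (∀ {R} → R ∈ L → ∃[ S ] (Partial done S × R ≡ mask n (available done S))) →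
            length L ≤ suc (n ^ M)
  states≤ {M} {key} narrow done θ before after L unique sound =
    ≤-trans (pigeonhole _≡_ L candidates unique covered (λ { refl eq → sym eq }))
      (≤-reflexive (trans (length-map code ([] ∷ tuples M)) (cong suc (length-tuples M))))
    where
    availableL : List ℕ → ℕ → Bool
    availableL l u = K u ∧ not (done u) ∧ not (any (λ s → A s u) l)
    code : List ℕ → ℕ
    code l = mask n (availableL l)
    candidates : List ℕ
    candidates = map code ([] ∷ tuples M)

    covered : ∀ {R} → R ∈ L → ∃[ R′ ] (R′ ∈ candidates × R ≡ R′)
    covered R∈L with sound R∈L
    ... | S , valid , refl = code l , ∈-map⁺ code listed , mask-cong n same
      where
      open Partial valid
      front : ℕ → Bool
      front s = S s ∧ any< n (λ t → K t ∧ not (done t) ∧ A s t)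
      xs : List ℕ
      xs = filter (λ s → front s Boolₚ.≟ true) (upTo n)
      ∈xs : ∀ {s} → s ∈ xs → s < n × front s ≡ true
      ∈xs s∈xs with ∈-filter⁻ (λ s → front s Boolₚ.≟ true) {xs = upTo n} s∈xs
      ... | s∈ , fs = ∈-upTo⁻ s∈ , fs
      xs≤M : length xs ≤ M
      xs≤M = narrow θ xs (Uniqueₚ.filter⁺ (λ s → front s Boolₚ.≟ true) (Uniqueₚ.upTo⁺ n)) props indep
        where
        props : ∀ {s} → s ∈ xs → s < n × K s ≡ true × key s ≤ θ ×
                  ∃[ t ] (t < n × K t ≡ true × A s t ≡ true × θ ≤ key t)
        props {s} s∈ with ∈xs s∈
        ... | s<n , fs with members s s<n (∧-trueˡ fs) | any<-elim n _ (∧-trueʳ {S s} fs)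
        ...   | ds , Ks | t , t<n , three = s<n , Ks , before s s<n ds ,
                t , t<n , ∧-trueˡ three , ∧-trueʳ {not (done t)} (∧-trueʳ {K t} three) ,
                after t t<n (not-true⇒false (∧-trueˡ (∧-trueʳ {K t} three)))
        indep : ∀ {s t} → s ∈ xs → t ∈ xs → A s t ≡ false
        indep s∈ t∈ = independent _ _ (proj₁ (∈xs s∈)) (proj₁ (∈xs t∈)) (∧-trueˡ (proj₂ (∈xs s∈))) (∧-trueˡ (proj₂ (∈xs t∈)))

      -- Repeating a vertex does not change what is hit, so a front of at most `M` vertices becomes
      -- a tuple of length exactly `M`. An empty front has nothing to repeat and accounts for the
      -- extra candidate `[]`.
      pad : List ℕ → List ℕ
      pad []       = []
      pad (y ∷ ys) = replicate (M ∸ length (y ∷ ys)) y ++ y ∷ ys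
      l : List ℕ
      l = pad xs
      ∈pad⁺ : ∀ {s} ys → s ∈ ys → s ∈ pad ys
      ∈pad⁺ (y ∷ ys) s∈ = ∈-++⁺ʳ (replicate (M ∸ length (y ∷ ys)) y) s∈
      ∈pad⁻ : ∀ {s} ys → s ∈ pad ys → s ∈ ys
      ∈pad⁻ (y ∷ ys) s∈ with ∈-++⁻ (replicate (M ∸ length (y ∷ ys)) y) s∈
      ... | inj₂ s∈ys = s∈ys
      ... | inj₁ s∈rep = here (All.lookup (Allₚ.replicate⁺ {P = _≡ y} (M ∸ length (y ∷ ys)) refl) s∈rep)
      listed : l ∈ [] ∷ tuples M
      listed = go xs refl
        where
        go : ∀ ys → xs ≡ ys → pad ys ∈ [] ∷ tuples M
        go [] _ = here refl
        go (y ∷ ys) eq = there (subst (λ m → pad (y ∷ ys) ∈ tuples m) len (∈-tuples (All.tabulate small)))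
          where
          small : ∀ {s} → s ∈ pad (y ∷ ys) → s < n
          small s∈ = proj₁ (∈xs (subst (_ ∈_) (sym eq) (∈pad⁻ (y ∷ ys) s∈)))
          len : length (pad (y ∷ ys)) ≡ M
          len = trans (length-++ (replicate (M ∸ length (y ∷ ys)) y))
                  (trans (cong (_+ length (y ∷ ys)) (length-replicate (M ∸ length (y ∷ ys))))
                    (m∸n+n≡m (subst (λ zs → length zs ≤ M) eq xs≤M)))

      same : ∀ u → u < n → available done S u ≡ availableL l u
      same u u<n with K u in Ku | done u in du
      ... | false | _    = refl
      ... | true  | true = refl
      ... | true  | false = cong not (bool-ext to from)
        where
        to : hit S u ≡ true → any (λ s → A s u) l ≡ true
        to h with any<-elim n _ h
        ... | s , s<n , both = any-intro (λ s → A s u)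
                (∈pad⁺ xs (∈-filter⁺ (λ s → front s Boolₚ.≟ true) (∈-upTo⁺ s<n) (∧-intro (∧-trueˡ both)
                  (any<-intro (λ t → K t ∧ not (done t) ∧ A s t) u<n
                    (∧-intro Ku (∧-intro (false⇒not-true du) (∧-trueʳ {S s} both)))))))
                (∧-trueʳ {S s} both)
        from : any (λ s → A s u) l ≡ true → hit S u ≡ true
        from h with any-elim (λ s → A s u) l h
        ... | s , s∈l , Asu with ∈xs (∈pad⁻ xs s∈l)
        ...   | s<n , fs = any<-intro (λ s → S s ∧ A s u) s<n (∧-intro (∧-trueˡ fs) Asu)

-- Dynamic programming over available sets

pattern nᵛ = 1
pattern kᵛ = 2
pattern hᵛ = 3
pattern widthᵛ = 4
pattern 2ⁿᵛ = 5
pattern ptrᵛ = 6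
pattern uᵛ = 7
pattern jᵛ = 8
pattern minxᵛ = 9
pattern maxxᵛ = 10
pattern loᵛ = 11
pattern gᵛ = 12
pattern cutᵛ = 13
pattern iᵛ = 14
pattern bestᵛ = 15
pattern tabᵛ = 16
pattern headᵛ = 17
pattern tailᵛ = 18
pattern oᵛ = 19
pattern cntᵛ = 20
pattern keyᵛ = 21
pattern key′ᵛ = 22
pattern keptᵛ = 23
pattern infᵛ = 24
pattern stageᵛ = 25
pattern vᵛ = 26
pattern leastᵛ = 27
pattern rowᵛ = 28
pattern tab′ᵛ = 29
pattern head′ᵛ = 30
pattern recᵛ = 31
pattern Rᵛ = 32
pattern xᵛ = 33
pattern y₀ᵛ = 34
pattern y₁ᵛ = 35
pattern fᵛ = 36
pattern dᵛ = 37
pattern bᵛ = 38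
pattern powᵛ = 39
pattern yᵛ = 40
pattern sᵛ = 41

pattern best-wᵛ = 0
pattern wᵛ = 1

pattern Minx = 0F
pattern Maxx = 1F
pattern Lo   = 2F
pattern Pow  = 3F
pattern Cut  = 4F
pattern Key  = 5F
pattern Tab  = 6F
pattern Que  = 7F

-- A mask is queued when it first arrives, which the zero in its table cell reveals; later arrivals
-- only compete by weight.
insert : Cmd
insert =
  if≤ (Tab at (var tab′ᵛ ⊕ var yᵛ)) (lit 0)
    (Tab [ var tab′ᵛ ⊕ var yᵛ ]≔ var sᵛ ⨟ tab[ var tab′ᵛ ⊕ var yᵛ ]≔ wvar wᵛ ⨟
     Que [ var tailᵛ ]≔ var yᵛ ⨟ tailᵛ ≔ var tailᵛ ⊕ lit 1)
    (if≤ʷ (wtab (var tab′ᵛ ⊕ var yᵛ)) (wvar wᵛ)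
      (Tab [ var tab′ᵛ ⊕ var yᵛ ]≔ var sᵛ ⨟ tab[ var tab′ᵛ ⊕ var yᵛ ]≔ wvar wᵛ)
      skip)

-- One pass over the bits of `Rᵛ` produces both successors: `y₀ᵛ` omits the current vertex, `y₁ᵛ`
-- its neighbours as well, and `fᵛ` tells whether the vertex was available.
decode : Cmd
decode =
  xᵛ ≔ var Rᵛ ⨟ y₀ᵛ ≔ lit 0 ⨟ y₁ᵛ ≔ lit 0 ⨟ fᵛ ≔ lit 0 ⨟
  for dᵛ (var nᵛ)
    (bᵛ ≔ var nᵛ ⊖ (var dᵛ ⊕ lit 1) ⨟ powᵛ ≔ Pow at var bᵛ ⨟
     if≤ (var powᵛ) (var xᵛ)
       (xᵛ ≔ var xᵛ ⊖ var powᵛ ⨟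
        -- A test for equality: both truncated differences vanish.
        if≤ ((var bᵛ ⊖ var vᵛ) ⊕ (var vᵛ ⊖ var bᵛ)) (lit 0)
          (fᵛ ≔ lit 1)
          (y₀ᵛ ≔ var y₀ᵛ ⊕ var powᵛ ⨟
           if≤ (inp (var rowᵛ ⊕ var bᵛ)) (lit 0) (y₁ᵛ ≔ var y₁ᵛ ⊕ var powᵛ) skip))
       skip)

by-computation : ∀ {m n} → {T (m ≤ᵇ n)} → m ≤ n
by-computation {m} {n} {le} = ≤ᵇ⇒≤ m n le

tab-same : ∀ (m : ℕ → ℚ) B i {v} → (m [ B + i ↦ v ]) (B + i) ≡ v
tab-same m B i = upd-same m (B + i)

tab-diff : ∀ (m : ℕ → ℚ) B {i j v} → j ≢ i → (m [ B + i ↦ v ]) (B + j) ≡ m (B + j)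
tab-diff m B {i} {j} j≢i = upd-diff m (j≢i ∘ +-cancelˡ-≡ B j i)

-- The masks in L occupy the queue from h on; the table from t on holds, at index R, an entry for each R in L.
record Table (P : ℕ) (Good : ℕ → ℕ → ℚ → Set) (t h : ℕ) (L : List ℕ) (σ : State) : Set where
  field
    unique : Unique L
    small  : ∀ {R} → R ∈ L → R < P
    queued : ∀ {R} → R ∈ L → ∃[ j ] (j < length L × arr σ Que (h + j) ≡ R)
    listed : ∀ {j} → j < length L → arr σ Que (h + j) ∈ L
    good   : ∀ {R} → R ∈ L → Good R (arr σ Tab (t + R)) (tab σ (t + R))
    empty  : ∀ {R} → R < P → R ∉ L → arr σ Tab (t + R) ≡ 0

-- Below `t` lies the old table, which is still being read. From `t + P` on, the marks must stay 0
-- for later stages; weights are read only in occupied cells, so for them the part below `t`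
-- suffices.
record Outside (P t h : ℕ) (σ τ : State) : Set where
  field
    tabs  : ∀ {z} → z < t ⊎ t + P ≤ z → arr τ Tab z ≡ arr σ Tab z
    wtabs : ∀ {z} → z < t → tab τ z ≡ tab σ z
    ques  : ∀ {z} → z < h → arr τ Que z ≡ arr σ Que z

outside-refl : ∀ {P t h σ} → Outside P t h σ σ
outside-refl = record { tabs = λ _ → refl; wtabs = λ _ → refl; ques = λ _ → refl }

outside-trans : ∀ {P t h σ τ υ} → Outside P t h σ τ → Outside P t h τ υ → Outside P t h σ υ
outside-trans p q = record
  { tabs = λ z → trans (Q.tabs z) (P.tabs z); wtabs = λ z → trans (Q.wtabs z) (P.wtabs z)
  ; ques = λ z → trans (Q.ques z) (P.ques z) }
  where module P = Outside p; module Q = Outside q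

-- Masks stay listed and their weights never fall, so whatever earlier queue entries contributed
-- remains witnessed.
record Grown (P : ℕ) (Good : ℕ → ℕ → ℚ → Set) (t h : ℕ) (L : List ℕ) (σ τ : State) : Set where
  field
    {L′}    : List ℕ
    table   : Table P Good t h L′ τ
    tail    : reg τ tailᵛ ≡ h + length L′
    mono    : ∀ {R} → R ∈ L → R ∈ L′ × tab σ (t + R) ℚ.≤ tab τ (t + R)
    outside : Outside P t h σ τ

module _ {P : ℕ} {Good : ℕ → ℕ → ℚ → Set} (positive : ∀ {R s w} → Good R s w → 1 ≤ s) where

  insertSpec : ∀ {t h L y s w} σ → reg σ tab′ᵛ ≡ t → reg σ yᵛ ≡ y → reg σ sᵛ ≡ s → wreg σ wᵛ ≡ w →
               reg σ tailᵛ ≡ h + length L → Table P Good t h L σ → y < P → Good y s w →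
               Spec insert σ 90 λ τ → Σ (Grown P Good t h L σ τ) λ g → y ∈ Grown.L′ g × w ℚ.≤ tab τ (t + y)
  insertSpec {t} {h} {L} {y} {s} {w} σ refl refl refl refl tail table y<P goodY =
    within by-computation (branch new (λ old → branchʷ {t = 60} (improve old) (keep old)))
    where
    open Table table
    Entered : State → Set
    Entered τ = Σ (Grown P Good t h L σ τ) λ g → y ∈ Grown.L′ g × w ℚ.≤ tab τ (t + y)
    B = reg σ 0
    a = t + y

    a≢ : ∀ {R} → R ≢ y → t + R ≢ a
    a≢ R≢y = R≢y ∘ +-cancelˡ-≡ t _ _
    outside-a : ∀ {z} → z < t ⊎ t + P ≤ z → z ≢ a
    outside-a (inj₁ z<t) refl = <⇒≱ z<t (m≤m+n t y)
    outside-a (inj₂ le)  refl = <⇒≱ y<P (+-cancelˡ-≤ t _ _ le)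

    y∈L : 0 < arr σ Tab a → y ∈ L
    y∈L old with y ∈? L
    ... | yes y∈ = y∈
    ... | no y∉ = contradiction (empty y<P y∉) (>⇒≢ old)

    new : arr σ Tab a ≤ 0 → Spec _ σ 70 Entered
    new a≤0 = within by-computation (now (record
      { L′ = y ∷ L
      ; table = record
        { unique = All.tabulate (λ R∈L y≡R → y∉L (subst (_∈ L) (sym y≡R) R∈L)) ∷ unique
        ; small  = λ { (here refl) → y<P ; (there R∈) → small R∈ }
        ; queued = queued′
        ; listed = listed′
        ; good   = good′
        ; empty  = λ R<P R∉ → trans (tabs′ _ (R∉ ∘ here)) (empty R<P (R∉ ∘ there)) }
      ; tail = trans (cong (_+ 1) tail) (trans (+-comm _ 1) (sym (+-suc h (length L))))
      ; mono = λ R∈ → there R∈ , ℚₚ.≤-reflexive (sym (wtabs′ _ (λ R≡y → y∉L (subst (_∈ L) R≡y R∈))))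
      ; outside = record
        { tabs = λ {z} out → trans (store-array m₁ B Que q z λ ()) (store-index (mem σ) B Tab a (outside-a out))
        ; wtabs = λ {z} z<t → tab-diff (wmem σ) B (outside-a (inj₁ z<t))
        ; ques = λ {z} z<h → trans (store-index m₁ B Que q (<⇒≢ (<-≤-trans z<h (≤-trans (m≤m+n h _) (≤-reflexive (sym tail))))))
                               (store-array (mem σ) B Tab a z λ ()) }
      } , here refl , ℚₚ.≤-reflexive (sym (tab-same (wmem σ) B a))))
      where
      τ = ⟦ Tab [ var tab′ᵛ ⊕ var yᵛ ]≔ var sᵛ ⨟ tab[ var tab′ᵛ ⊕ var yᵛ ]≔ wvar wᵛ ⨟
            Que [ var tailᵛ ]≔ var yᵛ ⨟ tailᵛ ≔ var tailᵛ ⊕ lit 1 ⟧ σ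
      m₁ = mem σ [ cell B Tab a ↦ s ]
      q = reg σ tailᵛ
      y∉L : y ∉ L
      y∉L y∈ = <⇒≱ (positive (good y∈)) a≤0
      tabs′ : ∀ R → R ≢ y → arr τ Tab (t + R) ≡ arr σ Tab (t + R)
      tabs′ R R≢y = trans (store-array m₁ B Que q (t + R) λ ()) (store-index (mem σ) B Tab a (a≢ R≢y))
      wtabs′ : ∀ R → R ≢ y → tab τ (t + R) ≡ tab σ (t + R)
      wtabs′ R R≢y = tab-diff (wmem σ) B (a≢ R≢y)
      ques′ : ∀ j → j < length L → arr τ Que (h + j) ≡ arr σ Que (h + j)
      ques′ j j<l = trans (store-index m₁ B Que q (λ eq → <⇒≢ j<l (+-cancelˡ-≡ h _ _ (trans eq tail))))
                      (store-array (mem σ) B Tab a (h + j) λ ())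
      quey : arr τ Que (h + length L) ≡ y
      quey = store-same m₁ B Que q (sym tail)
      queued′ : ∀ {R} → R ∈ y ∷ L → ∃[ j ] (j < length (y ∷ L) × arr τ Que (h + j) ≡ R)
      queued′ (here refl) = length L , n<1+n _ , quey
      queued′ (there R∈) with queued R∈
      ... | j , j<l , eq = j , m<n⇒m<1+n j<l , trans (ques′ j j<l) eq
      listed′ : ∀ {j} → j < suc (length L) → arr τ Que (h + j) ∈ y ∷ L
      listed′ {j} j<l with <suc⇒<⊎≡ j<l
      ... | inj₁ j<l′ = there (subst (_∈ L) (sym (ques′ j j<l′)) (listed j<l′))
      ... | inj₂ refl = here quey
      good′ : ∀ {R} → R ∈ y ∷ L → Good R (arr τ Tab (t + R)) (tab τ (t + R))
      good′ (here refl) = subst₂ (Good y)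
        (sym (trans (store-array m₁ B Que q a λ ()) (store-same (mem σ) B Tab a refl)))
        (sym (tab-same (wmem σ) B a)) goodY
      good′ {R} (there R∈) = subst₂ (Good R) (sym (tabs′ R R≢y)) (sym (wtabs′ R R≢y)) (good R∈)
        where
        R≢y : R ≢ y
        R≢y R≡y = y∉L (subst (_∈ L) R≡y R∈)

    improve : 0 < arr σ Tab a → tab σ a ℚ.≤ w → Spec _ σ 60 Entered
    improve old le = within by-computation (now (record
      { L′ = L
      ; table = record
        { unique = unique
        ; small  = small
        ; queued = λ R∈ → let j , j<l , eq = queued R∈ in j , j<l , trans (store-array (mem σ) B Tab a (h + j) λ ()) eq
        ; listed = λ {j} j<l → subst (_∈ L) (sym (store-array (mem σ) B Tab a (h + j) λ ())) (listed j<l)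
        ; good   = λ {R} R∈ → good′ R R∈ (R ≟ y)
        ; empty  = λ {R} R<P R∉ → trans (store-index (mem σ) B Tab a (a≢ (λ R≡y → R∉ (subst (_∈ L) (sym R≡y) (y∈L old))))) (empty R<P R∉) }
      ; tail = tail
      ; mono = λ {R} R∈ → R∈ , mono′ R (R ≟ y)
      ; outside = record
        { tabs = λ {z} out → store-index (mem σ) B Tab a (outside-a out)
        ; wtabs = λ {z} z<t → tab-diff (wmem σ) B (outside-a (inj₁ z<t))
        ; ques = λ {z} z<h → store-array (mem σ) B Tab a z λ () }
      } , y∈L old , ℚₚ.≤-reflexive (sym (tab-same (wmem σ) B a))))
      where
      τ = ⟦ Tab [ var tab′ᵛ ⊕ var yᵛ ]≔ var sᵛ ⨟ tab[ var tab′ᵛ ⊕ var yᵛ ]≔ wvar wᵛ ⟧ σ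
      good′ : ∀ R → R ∈ L → Dec (R ≡ y) → Good R (arr τ Tab (t + R)) (tab τ (t + R))
      good′ R R∈ (yes refl) = subst₂ (Good R) (sym (store-same (mem σ) B Tab a refl)) (sym (tab-same (wmem σ) B a)) goodY
      good′ R R∈ (no R≢y) = subst₂ (Good R) (sym (store-index (mem σ) B Tab a (a≢ R≢y))) (sym (tab-diff (wmem σ) B (a≢ R≢y))) (good R∈)
      mono′ : ∀ R → Dec (R ≡ y) → tab σ (t + R) ℚ.≤ tab τ (t + R)
      mono′ R (yes refl) = ℚₚ.≤-trans le (ℚₚ.≤-reflexive (sym (tab-same (wmem σ) B a)))
      mono′ R (no R≢y)   = ℚₚ.≤-reflexive (sym (tab-diff (wmem σ) B (a≢ R≢y)))

    keep : 0 < arr σ Tab a → w ℚ.≤ tab σ a → Spec skip σ 60 Entered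
    keep old le = within by-computation (now (record
      { table = table; tail = tail; mono = λ R∈ → R∈ , ℚₚ.≤-refl; outside = outside-refl } , y∈L old , le))

keepBut : ℕ → (ℕ → Bool) → ℕ → Bool
keepBut v r u = r u ∧ not (u ≡ᵇ v)

keepFar : (ℕ → ℕ → Bool) → ℕ → (ℕ → Bool) → ℕ → Bool
keepFar A v r u = r u ∧ not (u ≡ᵇ v) ∧ not (A v u)

distance≤0 : ∀ {i j} → (i ∸ j) + (j ∸ i) ≤ 0 → i ≡ j
distance≤0 {i} {j} le = ≤-antisym
  (m∸n≡0⇒m≤n (n≤0⇒n≡0 (≤-trans (m≤m+n (i ∸ j) (j ∸ i)) le)))
  (m∸n≡0⇒m≤n (n≤0⇒n≡0 (≤-trans (m≤n+m (j ∸ i) (i ∸ j)) le)))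

distance>0 : ∀ {i j} → 0 < (i ∸ j) + (j ∸ i) → i ≢ j
distance>0 {i} lt refl rewrite n∸n≡0 i = <-irrefl refl lt

∸-suc-suc : ∀ {d n} → d < n → n ∸ d ≡ suc (n ∸ suc d)
∸-suc-suc {zero}  {suc n} _         = refl
∸-suc-suc {suc d} {suc n} (s≤s d<n) = ∸-suc-suc d<n

record Decoded (n : ℕ) (A : ℕ → ℕ → Bool) (v : ℕ) (r : ℕ → Bool) (τ : State) : Set where
  field
    y₀≡ : reg τ y₀ᵛ ≡ mask n (keepBut v r)
    y₁≡ : reg τ y₁ᵛ ≡ mask n (keepFar A v r)
    f≡  : reg τ fᵛ ≡ encodeBool (r v)

module _ {n : ℕ} {A : ℕ → ℕ → Bool} {v : ℕ} (r : ℕ → Bool) (σ : State)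
         (v<n : v < n) (regn : reg σ nᵛ ≡ n) (regv : reg σ vᵛ ≡ v) (regR : reg σ Rᵛ ≡ mask n r)
         (pow : ∀ u → u < n → arr σ Pow u ≡ 2 ^ u)
         (row : ∀ u → u < n → reg σ rowᵛ + u < reg σ 0 × mem σ (reg σ rowᵛ + u) ≡ encodeBool (A v u))
  where

  private
    r₀ = keepBut v r
    r₁ = keepFar A v r

    -- `m` bits are still unread. Each accumulator plus the unread part of its target is constant,
    -- which avoids masks of upper bits.
    record Inv (m : ℕ) (τ : State) : Set where
      field
        x  : reg τ xᵛ ≡ mask m r
        y₀ : reg τ y₀ᵛ + mask m r₀ ≡ mask n r₀
        y₁ : reg τ y₁ᵛ + mask m r₁ ≡ mask n r₁
        f⁻ : v < m → reg τ fᵛ ≡ 0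
        f⁺ : m ≤ v → reg τ fᵛ ≡ encodeBool (r v)

    shift : ∀ {y y′ a b m} → y′ ≡ y + b → y + (a + b) ≡ m → y′ + a ≡ m
    shift {y} {a = a} {b} refl eq = trans (trans (+-assoc y b a) (cong (y +_) (+-comm b a))) eq

  decodeSpec : Spec decode σ (30 + n * 150) (Decoded n A v r)
  decodeSpec = weaken (≤-trans (≤-reflexive (arith n)) (+-monoˡ-≤ (n * 150) (by-computation {17} {30}))) (λ τ _ inv → record
      { y₀≡ = trans (sym (+-identityʳ _)) (trans (cong (λ m → reg τ y₀ᵛ + mask m r₀) (sym (n∸n≡0 n))) (Inv.y₀ inv))
      ; y₁≡ = trans (sym (+-identityʳ _)) (trans (cong (λ m → reg τ y₁ᵛ + mask m r₁) (sym (n∸n≡0 n))) (Inv.y₁ inv))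
      ; f≡  = Inv.f⁺ inv (subst (_≤ v) (sym (n∸n≡0 n)) z≤n) })
    (first (first (first (first (forSpec n 145 (λ d → Inv (n ∸ d)) regn init body)))))
    where
    arith : ∀ n → 4 + (3 + (3 + (3 + (4 + n * 150)))) ≡ 17 + n * 150
    arith n = refl
    σ₀ = ⟦ xᵛ ≔ var Rᵛ ⨟ y₀ᵛ ≔ lit 0 ⨟ y₁ᵛ ≔ lit 0 ⨟ fᵛ ≔ lit 0 ⟧ σ
    init : Inv n σ₀
    init = record { x = regR; y₀ = refl; y₁ = refl; f⁻ = λ _ → refl; f⁺ = λ n≤v → contradiction v<n (≤⇒≯ n≤v) }
    body : ∀ d τ → d < n → _ → Inv (n ∸ d) τ → Spec _ (set dᵛ d τ) 145 (Inv (n ∸ suc d))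
    body d τ d<n fr inv = within by-computation (first (first (branch {t = 110} present absent)))
      where
      m = n ∸ suc d
      τ₁ = ⟦ bᵛ ≔ var nᵛ ⊖ (var dᵛ ⊕ lit 1) ⨟ powᵛ ≔ Pow at var bᵛ ⟧ (set dᵛ d τ)
      m<n : m < n
      m<n = subst (_≤ n) (∸-suc-suc d<n) (m∸n≤m n d)
      inv′ : Inv (suc m) τ
      inv′ = subst (λ k → Inv k τ) (∸-suc-suc d<n) inv
      open Inv inv′
      b≡ : reg τ₁ bᵛ ≡ m
      b≡ = cong₂ _∸_ (trans (Frame.regs fr nᵛ refl) regn) (+-comm d 1)
      pow≡ : reg τ₁ powᵛ ≡ 2 ^ m
      pow≡ = trans (cong (arr τ Pow) b≡) (trans (Frame.arrs fr refl Pow refl m) (pow m m<n))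
      v≡ : reg τ vᵛ ≡ v
      v≡ = trans (Frame.regs fr vᵛ refl) regv
      row≡ : mem τ (reg τ rowᵛ + reg τ₁ bᵛ) ≡ encodeBool (A v m)
      row≡ = trans (cong₂ (λ i j → mem τ (i + j)) (Frame.regs fr rowᵛ refl) b≡)
               (trans (Frame.inps fr refl (proj₁ (row m m<n))) (proj₂ (row m m<n)))

      mk : ∀ {τ′} → reg τ′ xᵛ ≡ mask m r → reg τ′ y₀ᵛ ≡ reg τ y₀ᵛ + bit (r₀ m) m → reg τ′ y₁ᵛ ≡ reg τ y₁ᵛ + bit (r₁ m) m →
           (m ≡ v → reg τ′ fᵛ ≡ encodeBool (r v)) → (m ≢ v → reg τ′ fᵛ ≡ reg τ fᵛ) → Inv m τ′
      mk {τ′} x≡ y₀≡ y₁≡ f= f≠ = record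
        { x = x≡
        ; y₀ = shift {reg τ y₀ᵛ} {a = mask m r₀} {bit (r₀ m) m} y₀≡ y₀
        ; y₁ = shift {reg τ y₁ᵛ} {a = mask m r₁} {bit (r₁ m) m} y₁≡ y₁
        ; f⁻ = λ v<m → trans (f≠ (>⇒≢ v<m)) (f⁻ (m<n⇒m<1+n v<m))
        ; f⁺ = λ m≤v → f⁺′ (m≤n⇒m<n∨m≡n m≤v) }
        where
        f⁺′ : m < v ⊎ m ≡ v → reg τ′ fᵛ ≡ encodeBool (r v)
        f⁺′ (inj₁ m<v) = trans (f≠ (<⇒≢ m<v)) (f⁺ m<v)
        f⁺′ (inj₂ m≡v) = f= m≡v

      nothing : ∀ y {b} → b ≡ false → y ≡ y + bit b m
      nothing y refl = sym (+-identityʳ y)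
      something : ∀ y {b} → b ≡ true → y + reg τ₁ powᵛ ≡ y + bit b m
      something y refl = cong (y +_) pow≡

      absent : reg τ xᵛ < reg τ₁ powᵛ → Spec skip τ₁ 110 (Inv m)
      absent lt = within by-computation (now (mk
        (trans x (trans (cong (λ b → mask m r + bit b m) rm) (+-identityʳ _)))
        (nothing _ (cong (_∧ not (m ≡ᵇ v)) rm)) (nothing _ (cong (_∧ (not (m ≡ᵇ v) ∧ not (A v m))) rm))
        (λ m≡v → trans (f⁻ (≤-reflexive (cong suc (sym m≡v)))) (sym (cong encodeBool (trans (cong r (sym m≡v)) rm))))
        (λ _ → refl)))
        where
        rm : r m ≡ false
        rm = no-top-bit m r (subst₂ _<_ x pow≡ lt)

      present : reg τ₁ powᵛ ≤ reg τ xᵛ → Spec _ τ₁ 110 (Inv m)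
      present le = within by-computation (first (branch {t = 60} same other))
        where
        rm : r m ≡ true
        rm = top-bit m r (subst₂ _≤_ pow≡ x le)
        x≡ : reg τ xᵛ ∸ reg τ₁ powᵛ ≡ mask m r
        x≡ = trans (cong₂ _∸_ (trans x (cong (λ b → mask m r + bit b m) rm)) pow≡) (m+n∸n≡m (mask m r) (2 ^ m))
        τ₂ = ⟦ xᵛ ≔ var xᵛ ⊖ var powᵛ ⟧ τ₁
        same : (reg τ₁ bᵛ ∸ reg τ vᵛ) + (reg τ vᵛ ∸ reg τ₁ bᵛ) ≤ 0 → Spec _ τ₂ 60 (Inv m)
        same le₀ = within by-computation (now (mk x≡ (nothing _ r₀m) (nothing _ r₁m)
            (λ { refl → sym (cong encodeBool rm) }) (λ m≢v → contradiction m≡v m≢v)))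
          where
          m≡v : m ≡ v
          m≡v = trans (sym b≡) (trans (distance≤0 le₀) v≡)
          m≡ᵇv : (m ≡ᵇ v) ≡ true
          m≡ᵇv = trans (cong (m ≡ᵇ_) (sym m≡v)) (≡ᵇ-refl m)
          r₀m : r₀ m ≡ false
          r₀m rewrite rm | m≡ᵇv = refl
          r₁m : r₁ m ≡ false
          r₁m rewrite rm | m≡ᵇv = refl
        other : 0 < (reg τ₁ bᵛ ∸ reg τ vᵛ) + (reg τ vᵛ ∸ reg τ₁ bᵛ) → Spec _ τ₂ 60 (Inv m)
        other gt = within by-computation (first (branch {t = 20}
          (λ a≤0 → within by-computation (now (mk x≡ (something _ r₀m) (something _ (r₁m (n≤0⇒n≡0 (subst (_≤ 0) row≡ a≤0)))) m≡v⇒ (λ _ → refl))))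
          (λ a>0 → within by-computation (now (mk x≡ (something _ r₀m) (nothing _ (r₁m′ (subst (0 <_) row≡ a>0))) m≡v⇒ (λ _ → refl))))))
          where
          m≢v : m ≢ v
          m≢v m≡v = distance>0 gt (trans b≡ (trans m≡v (sym v≡)))
          m≡v⇒ : ∀ {C : Set} → m ≡ v → C
          m≡v⇒ m≡v = contradiction m≡v m≢v
          r₀m : r₀ m ≡ true
          r₀m rewrite rm | ≢⇒≡ᵇ m≢v = refl
          r₁m : encodeBool (A v m) ≡ 0 → r₁ m ≡ true
          r₁m eq rewrite rm | ≢⇒≡ᵇ m≢v with A v m
          ... | false = refl
          r₁m′ : 0 < encodeBool (A v m) → r₁ m ≡ false
          r₁m′ gt rewrite rm | ≢⇒≡ᵇ m≢v with A v m
          ... | true = refl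

-- Leaving out the current vertex is always possible; taking it is tried only if the decoded set
-- contains it.
expand : Cmd
expand =
  Rᵛ ≔ Que at (var headᵛ ⊕ var recᵛ) ⨟ decode ⨟
  (sᵛ ≔ Tab at (var tabᵛ ⊕ var Rᵛ) ⨟ wᵛ ≔ʷ wtab (var tabᵛ ⊕ var Rᵛ) ⨟ yᵛ ≔ var y₀ᵛ) ⨟ insert ⨟
  if≤ (lit 1) (var fᵛ)
    ((sᵛ ≔ (Tab at (var tabᵛ ⊕ var Rᵛ)) ⊕ (Pow at var vᵛ) ⨟
      wᵛ ≔ʷ wtab (var tabᵛ ⊕ var Rᵛ) ⊞ winp (var vᵛ) ⨟ yᵛ ≔ var y₁ᵛ) ⨟ insert)
    skip

scanKeys : Cmd
scanKeys = for uᵛ (var nᵛ) (if≤ (Key at var uᵛ) (var leastᵛ) (vᵛ ≔ var uᵛ ⨟ leastᵛ ≔ Key at var uᵛ) skip)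

select : Cmd
select =
  leastᵛ ≔ var infᵛ ⨟ vᵛ ≔ lit 0 ⨟ scanKeys ⨟
  -- `infᵛ` bounds all keys and is the initial value of `leastᵛ`. Its successor therefore excludes
  -- the vertex from later searches, while an unprocessed key equal to `infᵛ` is still found.
  Key [ var vᵛ ]≔ var infᵛ ⊕ lit 1

-- The adjacency matrix follows six header cells; the product of the vertex and n is formed by
-- repeated addition.
findRow : Cmd
findRow = rowᵛ ≔ lit 6 ⨟ for jᵛ (var vᵛ) (rowᵛ ≔ var rowᵛ ⊕ var nᵛ)

-- Every stage uses a fresh part of the table and of the queue, so nothing has to be cleared.
stage : Cmd
stage =
  select ⨟ findRow ⨟ (tab′ᵛ ≔ var tabᵛ ⊕ var 2ⁿᵛ ⨟ head′ᵛ ≔ var tailᵛ) ⨟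
  for recᵛ (var tailᵛ ⊖ var headᵛ) expand ⨟ (tabᵛ ≔ var tab′ᵛ ⨟ headᵛ ≔ var head′ᵛ)

table-cong : ∀ {P Good t h L σ τ} → (∀ z → arr τ Tab z ≡ arr σ Tab z) → (∀ z → arr τ Que z ≡ arr σ Que z) →
             (∀ z → tab τ z ≡ tab σ z) → Table P Good t h L σ → Table P Good t h L τ
table-cong {Good = Good} {t} {h} {L} tabs ques wtabs table = record
  { unique = unique
  ; small  = small
  ; queued = λ R∈ → let j , j< , eq = queued R∈ in j , j< , trans (ques (h + j)) eq
  ; listed = λ {j} j< → subst (_∈ L) (sym (ques (h + j))) (listed j<)
  ; good   = λ {R} R∈ → subst₂ (Good R) (sym (tabs (t + R))) (sym (wtabs (t + R))) (good R∈)
  ; empty  = λ {R} R<P R∉ → trans (tabs (t + R)) (empty R<P R∉) }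
  where open Table table

count : ℕ → (ℕ → Bool) → ℕ
count zero    f = 0
count (suc m) f = count m f + encodeBool (f m)

encodeBool≤1 : ∀ b → encodeBool b ≤ 1
encodeBool≤1 true  = ≤-refl
encodeBool≤1 false = z≤n

count≤ : ∀ m f → count m f ≤ m
count≤ zero    f = z≤n
count≤ (suc m) f = ≤-trans (+-mono-≤ (count≤ m f) (encodeBool≤1 (f m))) (≤-reflexive (+-comm m 1))

count-cong : ∀ m {f g} → (∀ u → u < m → f u ≡ g u) → count m f ≡ count m g
count-cong zero    _  = refl
count-cong (suc m) eq = cong₂ (λ x b → x + encodeBool b) (count-cong m (λ u u<m → eq u (m<n⇒m<1+n u<m))) (eq m (n<1+n m))

count-ins : ∀ {m v} f → v < m → f v ≡ false → count m (ins v f) ≡ suc (count m f)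
count-ins {suc m} {v} f v<m fv with <suc⇒<⊎≡ v<m
... | inj₂ refl rewrite ≡ᵇ-refl v | fv = trans (+-comm _ 1)
  (cong suc (trans (count-cong v (λ u u<v → ins-other f (<⇒≢ u<v))) (sym (+-identityʳ _))))
... | inj₁ v<m′ rewrite ≢⇒≡ᵇ (>⇒≢ v<m′) | count-ins f v<m′ fv = refl

count-full : ∀ m f → count m f ≡ m → ∀ u → u < m → f u ≡ true
count-full (suc m) f eq u u<m with f m in fm
... | false = contradiction (≤-reflexive (sym (trans (sym (+-identityʳ _)) eq))) (<⇒≱ (s≤s (count≤ m f)))
... | true with <suc⇒<⊎≡ u<m
...   | inj₂ refl = fm
...   | inj₁ u<m′ = count-full m f (suc-injective (trans (+-comm 1 _) eq)) u u<m′

count-empty : ∀ m → count m (λ _ → false) ≡ 0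
count-empty zero = refl
count-empty (suc m) = trans (+-identityʳ _) (count-empty m)

count< : ∀ m f → count m f < m → ∃[ u ] (u < m × f u ≡ false)
count< (suc m) f lt with f m in fm
... | false = m , n<1+n m , fm
... | true with count< m f (+-cancelʳ-≤ 1 _ _ (subst₂ _≤_ refl (+-comm 1 m) lt))
...   | u , u<m , fu = u , m<n⇒m<1+n u<m , fu

-- Collects what every stage reads and none changes. `room` and `roomʷ` place the matrix and the
-- weights below register 0, where clean commands leave them intact.
record Ctx (n : ℕ) (A : ℕ → ℕ → Bool) (w : ℕ → ℚ) (σ : State) : Set where
  field
    n≡      : reg σ nᵛ ≡ n
    2ⁿ≡     : reg σ 2ⁿᵛ ≡ 2 ^ n
    pow     : ∀ u → u < n → arr σ Pow u ≡ 2 ^ u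
    room    : 6 + n * n ≤ reg σ 0
    roomʷ   : n ≤ reg σ 0
    adjs    : ∀ v u → v < n → u < n → mem σ (6 + v * n + u) ≡ encodeBool (A v u)
    weights : ∀ u → u < n → wmem σ u ≡ w u

  adjs< : ∀ v u → v < n → u < n → 6 + v * n + u < reg σ 0
  adjs< v u v<n u<n = ≤-trans (+-monoʳ-< (6 + v * n) u<n)
    (≤-trans (≤-reflexive (trans (+-assoc 6 (v * n) n) (cong (6 +_) (+-comm (v * n) n)))) (≤-trans (+-monoʳ-≤ 6 (*-monoˡ-≤ n v<n)) room))

ctx-frame : ∀ {n A w F σ τ} → Frame F σ τ → clean F ≡ true → modifies F nᵛ ≡ false → modifies F 2ⁿᵛ ≡ false →
            stores F Pow ≡ false → Ctx n A w σ → Ctx n A w τ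
ctx-frame fr cl mn mp sp c = record
  { n≡ = trans (regs nᵛ mn) n≡
  ; 2ⁿ≡ = trans (regs 2ⁿᵛ mp) 2ⁿ≡
  ; pow = λ u u<n → trans (arrs cl Pow sp u) (pow u u<n)
  ; room = ≤-trans room (≤-reflexive (sym (base cl)))
  ; roomʷ = ≤-trans roomʷ (≤-reflexive (sym (base cl)))
  ; adjs = λ v u v<n u<n → trans (inps cl (adjs< v u v<n u<n)) (adjs v u v<n u<n)
  ; weights = λ u u<n → trans (winps cl (<-≤-trans u<n roomʷ)) (weights u u<n) }
  where open Frame fr; open Ctx c

KeyState : ℕ → (ℕ → ℕ) → ℕ → (ℕ → Bool) → State → Set
KeyState n key inf done σ = reg σ infᵛ ≡ inf × (∀ u → u < n → arr σ Key u ≡ (if done u then suc inf else key u))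

record Selected (n : ℕ) (key : ℕ → ℕ) (inf : ℕ) (done : ℕ → Bool) (τ : State) : Set where
  field
    {v}    : ℕ
    v<n    : v < n
    v≡     : reg τ vᵛ ≡ v
    undone : done v ≡ false
    least  : ∀ u → u < n → done u ≡ false → key v ≤ key u
    keys   : KeyState n key inf (ins v done) τ

selectSpec : ∀ {n key inf done} σ → reg σ nᵛ ≡ n → (∀ u → u < n → key u ≤ inf) →
             KeyState n key inf done σ → (∃[ u ] (u < n × done u ≡ false)) →
             Spec select σ (30 + n * 60) (Selected n key inf done)
selectSpec {n} {key} {inf} {done} σ n≡ key≤ (inf≡ , keys) (u₀ , u₀<n , u₀-undone) =
  within (≤-trans (≤-reflexive (arith (n * 60))) (+-monoˡ-≤ (n * 60) (by-computation {24} {30})))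
    (first (first (andThen (forSpec n 55 Inv n≡ init body) finish)))
  where
  arith : ∀ m → 4 + (3 + ((4 + m) + 13)) ≡ 24 + m
  arith = solve-∀
  record Inv (i : ℕ) (τ : State) : Set where
    field
      below : ∀ u → u < i → done u ≡ false → reg τ leastᵛ ≤ key u
      top   : reg τ leastᵛ ≤ inf
      found : ((∀ u → u < i → done u ≡ true) × reg τ leastᵛ ≡ inf) ⊎
              (reg τ vᵛ < n × done (reg τ vᵛ) ≡ false × reg τ leastᵛ ≡ key (reg τ vᵛ))
  σ₁ = ⟦ leastᵛ ≔ var infᵛ ⨟ vᵛ ≔ lit 0 ⟧ σ
  init : Inv 0 σ₁
  init = record { below = λ _ (); top = ≤-reflexive inf≡; found = inj₁ ((λ _ ()) , inf≡) }
  body : ∀ i τ → i < n → Frame (foot scanKeys) σ₁ τ → Inv i τ → Spec _ (set uᵛ i τ) 55 (Inv (suc i))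
  body i τ i<n fr inv = within by-computation (branch {t = 30} better worse)
    where
    open Inv inv
    keyi : arr τ Key i ≡ (if done i then suc inf else key i)
    keyi = trans (Frame.arrs fr refl Key refl i) (keys i i<n)
    keyi⁺ : done i ≡ true → arr τ Key i ≡ suc inf
    keyi⁺ di = trans keyi (cong (if_then suc inf else key i) di)
    keyi⁻ : done i ≡ false → arr τ Key i ≡ key i
    keyi⁻ di = trans keyi (cong (if_then suc inf else key i) di)
    better : arr τ Key i ≤ reg τ leastᵛ → Spec _ (set uᵛ i τ) 30 (Inv (suc i))
    better le with done i in di
    ... | true  = contradiction (≤-trans (≤-reflexive (sym (keyi⁺ di))) (≤-trans le top)) (<⇒≱ (n<1+n inf))
    ... | false = within by-computation (now (record
      { below = λ u u<i du → below′ u (<suc⇒<⊎≡ u<i) du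
      ; top = ≤-trans le top
      ; found = inj₂ (i<n , di , keyi⁻ di) }))
      where
      below′ : ∀ u → u < i ⊎ u ≡ i → done u ≡ false → arr τ Key i ≤ key u
      below′ u (inj₁ u<i) du = ≤-trans le (below u u<i du)
      below′ u (inj₂ refl) du = ≤-reflexive (keyi⁻ di)
    worse : reg τ leastᵛ < arr τ Key i → Spec skip (set uᵛ i τ) 30 (Inv (suc i))
    worse gt = within by-computation (now (record
      { below = λ u u<i du → below′ u (<suc⇒<⊎≡ u<i) du
      ; top = top
      ; found = found′ found }))
      where
      below′ : ∀ u → u < i ⊎ u ≡ i → done u ≡ false → reg τ leastᵛ ≤ key u
      below′ u (inj₁ u<i) du = below u u<i du
      below′ u (inj₂ refl) du = ≤-trans (<⇒≤ gt) (≤-reflexive (keyi⁻ du))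
      found′ : _ → _
      found′ (inj₂ f) = inj₂ f
      found′ (inj₁ (all , eq)) with done i in di
      ... | true = inj₁ ((λ u u<i → all′ u (<suc⇒<⊎≡ u<i)) , eq)
        where
        all′ : ∀ u → u < i ⊎ u ≡ i → done u ≡ true
        all′ u (inj₁ u<i) = all u u<i
        all′ u (inj₂ refl) = di
      ... | false = contradiction (≤-trans (≤-reflexive (keyi⁻ di)) (key≤ i i<n)) (<⇒≱ (subst (_< arr τ Key i) eq gt))
  finish : ∀ τ → Frame (foot scanKeys) σ₁ τ → Inv n τ → Spec _ τ 13 (Selected n key inf done)
  finish τ fr inv with Inv.found inv
  ... | inj₁ (all , _) = contradiction u₀-undone (true≢false (all u₀ u₀<n))
  ... | inj₂ (v<n , dv , eq) = within by-computation (now (record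
    { v<n = v<n; v≡ = refl; undone = dv
    ; least = λ u u<n du → ≤-trans (≤-reflexive (sym eq)) (Inv.below inv u u<n du)
    ; keys = trans (Frame.regs fr infᵛ refl) inf≡ , keys′ }))
    where
    keys′ : ∀ u → u < n → (mem τ [ cell (reg τ 0) Key (reg τ vᵛ) ↦ reg τ infᵛ + 1 ]) (cell (reg τ 0) Key u) ≡
            (if ins (reg τ vᵛ) done u then suc inf else key u)
    keys′ u u<n with u ≟ reg τ vᵛ
    ... | yes refl rewrite ins-same u {done} = trans (store-same (mem τ) (reg τ 0) Key u refl)
            (trans (cong (_+ 1) (trans (Frame.regs fr infᵛ refl) inf≡)) (+-comm inf 1))
    ... | no u≢v rewrite ins-other {u} {reg τ vᵛ} done u≢v =
            trans (store-index (mem τ) (reg τ 0) Key (reg τ vᵛ) u≢v) (trans (Frame.arrs fr refl Key refl u) (keys u u<n))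

any<-cong : ∀ m {p q : ℕ → Bool} → (∀ u → u < m → p u ≡ q u) → any< m p ≡ any< m q
any<-cong zero    _  = refl
any<-cong (suc m) eq = cong₂ _∨_ (eq m (n<1+n m)) (any<-cong m (λ u u<m → eq u (m<n⇒m<1+n u<m)))

findRowSpec : ∀ {n A w v} σ → Ctx n A w σ → v < n → reg σ vᵛ ≡ v →
              Spec findRow σ (7 + n * 12) (λ τ → reg τ rowᵛ ≡ 6 + v * n)
findRowSpec {n} {v = v} σ ctx v<n v≡ =
  within (+-monoʳ-≤ 7 (*-monoˡ-≤ 12 (<⇒≤ v<n)))
    (first (forSpec v 7 (λ i τ → reg τ rowᵛ ≡ 6 + i * n) v≡ refl
      (λ i τ _ fr inv → within by-computation (now (trans
        (cong₂ _+_ inv (trans (Frame.regs fr nᵛ refl) (Ctx.n≡ ctx)))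
        (trans (+-assoc 6 (i * n) n) (cong (6 +_) (+-comm (i * n) n))))))))

record Symmetric (A : ℕ → ℕ → Bool) : Set where
  field
    symmetric   : ∀ s t → A s t ≡ A t s
    irreflexive : ∀ s → A s s ≡ false

expandAll : Cmd
expandAll = for recᵛ (var tailᵛ ⊖ var headᵛ) expand

module DP (n : ℕ) (A : ℕ → ℕ → Bool) (w : ℕ → ℚ) (sym-A : Symmetric A) (K : ℕ → Bool) where

  open Available n A K
  open Symmetric sym-A

  -- Masks are stored incremented, so that 0 marks a free cell of the table.
  Good : (ℕ → Bool) → ℕ → ℕ → ℚ → Set
  Good done R s x = ∃[ S ] (Partial done S × R ≡ mask n (available done S) × s ≡ suc (mask n S) × x ≡ wsum w n S)

  good-positive : ∀ {done R s x} → Good done R s x → 1 ≤ s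
  good-positive (_ , _ , _ , refl , _) = s≤s z≤n

  available-cong : ∀ done {S S′} → (∀ u → u < n → S u ≡ S′ u) → ∀ u → available done S u ≡ available done S′ u
  available-cong done eq u = cong (λ h → K u ∧ not (done u) ∧ not h) (any<-cong n (λ s s<n → cong (_∧ A s u) (eq s s<n)))

  module _ {done : ℕ → Bool} {v : ℕ} (v<n : v < n) (undone : done v ≡ false) where

    done′ = ins v done

    still-done : ∀ {u} → done u ≡ true → done′ u ≡ true
    still-done {u} du rewrite du = ∨-zeroʳ (u ≡ᵇ v)

    partial-skip : ∀ {S} → Partial done S → Partial done′ S
    partial-skip p = record { members = λ s s<n Ss → let ds , Ks = members s s<n Ss in still-done ds , Ks ; independent = independent }
      where open Partial p

    v∉ : ∀ {S} → Partial done S → S v ≡ false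
    v∉ p = ≢true⇒false (λ Sv → true≢false (proj₁ (Partial.members p v v<n Sv)) undone)

    partial-take : ∀ {S} → Partial done S → available done S v ≡ true → Partial done′ (ins v S)
    partial-take {S} p av = record { members = members′ ; independent = independent′ }
      where
      open Partial p
      Kv : K v ≡ true
      Kv = ∧-trueˡ av
      ¬hit : hit S v ≡ false
      ¬hit = not-true⇒false (∧-trueʳ {not (done v)} (∧-trueʳ {K v} av))
      free : ∀ s → s < n → S s ≡ true → A s v ≡ false
      free s s<n Ss = ≢true⇒false (λ Asv → true≢false (any<-intro (λ s → S s ∧ A s v) s<n (∧-intro Ss Asv)) ¬hit)
      members′ : ∀ s → s < n → ins v S s ≡ true → done′ s ≡ true × K s ≡ true
      members′ s s<n Ss with ins-elim {s} {v} S Ss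
      ... | inj₁ refl = ins-same v {done} , Kv
      ... | inj₂ Ss′ = let ds , Ks = members s s<n Ss′ in still-done ds , Ks
      independent′ : IndependentSet (ins v S)
      independent′ s t s<n t<n Ss St with ins-elim {s} {v} S Ss | ins-elim {t} {v} S St
      ... | inj₁ refl | inj₁ refl = irreflexive v
      ... | inj₁ refl | inj₂ St′  = trans (symmetric v t) (free t t<n St′)
      ... | inj₂ Ss′  | inj₁ refl = free s s<n Ss′
      ... | inj₂ Ss′  | inj₂ St′  = independent s t s<n t<n Ss′ St′

    partial-remove : ∀ {I} → Partial done′ I → Partial done (keepBut v I)
    partial-remove {I} p = record { members = members′
      ; independent = λ s t s<n t<n Is It → independent s t s<n t<n (∧-trueˡ Is) (∧-trueˡ It) }
      where
      open Partial p
      members′ : ∀ s → s < n → keepBut v I s ≡ true → done s ≡ true × K s ≡ true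
      members′ s s<n Is with members s s<n (∧-trueˡ Is)
      ... | ds , Ks = trans (sym (ins-other done (≡ᵇ-false⇒≢ (not-true⇒false (∧-trueʳ {I s} Is))))) ds , Ks

    -- This is what completeness needs from the expansion of `r`. The weights are bounded only from
    -- below, because another predecessor may have brought a heavier set to the same mask.
    record Expanded (t t′ : ℕ) (σ τ : State) (L′ : List ℕ) (r : ℕ → Bool) : Set where
      field
        skipped : mask n (keepBut v r) ∈ L′ × tab σ (t + mask n r) ℚ.≤ tab τ (t′ + mask n (keepBut v r))
        taken   : r v ≡ true → mask n (keepFar A v r) ∈ L′ ×
                  tab σ (t + mask n r) ℚ.+ w v ℚ.≤ tab τ (t′ + mask n (keepFar A v r))

    expanded-cong : ∀ {t t′ σ τ L′ r r′} → (∀ u → u < n → r u ≡ r′ u) → Expanded t t′ σ τ L′ r → Expanded t t′ σ τ L′ r′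
    expanded-cong {t} {t′} {σ} {τ} {L′} {r} {r′} eq e = record
      { skipped = subst₂ (λ a b → b ∈ L′ × tab σ (t + a) ℚ.≤ tab τ (t′ + b)) mr m₀ skipped
      ; taken = λ r′v → subst₂ (λ a b → b ∈ L′ × tab σ (t + a) ℚ.+ w v ℚ.≤ tab τ (t′ + b)) mr m₁ (taken (trans (eq v v<n) r′v)) }
      where
      open Expanded e
      mr = mask-cong n eq
      m₀ = mask-cong n (λ u u<n → cong (_∧ not (u ≡ᵇ v)) (eq u u<n))
      m₁ = mask-cong n (λ u u<n → cong (_∧ (not (u ≡ᵇ v) ∧ not (A v u))) (eq u u<n))

    -- The new table starts blank, hence `[]`. `progress` speaks of every function with the queued
    -- mask, because a mask fixes membership only below `n`, and the functions met in the
    -- completeness proof are not the one taken from the table.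
    record ExpandInv (t h : ℕ) (L : List ℕ) (σ : State) (i : ℕ) (τ : State) : Set where
      field
        grown    : Grown (2 ^ n) (Good done′) (t + 2 ^ n) (h + length L) [] σ τ
        progress : ∀ j → j < i → ∀ r → arr σ Que (h + j) ≡ mask n r → Expanded t (t + 2 ^ n) σ τ (Grown.L′ grown) r

    expandSpec : ∀ {t h L} σ → Ctx n A w σ → reg σ tabᵛ ≡ t → reg σ headᵛ ≡ h → reg σ tab′ᵛ ≡ t + 2 ^ n →
                 reg σ vᵛ ≡ v → reg σ rowᵛ ≡ 6 + v * n → Table (2 ^ n) (Good done) t h L σ →
                 ∀ i τ → i < length L → Frame (foot expandAll) σ τ → ExpandInv t h L σ i τ →
                 Spec expand (set recᵛ i τ) (300 + n * 150) (ExpandInv t h L σ (suc i))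
    expandSpec {t} {h} {L} σ ctx tab≡ head≡ tab′≡ v≡ row≡ table i τ i<l fr inv =
      within (≤-trans (≤-reflexive (arith (n * 150))) (+-monoˡ-≤ (n * 150) (by-computation {296} {300})))
        (first (andThen (decodeSpec r τ₁ v<n (Ctx.n≡ ctxτ) v≡τ (trans R≡ mask-r) (Ctx.pow ctxτ) row) afterDecode))
      where
      arith : ∀ m → 14 + ((30 + m) + (27 + (90 + 135))) ≡ 296 + m
      arith = solve-∀
      P = 2 ^ n
      t′ = t + P
      h′ = h + length L
      R = arr σ Que (h + i)
      R∈L : R ∈ L
      R∈L = Table.listed table i<l
      S = proj₁ (Table.good table R∈L)
      S-partial = proj₁ (proj₂ (Table.good table R∈L))
      r = available done S
      mask-r : R ≡ mask n r
      mask-r = proj₁ (proj₂ (proj₂ (Table.good table R∈L)))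
      s≡ : arr σ Tab (t + R) ≡ suc (mask n S)
      s≡ = proj₁ (proj₂ (proj₂ (proj₂ (Table.good table R∈L))))
      w≡ : tab σ (t + R) ≡ wsum w n S
      w≡ = proj₂ (proj₂ (proj₂ (proj₂ (Table.good table R∈L))))
      y₀ = mask n (keepBut v r)
      y₁ = mask n (keepFar A v r)

      open ExpandInv inv
      module G = Grown grown
      module O = Outside G.outside
      ctxτ : Ctx n A w τ
      ctxτ = ctx-frame fr refl refl refl refl ctx
      v≡τ : reg τ vᵛ ≡ v
      v≡τ = trans (Frame.regs fr vᵛ refl) v≡
      τ₁ = ⟦ Rᵛ ≔ Que at (var headᵛ ⊕ var recᵛ) ⟧ (set recᵛ i τ)
      R≡ : reg τ₁ Rᵛ ≡ R
      R≡ = trans (cong (λ h → arr τ Que (h + i)) (trans (Frame.regs fr headᵛ refl) head≡)) (O.ques (+-monoʳ-< h i<l))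
      tR<t′ : t + R < t′
      tR<t′ = +-monoʳ-< t (Table.small table R∈L)
      row : ∀ u → u < n → reg τ rowᵛ + u < reg τ 0 × mem τ (reg τ rowᵛ + u) ≡ encodeBool (A v u)
      row u u<n rewrite trans (Frame.regs fr rowᵛ refl) row≡ = Ctx.adjs< ctxτ v u v<n u<n , Ctx.adjs ctxτ v u v<n u<n

      good₀ : Good done′ y₀ (suc (mask n S)) (wsum w n S)
      good₀ = S , partial-skip S-partial , sym (mask-cong n (λ u _ → available-skip v done S u)) , refl , refl
      good₁ : r v ≡ true → Good done′ y₁ (suc (mask n S) + 2 ^ v) (wsum w n S ℚ.+ w v)
      good₁ rv = ins v S , partial-take S-partial rv , sym (mask-cong n (λ u _ → available-take done S u v<n)) ,
        cong suc (sym (mask-ins S v<n (v∉ S-partial))) , sym (wsum-ins w S v<n (v∉ S-partial))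

      afterDecode : ∀ τ₂ → Frame (foot decode) τ₁ τ₂ → Decoded n A v r τ₂ → Spec _ τ₂ (27 + (90 + 135)) (ExpandInv t h L σ (suc i))
      afterDecode τ₂ fr₂ dec = first (andThen
          (insertSpec good-positive τ₃
            (trans (Frame.regs fr₂ tab′ᵛ refl) (trans (Frame.regs fr tab′ᵛ refl) tab′≡)) y₀≡
            (trans (cong (arr τ₂ Tab) tR≡) (trans (Frame.arrs fr₂ refl Tab refl (t + R)) (trans (O.tabs (inj₁ tR<t′)) s≡)))
            (trans (cong (tab τ₂) tR≡) (trans (Frame.tabs fr₂ refl refl (t + R)) (trans (O.wtabs tR<t′) w≡)))
            (trans (Frame.regs fr₂ tailᵛ refl) G.tail) table₃ (mask<2^ n (keepBut v r)) good₀)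
          afterInsert)
        where
        open Decoded dec
        τ₃ = ⟦ sᵛ ≔ Tab at (var tabᵛ ⊕ var Rᵛ) ⨟ wᵛ ≔ʷ wtab (var tabᵛ ⊕ var Rᵛ) ⨟ yᵛ ≔ var y₀ᵛ ⟧ τ₂
        tR≡ : reg τ₂ tabᵛ + reg τ₂ Rᵛ ≡ t + R
        tR≡ = cong₂ _+_ (trans (Frame.regs fr₂ tabᵛ refl) (trans (Frame.regs fr tabᵛ refl) tab≡)) (trans (Frame.regs fr₂ Rᵛ refl) R≡)
        table₃ : Table P (Good done′) t′ h′ G.L′ τ₃
        table₃ = table-cong (Frame.arrs fr₂ refl Tab refl) (Frame.arrs fr₂ refl Que refl) (Frame.tabs fr₂ refl refl) G.table
        ctx₂ : Ctx n A w τ₂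
        ctx₂ = ctx-frame fr₂ refl refl refl refl
          (ctx-frame (frame (recᵛ ≔ lit i ⨟ Rᵛ ≔ Que at (var headᵛ ⊕ var recᵛ)) τ) refl refl refl refl ctxτ)
        unchanged : Outside P t′ h′ τ τ₃
        unchanged = record
          { tabs = λ {z} _ → Frame.arrs fr₂ refl Tab refl z; wtabs = λ {z} _ → Frame.tabs fr₂ refl refl z
          ; ques = λ {z} _ → Frame.arrs fr₂ refl Que refl z }

        extend : ∀ {τ′ L″} → (∀ {R′} → R′ ∈ G.L′ → R′ ∈ L″ × tab τ (t′ + R′) ℚ.≤ tab τ′ (t′ + R′)) →
                 Expanded t t′ σ τ′ L″ r →
                 ∀ j → j < suc i → ∀ r′ → arr σ Que (h + j) ≡ mask n r′ → Expanded t t′ σ τ′ L″ r′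
        extend mono e j j<si r′ eq with <suc⇒<⊎≡ j<si
        ... | inj₂ refl = expanded-cong (mask-injective n (trans (sym mask-r) eq)) e
        ... | inj₁ j<i = record
          { skipped = let R∈ , le = E.skipped; R∈′ , le′ = mono R∈ in R∈′ , ℚₚ.≤-trans le le′
          ; taken = λ rv → let R∈ , le = E.taken rv; R∈′ , le′ = mono R∈ in R∈′ , ℚₚ.≤-trans le le′ }
          where module E = Expanded (progress j j<i r′ eq)

        afterInsert : ∀ τ₄ → Frame (foot insert) τ₃ τ₄ →
                      (Σ (Grown P (Good done′) t′ h′ G.L′ τ₃ τ₄) λ g → y₀ ∈ Grown.L′ g × wsum w n S ℚ.≤ tab τ₄ (t′ + y₀)) →
                      Spec _ τ₄ 135 (ExpandInv t h L σ (suc i))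
        afterInsert τ₄ fr₄ (g₄ , y₀∈ , le₀) = branch {t = 131} take leave
          where
          module G₄ = Grown g₄
          f≡₄ : reg τ₄ fᵛ ≡ encodeBool (r v)
          f≡₄ = trans (Frame.regs fr₄ fᵛ refl) f≡
          old₄ : ∀ {R′} → R′ ∈ G.L′ → R′ ∈ G₄.L′ × tab τ (t′ + R′) ℚ.≤ tab τ₄ (t′ + R′)
          old₄ R′∈ = let R′∈₄ , le = G₄.mono R′∈ in R′∈₄ , ℚₚ.≤-trans (ℚₚ.≤-reflexive (sym (Frame.tabs fr₂ refl refl _))) le
          skipped₄ : y₀ ∈ G₄.L′ × tab σ (t + mask n r) ℚ.≤ tab τ₄ (t′ + y₀)
          skipped₄ = y₀∈ , ℚₚ.≤-trans (ℚₚ.≤-reflexive (trans (cong (λ R → tab σ (t + R)) (sym mask-r)) w≡)) le₀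
          out₄ : Outside P t′ h′ σ τ₄
          out₄ = outside-trans G.outside (outside-trans unchanged G₄.outside)

          leave : reg τ₄ fᵛ < 1 → Spec skip τ₄ 131 (ExpandInv t h L σ (suc i))
          leave f<1 = within by-computation (now (record
            { grown = record { table = G₄.table; tail = G₄.tail; mono = λ (); outside = out₄ }
            ; progress = extend old₄ (record { skipped = skipped₄ ; taken = λ rv → contradiction (≤-reflexive (sym (trans f≡₄ (cong encodeBool rv)))) (<⇒≱ f<1) }) }))

          take : 1 ≤ reg τ₄ fᵛ → Spec _ τ₄ 131 (ExpandInv t h L σ (suc i))
          take 1≤f = weaken ≤-refl done₆ (first (insertSpec good-positive τ₅
              (trans (Frame.regs fr₄ tab′ᵛ refl) (trans (Frame.regs fr₂ tab′ᵛ refl) (trans (Frame.regs fr tab′ᵛ refl) tab′≡)))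
              (trans (Frame.regs fr₄ y₁ᵛ refl) y₁≡)
              (cong₂ _+_ (trans (cong (arr τ₄ Tab) tR≡₄) (trans (Outside.tabs out₄ (inj₁ tR<t′)) s≡))
                (trans (cong (arr τ₄ Pow) v≡₄) (Ctx.pow ctx₄ v v<n)))
              (cong₂ ℚ._+_ (trans (cong (tab τ₄) tR≡₄) (trans (Outside.wtabs out₄ tR<t′) w≡))
                (trans (cong (wmem τ₄) v≡₄) (Ctx.weights ctx₄ v v<n)))
              G₄.tail table₅ (mask<2^ n (keepFar A v r)) (good₁ rv)))
            where
            τ₅ = ⟦ sᵛ ≔ (Tab at (var tabᵛ ⊕ var Rᵛ)) ⊕ (Pow at var vᵛ) ⨟
                   wᵛ ≔ʷ wtab (var tabᵛ ⊕ var Rᵛ) ⊞ winp (var vᵛ) ⨟ yᵛ ≔ var y₁ᵛ ⟧ τ₄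
            rv : r v ≡ true
            rv = ≢false⇒true (λ rv → <⇒≱ 1≤f (≤-reflexive (trans f≡₄ (cong encodeBool rv))))
            ctx₄ : Ctx n A w τ₄
            ctx₄ = ctx-frame fr₄ refl refl refl refl
              (ctx-frame (frame (sᵛ ≔ Tab at (var tabᵛ ⊕ var Rᵛ) ⨟ wᵛ ≔ʷ wtab (var tabᵛ ⊕ var Rᵛ) ⨟ yᵛ ≔ var y₀ᵛ) τ₂) refl refl refl refl ctx₂)
            v≡₄ : reg τ₄ vᵛ ≡ v
            v≡₄ = trans (Frame.regs fr₄ vᵛ refl) (trans (Frame.regs fr₂ vᵛ refl) v≡τ)
            tR≡₄ : reg τ₄ tabᵛ + reg τ₄ Rᵛ ≡ t + R
            tR≡₄ = trans (cong₂ _+_ (Frame.regs fr₄ tabᵛ refl) (Frame.regs fr₄ Rᵛ refl)) tR≡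
            table₅ : Table P (Good done′) t′ h′ G₄.L′ τ₅
            table₅ = table-cong (λ _ → refl) (λ _ → refl) (λ _ → refl) G₄.table
            done₆ : ∀ τ₆ → _ → (Σ (Grown P (Good done′) t′ h′ G₄.L′ τ₅ τ₆) λ g → y₁ ∈ Grown.L′ g × wsum w n S ℚ.+ w v ℚ.≤ tab τ₆ (t′ + y₁)) →
                    ExpandInv t h L σ (suc i) τ₆
            done₆ τ₆ _ (g₆ , y₁∈ , le₁) = record
              { grown = record { table = G₆.table; tail = G₆.tail; mono = λ ()
                ; outside = outside-trans out₄ (outside-trans (record { tabs = λ _ → refl; wtabs = λ _ → refl; ques = λ _ → refl }) G₆.outside) }
              ; progress = extend (λ R′∈ → let R′∈₄ , le = old₄ R′∈; R′∈₆ , le′ = G₆.mono R′∈₄ in R′∈₆ , ℚₚ.≤-trans le le′)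
                  (record
                    { skipped = let R′∈₆ , le′ = G₆.mono (proj₁ skipped₄) in R′∈₆ , ℚₚ.≤-trans (proj₂ skipped₄) le′
                    ; taken = λ _ → y₁∈ , ℚₚ.≤-trans (ℚₚ.≤-reflexive (cong (ℚ._+ w v) (trans (cong (λ R → tab σ (t + R)) (sym mask-r)) w≡))) le₁ }) }
              where module G₆ = Grown g₆

-- One offset: initial entry, n stages, and extraction of the optimum

stages : Cmd
stages = for stageᵛ (var nᵛ) stage

-- The only entry has all kept vertices available and the empty set chosen, whose mask 0 is stored
-- as 1.
startDP : Cmd
startDP =
  Tab [ var tabᵛ ⊕ var keptᵛ ]≔ lit 1 ⨟ tab[ var tabᵛ ⊕ var keptᵛ ]≔ wnil ⨟
  Que [ var tailᵛ ]≔ var keptᵛ ⨟ headᵛ ≔ var tailᵛ ⨟ tailᵛ ≔ var tailᵛ ⊕ lit 1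

-- After n stages no vertex is available, so all solutions have merged into cell 0 of the current
-- table.
improveBest : Cmd
improveBest = if≤ʷ (wvar best-wᵛ) (wtab (var tabᵛ))
  (best-wᵛ ≔ʷ wtab (var tabᵛ) ⨟ bestᵛ ≔ (Tab at var tabᵛ) ⊖ lit 1) skip

dp : Cmd
dp = startDP ⨟ stages ⨟ improveBest ⨟ tabᵛ ≔ var tabᵛ ⊕ var 2ⁿᵛ

mask-empty : ∀ m {f} → (∀ u → u < m → f u ≡ false) → mask m f ≡ 0
mask-empty zero    _  = refl
mask-empty (suc m) eq = cong₂ (λ x b → x + bit b m) (mask-empty m (λ u u<m → eq u (m<n⇒m<1+n u<m))) (eq m (n<1+n m))

wsum-empty : ∀ w m {S} → (∀ u → u < m → S u ≡ false) → wsum w m S ≡ 0ℚ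
wsum-empty w zero    _  = refl
wsum-empty w (suc m) eq = cong₂ (λ x b → x ℚ.+ (if b then w m else 0ℚ)) (wsum-empty w m (λ u u<m → eq u (m<n⇒m<1+n u<m))) (eq m (n<1+n m))

stage-time : ∀ n X {l} → l ≤ suc X →
             30 + n * 60 + (7 + n * 12 + (11 + (7 + l * (5 + (300 + n * 150)) + 8))) ≤ 377 * (suc n * suc X)
stage-time n X {l} l≤ = subst₂ _≤_ (arith n l) (arith′ n X)
    -- 377 is 72 + 305: selection and bookkeeping cost at most `72 * suc n`, one round of expansion
    -- at most `305 * suc n`. The summand added on the right is the exact slack, which leaves a ring
    -- identity.
    (≤-trans (+-monoʳ-≤ (63 + n * 72) (*-monoˡ-≤ (305 + n * 150) l≤)) (m≤m+n _ (9 + 72 * (suc n * X) + suc X * (n * 155))))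
  where
  arith : ∀ n l → 63 + n * 72 + l * (305 + n * 150) ≡ 30 + n * 60 + (7 + n * 12 + (11 + (7 + l * (305 + n * 150) + 8)))
  arith = solve-∀
  arith′ : ∀ n X → 63 + n * 72 + (1 + X) * (305 + n * 150) + (9 + 72 * ((1 + n) * X) + (1 + X) * (n * 155)) ≡ 377 * ((1 + n) * (1 + X))
  arith′ = solve-∀

module Stages (n : ℕ) (A : ℕ → ℕ → Bool) (w : ℕ → ℚ) (sym-A : Symmetric A) (K : ℕ → Bool)
              (key : ℕ → ℕ) (inf : ℕ) (key≤ : ∀ u → u < n → key u ≤ inf)
              (M : ℕ) (narrow : Available.Narrow n A K M key) where

  open Available n A K
  open DP n A w sym-A K

  private
    D P : ℕ
    D = suc (n ^ M)
    P = 2 ^ n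

  -- Soundness is contained in `table`; optimality is `complete`: each partial solution is dominated
  -- by an entry with the same available set. θ separates processed from unprocessed keys, as
  -- `states≤` requires, and `counted` shows that n stages process everything.
  record StageInv (i : ℕ) (τ : State) : Set where
    field
      done     : ℕ → Bool
      θ        : ℕ
      L        : List ℕ
      counted  : count n done ≡ i
      before   : ∀ u → u < n → done u ≡ true → key u ≤ θ
      after    : ∀ u → u < n → done u ≡ false → θ ≤ key u
      keys     : KeyState n key inf done τ
      table    : Table P (Good done) (reg τ tabᵛ) (reg τ headᵛ) L τ
      tail     : reg τ tailᵛ ≡ reg τ headᵛ + length L
      complete : ∀ I → Partial done I → mask n (available done I) ∈ L ×
                 wsum w n I ℚ.≤ tab τ (reg τ tabᵛ + mask n (available done I))
      fresh    : ∀ z → reg τ tabᵛ + P ≤ z → arr τ Tab z ≡ 0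

  stageTime : ℕ
  stageTime = 377 * (suc n * D)

  stageSpec : ∀ i σ → i < n → Ctx n A w σ → StageInv i σ → Spec stage σ stageTime (StageInv (suc i))
  stageSpec i σ i<n ctx inv = within time
    (andThen (selectSpec σ (Ctx.n≡ ctx) key≤ keys (count< n done (subst (_< n) (sym counted) i<n))) afterSelect)
    where
    open StageInv inv
    t = reg σ tabᵛ
    h = reg σ headᵛ
    l≤D : length L ≤ D
    l≤D = states≤ narrow done θ before after L (Table.unique table)
      (λ R∈ → let S , p , eq , _ = Table.good table R∈ in S , p , eq)

    time : 30 + n * 60 + (7 + n * 12 + (11 + (7 + length L * (5 + (300 + n * 150)) + 8))) ≤ stageTime
    time = stage-time n (n ^ M) {length L} l≤D

    afterSelect : ∀ τ₁ → Frame (foot select) σ τ₁ → Selected n key inf done τ₁ →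
                  Spec _ τ₁ (7 + n * 12 + (11 + (7 + length L * (5 + (300 + n * 150)) + 8))) (StageInv (suc i))
    afterSelect τ₁ fr₁ sel = andThen (findRowSpec τ₁ ctx₁ v<n v≡) afterRow
      where
      open Selected sel renaming (keys to keys₁)
      ctx₁ : Ctx n A w τ₁
      ctx₁ = ctx-frame fr₁ refl refl refl refl ctx

      afterRow : ∀ τ₂ → Frame (foot findRow) τ₁ τ₂ → reg τ₂ rowᵛ ≡ 6 + v * n →
                 Spec _ τ₂ (11 + (7 + length L * (5 + (300 + n * 150)) + 8)) (StageInv (suc i))
      afterRow τ₂ fr₂ row≡ = first (andThen
          (forSpec (length L) (300 + n * 150) (ExpandInv v<n undone t h L τ₃) bound init
            (expandSpec v<n undone τ₃ ctx₃ (regs₂ tabᵛ refl refl) (regs₂ headᵛ refl refl)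
              (cong₂ _+_ (regs₂ tabᵛ refl refl) (Ctx.2ⁿ≡ ctx₂))
              (trans (Frame.regs fr₂ vᵛ refl) v≡) row≡ table₃))
          afterExpand)
        where
        τ₃ = ⟦ tab′ᵛ ≔ var tabᵛ ⊕ var 2ⁿᵛ ⨟ head′ᵛ ≔ var tailᵛ ⟧ τ₂
        regs₂ : ∀ x → modifies (foot select) x ≡ false → modifies (foot findRow) x ≡ false → reg τ₂ x ≡ reg σ x
        regs₂ x p q = trans (Frame.regs fr₂ x q) (Frame.regs fr₁ x p)
        tabs₂ : ∀ z → arr τ₂ Tab z ≡ arr σ Tab z
        tabs₂ z = trans (Frame.arrs fr₂ refl Tab refl z) (Frame.arrs fr₁ refl Tab refl z)
        wtabs₂ : ∀ z → tab τ₂ z ≡ tab σ z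
        wtabs₂ z = trans (Frame.tabs fr₂ refl refl z) (Frame.tabs fr₁ refl refl z)
        ctx₂ : Ctx n A w τ₂
        ctx₂ = ctx-frame fr₂ refl refl refl refl ctx₁
        ctx₃ : Ctx n A w τ₃
        ctx₃ = ctx-frame (frame (tab′ᵛ ≔ var tabᵛ ⊕ var 2ⁿᵛ ⨟ head′ᵛ ≔ var tailᵛ) τ₂) refl refl refl refl ctx₂
        table₃ : Table P (Good done) t h L τ₃
        table₃ = table-cong tabs₂ (λ z → trans (Frame.arrs fr₂ refl Que refl z) (Frame.arrs fr₁ refl Que refl z)) wtabs₂ table
        tail₂ : reg τ₂ tailᵛ ≡ h + length L
        tail₂ = trans (regs₂ tailᵛ refl refl) tail
        bound : reg τ₂ tailᵛ ∸ reg τ₂ headᵛ ≡ length L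
        bound = trans (cong₂ _∸_ tail₂ (regs₂ headᵛ refl refl)) (m+n∸m≡n h (length L))
        init : ExpandInv v<n undone t h L τ₃ 0 τ₃
        init = record
          { grown = record
            { L′ = []
            ; table = record { unique = []; small = λ (); queued = λ (); listed = λ (); good = λ ()
                             ; empty = λ {R} _ _ → trans (tabs₂ (t + P + R)) (fresh (t + P + R) (m≤m+n (t + P) R)) }
            ; tail = trans tail₂ (sym (+-identityʳ _))
            ; mono = λ ()
            ; outside = outside-refl }
          ; progress = λ _ () }

        afterExpand : ∀ τ₄ → Frame (foot expandAll) τ₃ τ₄ → ExpandInv v<n undone t h L τ₃ (length L) τ₄ → Spec _ τ₄ 8 (StageInv (suc i))
        afterExpand τ₄ fr₄ inv₄ = now (record
          { done = done₄
          -- The vertex has the least key among the unprocessed ones, and the old θ lies between the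
          -- processed keys and this key; so the new threshold separates again.
          ; θ = key v
          ; L = G.L′
          ; counted = trans (count-ins done v<n undone) (cong suc counted)
          ; before = λ u u<n du → before₄ u u<n (ins-elim {u} {v} done du)
          ; after = λ u u<n du → least u u<n (∨-falseʳ {u ≡ᵇ v} du)
          ; keys = trans (Frame.regs fr₄ infᵛ refl) (trans (Frame.regs fr₂ infᵛ refl) (proj₁ keys₁)) ,
                   λ u u<n → trans (Frame.arrs fr₄ refl Key refl u) (trans (Frame.arrs fr₂ refl Key refl u) (proj₂ keys₁ u u<n))
          ; table = subst₂ (λ a b → Table P (Good done₄) a b G.L′ τ₅) (sym tab′≡) (sym head′≡) (table-cong (λ _ → refl) (λ _ → refl) (λ _ → refl) G.table)
          ; tail = trans G.tail (cong (_+ length G.L′) (sym head′≡))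
          ; complete = λ I pI → subst (λ a → mask n (available done₄ I) ∈ G.L′ × wsum w n I ℚ.≤ tab τ₄ (a + mask n (available done₄ I)))
                         (sym tab′≡) (complete₄ I pI)
          ; fresh = λ z le → fresh₄ z (subst (λ a → a + P ≤ z) tab′≡ le) })
          where
          open ExpandInv inv₄
          module G = Grown grown
          τ₅ = ⟦ tabᵛ ≔ var tab′ᵛ ⨟ headᵛ ≔ var head′ᵛ ⟧ τ₄
          done₄ = ins v done
          tab′≡ : reg τ₄ tab′ᵛ ≡ t + P
          tab′≡ = trans (Frame.regs fr₄ tab′ᵛ refl) (cong₂ _+_ (regs₂ tabᵛ refl refl) (Ctx.2ⁿ≡ ctx₂))
          head′≡ : reg τ₄ head′ᵛ ≡ h + length L
          head′≡ = trans (Frame.regs fr₄ head′ᵛ refl) tail₂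
          before₄ : ∀ u → u < n → u ≡ v ⊎ done u ≡ true → key u ≤ key v
          before₄ u u<n (inj₁ refl) = ≤-refl
          before₄ u u<n (inj₂ du) = ≤-trans (before u u<n du) (after v v<n undone)
          fresh₄ : ∀ z → t + P + P ≤ z → arr τ₄ Tab z ≡ 0
          fresh₄ z le = trans (Outside.tabs G.outside (inj₂ le)) (trans (tabs₂ z) (fresh z (≤-trans (m≤m+n (t + P) P) le)))

          complete₄ : ∀ I → Partial done₄ I → mask n (available done₄ I) ∈ G.L′ ×
                      wsum w n I ℚ.≤ tab τ₄ (t + P + mask n (available done₄ I))
          complete₄ I pI = go (I v) refl
            where
            -- Optimal substructure: the part of `I` chosen before this stage is dominated by an old
            -- entry, and `I v` decides which of its two successors dominates `I`.
            I₀ = keepBut v I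
            r = available done I₀
            old = complete I₀ (partial-remove v<n undone pI)
            slot = Table.queued table₃ (proj₁ old)
            exp : Expanded v<n undone t (t + P) τ₃ τ₄ G.L′ r
            exp = progress (proj₁ slot) (proj₁ (proj₂ slot)) r (proj₂ (proj₂ slot))
            w₀ : wsum w n I₀ ℚ.≤ tab τ₃ (t + mask n r)
            w₀ = ℚₚ.≤-trans (proj₂ old) (ℚₚ.≤-reflexive (sym (wtabs₂ _)))
            go : ∀ b → I v ≡ b → mask n (available done₄ I) ∈ G.L′ × wsum w n I ℚ.≤ tab τ₄ (t + P + mask n (available done₄ I))
            go false Iv = subst₂ (λ R x → R ∈ G.L′ × x ℚ.≤ tab τ₄ (t + P + R)) code (sym (wsum-cong w n I≗))
              (proj₁ (Expanded.skipped exp) , ℚₚ.≤-trans w₀ (proj₂ (Expanded.skipped exp)))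
              where
              I≗ : ∀ u → u < n → I u ≡ I₀ u
              I≗ u _ with u ≟ v
              ... | yes refl rewrite Iv = refl
              ... | no u≢v rewrite ≢⇒≡ᵇ u≢v = sym (Boolₚ.∧-identityʳ (I u))
              code : mask n (keepBut v r) ≡ mask n (available done₄ I)
              code = mask-cong n (λ u u<n → sym (trans (available-cong done₄ I≗ u) (available-skip v done I₀ u)))
            go true Iv = subst₂ (λ R x → R ∈ G.L′ × x ℚ.≤ tab τ₄ (t + P + R)) code (sym (trans (wsum-cong w n I≗) (wsum-ins w I₀ v<n I₀v)))
              (proj₁ taken , ℚₚ.≤-trans (ℚₚ.+-monoˡ-≤ (w v) w₀) (proj₂ taken))
              where
              I₀v : I₀ v ≡ false
              I₀v rewrite ≡ᵇ-refl v = Boolₚ.∧-zeroʳ (I v)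
              I≗ : ∀ u → u < n → I u ≡ ins v I₀ u
              I≗ u _ with u ≟ v
              ... | yes refl rewrite ≡ᵇ-refl u = Iv
              ... | no u≢v rewrite ≢⇒≡ᵇ u≢v = sym (Boolₚ.∧-identityʳ (I u))
              ¬hit : hit I₀ v ≡ false
              ¬hit = ≢true⇒false λ h → let s , s<n , both = any<-elim n _ h in
                true≢false (∧-trueʳ {I₀ s} both)
                  (Partial.independent pI s v s<n v<n (∧-trueˡ (∧-trueˡ {I₀ s} both)) Iv)
              rv : r v ≡ true
              rv = ∧-intro (proj₂ (Partial.members pI v v<n Iv)) (∧-intro (false⇒not-true undone) (false⇒not-true ¬hit))
              taken = Expanded.taken exp rv
              code : mask n (keepFar A v r) ≡ mask n (available done₄ I)
              code = mask-cong n (λ u u<n → sym (trans (available-cong done₄ I≗ u) (available-take done I₀ u v<n)))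

module _ (n : ℕ) (A : ℕ → ℕ → Bool) (w : ℕ → ℚ) where

  open Available n A (λ _ → true) using (IndependentSet)

  record Best (σ : State) : Set where
    field
      S           : ℕ → Bool
      independent : IndependentSet S
      best≡       : reg σ bestᵛ ≡ mask n S
      best-w≡     : wreg σ best-wᵛ ≡ wsum w n S

  Fresh : State → Set
  Fresh σ = ∀ z → reg σ tabᵛ ≤ z → arr σ Tab z ≡ 0

  record Optimised (K : ℕ → Bool) (σ τ : State) : Set where
    field
      best    : Best τ
      better  : wreg σ best-wᵛ ℚ.≤ wreg τ best-wᵛ
      optimal : ∀ I → IndependentSet I → (∀ s → s < n → I s ≡ true → K s ≡ true) → wsum w n I ℚ.≤ wreg τ best-wᵛ
      fresh   : Fresh τ

-- Numerals are unary, so unfolding these bounds is infeasible.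
abstract

  dpTime : ℕ → ℕ → ℕ
  dpTime n X = 461 * (suc n * (suc n * suc X))

  dpTime≡ : ∀ n X → dpTime n X ≡ 461 * (suc n * (suc n * suc X))
  dpTime≡ n X = refl

  dp-time : ∀ n X → 42 + (4 + n * (5 + 377 * (suc n * suc X)) + (26 + 7)) ≤ dpTime n X
  -- 461 is 377 + 84, where `84 * suc n` covers the cost 79 + 5n incurred outside the stage bodies.
  dp-time n X = subst (42 + (4 + n * (5 + 377 * (suc n * suc X)) + (26 + 7)) ≤_) (arith n X)
      (m≤m+n _ (382 + 456 * n + 84 * (n * (1 + n)) + X * (461 + 545 * n + 84 * (n * n))))
    where
    arith : ∀ n X → 42 + (4 + n * (5 + 377 * ((1 + n) * (1 + X))) + (26 + 7)) +
                    (382 + 456 * n + 84 * (n * (1 + n)) + X * (461 + 545 * n + 84 * (n * n))) ≡ 461 * ((1 + n) * ((1 + n) * (1 + X)))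
    arith = solve-∀

module _ (n : ℕ) (A : ℕ → ℕ → Bool) (w : ℕ → ℚ) (sym-A : Symmetric A) (K : ℕ → Bool)
         (key : ℕ → ℕ) (inf : ℕ) (key≤ : ∀ u → u < n → key u ≤ inf)
         (M : ℕ) (narrow : Available.Narrow n A K M key) where

  open Available n A K
  open DP n A w sym-A K
  open Stages n A w sym-A K key inf key≤ M narrow

  dpSpec : ∀ σ → Ctx n A w σ → reg σ keptᵛ ≡ mask n K → KeyState n key inf (λ _ → false) σ → Fresh n A w σ → Best n A w σ →
           Spec dp σ (dpTime n (n ^ M)) (Optimised n A w K σ)
  dpSpec σ ctx kept≡ (inf≡ , keys) fresh best = within (dp-time n (n ^ M))
    (first (andThen (forSpec n stageTime StageInv (Ctx.n≡ ctx) init body) afterStages))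
    where
    σ₁ = ⟦ startDP ⟧ σ
    P R₀ t q B : ℕ
    P = 2 ^ n
    R₀ = reg σ keptᵛ
    t = reg σ tabᵛ
    q = reg σ tailᵛ
    B = reg σ 0
    ∅ₛ : ℕ → Bool
    ∅ₛ _ = false
    ctx₁ : Ctx n A w σ₁
    ctx₁ = ctx-frame (frame startDP σ) refl refl refl refl ctx
    m₁ : ℕ → ℕ
    m₁ = mem σ [ cell B Tab (t + R₀) ↦ 1 ]
    tab-R₀ : arr σ₁ Tab (t + R₀) ≡ 1
    tab-R₀ = trans (store-array m₁ B Que q (t + R₀) λ ()) (store-same (mem σ) B Tab (t + R₀) refl)
    tab-other : ∀ {z} → z ≢ t + R₀ → arr σ₁ Tab z ≡ arr σ Tab z
    tab-other {z} z≢ = trans (store-array m₁ B Que q z λ ()) (store-index (mem σ) B Tab (t + R₀) z≢)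
    que-q : arr σ₁ Que (q + 0) ≡ R₀
    que-q = store-same m₁ B Que q (+-identityʳ q)
    ∅-partial : Partial ∅ₛ ∅ₛ
    ∅-partial = record { members = λ _ _ (); independent = λ _ _ _ _ () }
    all-available : ∀ {I} → (∀ u → u < n → I u ≡ false) → ∀ u → available ∅ₛ I u ≡ K u
    all-available {I} I≗ u = trans (cong (λ h → K u ∧ not h) ¬hit) (Boolₚ.∧-identityʳ (K u))
      where
      ¬hit : hit I u ≡ false
      ¬hit = ≢true⇒false λ h → let s , s<n , both = any<-elim n _ h in true≢false (∧-trueˡ {I s} both) (I≗ s s<n)
    code : ∀ {I} → (∀ u → u < n → I u ≡ false) → R₀ ≡ mask n (available ∅ₛ I)
    code I≗ = trans kept≡ (sym (mask-cong n (λ u _ → all-available I≗ u)))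
    R₀<P : R₀ < P
    R₀<P = subst (_< P) (sym kept≡) (mask<2^ n K)

    init : StageInv 0 σ₁
    init = record
      { done = ∅ₛ
      ; θ = 0
      ; L = R₀ ∷ []
      ; counted = count-empty n
      ; before = λ _ _ ()
      ; after = λ _ _ _ → z≤n
      ; keys = inf≡ , λ u u<n → trans (Frame.arrs (frame startDP σ) refl Key refl u) (keys u u<n)
      ; table = record
        { unique = [] ∷ []
        ; small = λ { (here refl) → R₀<P }
        ; queued = λ { (here refl) → 0 , s≤s z≤n , que-q }
        ; listed = λ { {zero} _ → here que-q ; {suc _} (s≤s ()) }
        ; good = λ { (here refl) → ∅ₛ , ∅-partial , code {∅ₛ} (λ _ _ → refl) ,
                     trans tab-R₀ (cong suc (sym (mask-empty n (λ _ _ → refl)))) ,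
                     trans (tab-same (wmem σ) B (t + R₀)) (sym (wsum-empty w n (λ _ _ → refl))) }
        ; empty = λ {R} _ R∉ → trans (tab-other (R∉ ∘ here ∘ +-cancelˡ-≡ t _ _)) (fresh (t + R) (m≤m+n t R)) }
      ; tail = refl
      ; complete = λ I pI →
          let I≗ : ∀ u → u < n → I u ≡ false
              I≗ u u<n = ≢true⇒false (λ Iu → true≢false (proj₁ (Partial.members pI u u<n Iu)) refl)
          in here (sym (code I≗)) ,
             ℚₚ.≤-reflexive (trans (wsum-empty w n I≗)
               (trans (sym (tab-same (wmem σ) B (t + R₀))) (cong (λ R → tab σ₁ (t + R)) (code I≗))))
      ; fresh = λ z le → trans (tab-other {z} (λ { refl → <⇒≱ R₀<P (+-cancelˡ-≤ t _ _ le) })) (fresh z (≤-trans (m≤m+n t P) le))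
      }

    body : ∀ i τ → i < n → Frame (foot stages) σ₁ τ → StageInv i τ → Spec stage (set stageᵛ i τ) stageTime (StageInv (suc i))
    body i τ i<n fr inv = stageSpec i (set stageᵛ i τ) i<n
        (ctx-frame (frame (stageᵛ ≔ lit i) τ) refl refl refl refl (ctx-frame fr refl refl refl refl ctx₁))
        (record { done = done; θ = θ; L = L; counted = counted; before = before; after = after; keys = keys′
                ; table = table-cong (λ _ → refl) (λ _ → refl) (λ _ → refl) table; tail = tail; complete = complete; fresh = fresh′ })
      where open StageInv inv renaming (keys to keys′; fresh to fresh′)

    afterStages : ∀ τ → Frame (foot stages) σ₁ τ → StageInv n τ → Spec _ τ (26 + 7) (Optimised n A w K σ)
    afterStages τ fr inv = andThen {t = 26} (branchʷ {t = 19} better worse) finish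
      where
      open StageInv inv renaming (fresh to freshτ)
      all-done : ∀ u → u < n → done u ≡ true
      all-done = count-full n done counted
      t′ : ℕ
      t′ = reg τ tabᵛ
      exhausted : ∀ I → mask n (available done I) ≡ 0
      exhausted I = mask-empty n λ u u<n → trans (cong (λ d → K u ∧ not d ∧ not (hit I u)) (all-done u u<n)) (Boolₚ.∧-zeroʳ (K u))
      opt : ∀ I → IndependentSet I → (∀ s → s < n → I s ≡ true → K s ≡ true) → 0 ∈ L × wsum w n I ℚ.≤ tab τ t′
      opt I ind I⊆K with complete I (record { members = λ s s<n Is → all-done s s<n , I⊆K s s<n Is; independent = ind })
      ... | R∈ , le = subst (_∈ L) (exhausted I) R∈ ,
        ℚₚ.≤-trans le (ℚₚ.≤-reflexive (cong (tab τ) (trans (cong (t′ +_) (exhausted I)) (+-identityʳ t′))))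
      entry : Good done 0 (arr τ Tab (t′ + 0)) (tab τ (t′ + 0))
      entry = Table.good table (proj₁ (opt ∅ₛ (λ _ _ _ _ ()) (λ _ _ ())))
      best-w≡τ : wreg τ best-wᵛ ≡ wreg σ best-wᵛ
      best-w≡τ = Frame.wregs fr best-wᵛ refl

      Improved : State → Set
      Improved υ = Best n A w υ × wreg σ best-wᵛ ℚ.≤ wreg υ best-wᵛ × tab τ t′ ℚ.≤ wreg υ best-wᵛ

      better : wreg τ best-wᵛ ℚ.≤ tab τ t′ → Spec _ τ 19 Improved
      better le with entry
      ... | S , pS , _ , s≡ , w≡ = now (record
        { S = S; independent = Partial.independent pS
        ; best≡ = cong (_∸ 1) (trans (cong (arr τ Tab) (sym (+-identityʳ t′))) s≡)
        ; best-w≡ = trans (cong (tab τ) (sym (+-identityʳ t′))) w≡ }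
        , subst (ℚ._≤ tab τ t′) best-w≡τ le , ℚₚ.≤-refl)
      worse : tab τ t′ ℚ.≤ wreg τ best-wᵛ → Spec skip τ 19 Improved
      worse le = within by-computation (now (record
        { S = Best.S best; independent = Best.independent best
        ; best≡ = trans (Frame.regs fr bestᵛ refl) (Best.best≡ best); best-w≡ = trans best-w≡τ (Best.best-w≡ best) }
        , ℚₚ.≤-reflexive (sym best-w≡τ) , le))

      finish : ∀ υ → Frame (foot improveBest) τ υ → Improved υ → Spec _ υ 7 (Optimised n A w K σ)
      finish υ frυ (b , bw , le) = now (record
        { best = record { S = Best.S b; independent = Best.independent b; best≡ = Best.best≡ b; best-w≡ = Best.best-w≡ b }
        ; better = bw
        ; optimal = λ I ind I⊆K → ℚₚ.≤-trans (proj₂ (opt I ind I⊆K)) le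
        ; fresh = λ z le → trans (Frame.arrs frυ refl Tab refl z) (freshτ z
            (subst (_≤ z) (cong₂ _+_ (Frame.regs frυ tabᵛ refl) (trans (Frame.regs frυ 2ⁿᵛ refl) (Ctx.2ⁿ≡ (ctx-frame fr refl refl refl refl ctx₁)))) le)) })

-- Parsing the paths, and the vertex order

-- Register 0 has to lie behind the input, whose length is not part of it. Reserving `q` cells for
-- every path gives an upper bound that additions can compute, and all memory from there on is
-- initially 0.
setup : ℕ → Cmd
setup q =
  nᵛ ≔ inp (lit 0) ⨟ widthᵛ ≔ inp (lit 4) ⨟ hᵛ ≔ inp (lit 5) ⨟ 0 ≔ lit 6 ⨟
  for uᵛ (var nᵛ) (0 ≔ var 0 ⊕ var nᵛ) ⨟ ptrᵛ ≔ var 0 ⨟ for uᵛ (var nᵛ) (0 ≔ var 0 ⊕ lit q)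

powers : Cmd
powers = 2ⁿᵛ ≔ lit 1 ⨟ for uᵛ (var nᵛ) (Pow [ var uᵛ ]≔ var 2ⁿᵛ ⨟ 2ⁿᵛ ≔ var 2ⁿᵛ ⊕ var 2ⁿᵛ)

scanPoints : Cmd
scanPoints = for jᵛ (inp (var ptrᵛ) ⊕ lit 2)
  (minxᵛ ≔ var minxᵛ ⊖ (var minxᵛ ⊖ inp (var ptrᵛ ⊕ lit 1)) ⨟
   maxxᵛ ≔ var maxxᵛ ⊕ (inp (var ptrᵛ ⊕ lit 1) ⊖ var maxxᵛ) ⨟
   loᵛ ≔ var loᵛ ⊖ (var loᵛ ⊖ inp (var ptrᵛ ⊕ lit 2)) ⨟
   ptrᵛ ≔ var ptrᵛ ⊕ lit 2)

-- The extremes are initialised with the first point, which the scan reads once more; thus no value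
-- has to stand for infinity.
parsePath : Cmd
parsePath =
  (minxᵛ ≔ inp (var ptrᵛ ⊕ lit 1) ⨟ maxxᵛ ≔ inp (var ptrᵛ ⊕ lit 1) ⨟ loᵛ ≔ inp (var ptrᵛ ⊕ lit 2)) ⨟
  scanPoints ⨟
  (ptrᵛ ≔ var ptrᵛ ⊕ lit 1 ⨟ Minx [ var uᵛ ]≔ var minxᵛ ⨟ Maxx [ var uᵛ ]≔ var maxxᵛ ⨟ Lo [ var uᵛ ]≔ var loᵛ)

parse : Cmd
parse = for uᵛ (var nᵛ) parsePath

-- m ∸ (m ∸ n) and m + (n ∸ m) are the minimum and the maximum of m and n.
scanMin scanMax : (Point → ℕ) → ℕ → List Point → ℕ
scanMin f a []       = a
scanMin f a (p ∷ ps) = scanMin f (a ∸ (a ∸ f p)) ps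
scanMax f a []       = a
scanMax f a (p ∷ ps) = scanMax f (a + (f p ∸ a)) ps

lowest highest : (Point → ℕ) → List Point → ℕ
lowest f []       = 0
lowest f (p ∷ ps) = scanMin f (f p) (p ∷ ps)
highest f []       = 0
highest f (p ∷ ps) = scanMax f (f p) (p ∷ ps)

-- Each cell carries the bound `p < B`, so that the frame of the input applies to it.
Reads : (ℕ → ℕ) → ℕ → ℕ → List ℕ → Set
Reads m B p []       = ⊤
Reads m B p (x ∷ xs) = (p < B × m p ≡ x) × Reads m B (suc p) xs

record Ready (n W H q : ℕ) (σ τ : State) : Set where
  field
    n≡    : reg τ nᵛ ≡ n
    W≡    : reg τ widthᵛ ≡ W
    H≡    : reg τ hᵛ ≡ H
    ptr≡  : reg τ ptrᵛ ≡ 6 + n * n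
    base≡ : reg τ 0 ≡ 6 + n * n + n * q
    mem≡  : mem τ ≡ mem σ
    wmem≡ : wmem τ ≡ wmem σ

setupSpec : ∀ {n W H} q σ → mem σ 0 ≡ n → mem σ 4 ≡ W → mem σ 5 ≡ H →
            Spec (setup q) σ (27 + n * 23) (Ready n W H q σ)
setupSpec {n} {W} {H} q σ n≡ W≡ H≡ = within (≤-reflexive (arith n))
  (first (first (first (first (andThen
    (forSpec n 7 (λ i τ → reg τ 0 ≡ 6 + i * n × mem τ ≡ mem σ × wmem τ ≡ wmem σ) n≡ (refl , refl , refl) rows)
    λ τ fr (base₁ , mem₁ , wmem₁) → first (weaken ≤-refl
      (λ υ fr′ (base₂ , mem₂ , wmem₂) → record
        { n≡ = trans (Frame.regs fr′ nᵛ refl) (trans (Frame.regs fr nᵛ refl) n≡)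
        ; W≡ = trans (Frame.regs fr′ widthᵛ refl) (trans (Frame.regs fr widthᵛ refl) W≡)
        ; H≡ = trans (Frame.regs fr′ hᵛ refl) (trans (Frame.regs fr hᵛ refl) H≡)
        ; ptr≡ = trans (Frame.regs fr′ ptrᵛ refl) base₁
        ; base≡ = base₂; mem≡ = mem₂; wmem≡ = wmem₂ })
      (forSpec n 6 (λ i υ → reg υ 0 ≡ 6 + n * n + i * q × mem υ ≡ mem σ × wmem υ ≡ wmem σ)
        (trans (Frame.regs fr nᵛ refl) n≡) (trans base₁ (sym (+-identityʳ _)) , mem₁ , wmem₁)
        (λ i υ _ _ (base₂ , mem₂ , wmem₂) → within by-computation (now
          (trans (cong (_+ q) base₂) (trans (+-assoc (6 + n * n) (i * q) q) (cong (6 + n * n +_) (+-comm (i * q) q))) , mem₂ , wmem₂))))))))))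
  where
  arith : ∀ n → 4 + (4 + (4 + (3 + (4 + n * 12 + (4 + (4 + n * 11)))))) ≡ 27 + n * 23
  arith = solve-∀
  rows : ∀ i τ → i < n → _ → (reg τ 0 ≡ 6 + i * n × mem τ ≡ mem σ × wmem τ ≡ wmem σ) → Spec _ (set uᵛ i τ) 7 _
  rows i τ _ fr (base₁ , mem₁ , wmem₁) = within by-computation (now
    (trans (cong₂ _+_ base₁ (trans (Frame.regs fr nᵛ refl) n≡)) (trans (+-assoc 6 (i * n) n) (cong (6 +_) (+-comm (i * n) n))) , mem₁ , wmem₁))

powersSpec : ∀ {n} σ → reg σ nᵛ ≡ n →
             Spec powers σ (7 + n * 25) (λ τ → reg τ 2ⁿᵛ ≡ 2 ^ n × (∀ u → u < n → arr τ Pow u ≡ 2 ^ u))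
powersSpec {n} σ n≡ = first (forSpec n 20 (λ i τ → reg τ 2ⁿᵛ ≡ 2 ^ i × (∀ u → u < i → arr τ Pow u ≡ 2 ^ u)) n≡ (refl , λ _ ())
  (λ i τ _ _ (p≡ , pow) → within by-computation (now
    (trans (cong₂ _+_ p≡ p≡) (cong (2 ^ i +_) (sym (+-identityʳ (2 ^ i)))) ,
     λ u u<i → stored i τ p≡ pow u (<suc⇒<⊎≡ u<i)))))
  where
  stored : ∀ i τ → reg τ 2ⁿᵛ ≡ 2 ^ i → (∀ u → u < i → arr τ Pow u ≡ 2 ^ u) → ∀ u → u < i ⊎ u ≡ i →
           (mem τ [ cell (reg τ 0) Pow i ↦ reg τ 2ⁿᵛ ]) (cell (reg τ 0) Pow u) ≡ 2 ^ u
  stored i τ p≡ pow u (inj₁ u<i) = trans (store-index (mem τ) (reg τ 0) Pow i (<⇒≢ u<i)) (pow u u<i)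
  stored i τ p≡ pow u (inj₂ refl) = trans (store-same (mem τ) (reg τ 0) Pow i refl) p≡

module _ (m : ℕ → ℕ) (B : ℕ) where

  -- Continuing the scan of `post` from the current registers gives the extremes of the whole list.
  record PointsInv (all post : List Point) (p : ℕ) (τ : State) : Set where
    field
      reads : Reads m B (suc (reg τ ptrᵛ)) (concatMap encodePoint post)
      xmin  : scanMin proj₁ (reg τ minxᵛ) post ≡ lowest proj₁ all
      xmax  : scanMax proj₁ (reg τ maxxᵛ) post ≡ highest proj₁ all
      ymin  : scanMin proj₂ (reg τ loᵛ) post ≡ lowest proj₂ all
      ptr   : reg τ ptrᵛ + 2 * length post ≡ p + 2 * length all

  scanPointsSpec : ∀ {p ps b} σ → B ≤ reg σ 0 → (∀ j → j < B → mem σ j ≡ m j) → mem σ (reg σ ptrᵛ) ≡ b → b + 2 ≡ length ps →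
    PointsInv ps ps p σ → Spec scanPoints σ (7 + (b + 2) * 60) (PointsInv ps [] p)
  scanPointsSpec {p} {ps} {b} σ B≤ agree b≡ b+2≡ init =
    weaken ≤-refl (λ τ _ (post , len , inv) → finish τ post len inv)
      (forSpec (b + 2) 55 Inv (cong (_+ 2) b≡) (ps , trans (+-identityʳ _) (sym b+2≡) , init) body)
    where
    Inv : ℕ → State → Set
    Inv i τ = Σ (List Point) λ post → length post + i ≡ b + 2 × PointsInv ps post p τ
    finish : ∀ τ post → length post + (b + 2) ≡ b + 2 → PointsInv ps post p τ → PointsInv ps [] p τ
    finish τ [] _ inv = inv
    finish τ (_ ∷ post) len _ = contradiction (≤-reflexive len) (<⇒≱ (s≤s (m≤n+m (b + 2) (length post))))
    body : ∀ i τ → i < b + 2 → Frame (foot scanPoints) σ τ → Inv i τ → Spec _ (set jᵛ i τ) 55 (Inv (suc i))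
    body i τ i< fr ([] , len , inv) = contradiction len (<⇒≢ i<)
    body i τ i< fr ((x , y) ∷ post , len , inv) = within by-computation (now
      (post , trans (+-suc (length post) i) len , record
        { reads = subst (λ a → Reads m B a (concatMap encodePoint post)) (cong suc (+-comm 2 (reg τ ptrᵛ))) (proj₂ (proj₂ reads))
        ; xmin = trans (cong (λ a → scanMin proj₁ (reg τ minxᵛ ∸ (reg τ minxᵛ ∸ a)) post) x≡) xmin
        ; xmax = trans (cong (λ a → scanMax proj₁ (reg τ maxxᵛ + (a ∸ reg τ maxxᵛ)) post) x≡) xmax
        ; ymin = trans (cong (λ a → scanMin proj₂ (reg τ loᵛ ∸ (reg τ loᵛ ∸ a)) post) y≡) ymin
        ; ptr = trans (arith (reg τ ptrᵛ) (length post)) ptr }))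
      where
      open PointsInv inv
      arith : ∀ r l → r + 2 + 2 * l ≡ r + 2 * (1 + l)
      arith = solve-∀
      read : ∀ {a j v} → a ≡ j → j < B × m j ≡ v → mem τ a ≡ v
      read refl (j< , eq) = trans (Frame.inps fr refl (<-≤-trans j< B≤)) (trans (agree _ j<) eq)
      x≡ : mem τ (reg τ ptrᵛ + 1) ≡ x
      x≡ = read (+-comm _ 1) (proj₁ reads)
      y≡ : mem τ (reg τ ptrᵛ + 2) ≡ y
      y≡ = read (+-comm _ 2) (proj₁ (proj₂ reads))

record Parsed (n : ℕ) (pts : ℕ → List Point) (τ : State) : Set where
  field
    minxs : ∀ u → u < n → arr τ Minx u ≡ lowest proj₁ (pts u)
    maxxs : ∀ u → u < n → arr τ Maxx u ≡ highest proj₁ (pts u)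
    los   : ∀ u → u < n → arr τ Lo u ≡ lowest proj₂ (pts u)

module _ (m : ℕ → ℕ) (B b n : ℕ) (bds ptrs : ℕ → ℕ) (pts : ℕ → List Point)
         (reads : ∀ u → u < n → Reads m B (ptrs u) (bds u ∷ concatMap encodePoint (pts u)))
         (len : ∀ u → u < n → bds u + 2 ≡ length (pts u)) (few : ∀ u → u < n → bds u ≤ b)
         (next : ∀ u → u < n → ptrs (suc u) ≡ ptrs u + 1 + 2 * length (pts u)) where

  parseTime : ℕ
  parseTime = 4 + n * (5 + (70 + (b + 2) * 60))

  parseSpec : ∀ σ → reg σ nᵛ ≡ n → reg σ ptrᵛ ≡ ptrs 0 → B ≤ reg σ 0 → (∀ j → j < B → mem σ j ≡ m j) →
              Spec parse σ parseTime (Parsed n pts)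
  parseSpec σ n≡ ptr≡ B≤ agree = weaken ≤-refl (λ _ _ → proj₂)
    (forSpec n (70 + (b + 2) * 60) (λ i τ → reg τ ptrᵛ ≡ ptrs i × Parsed i pts τ) n≡
      (ptr≡ , record { minxs = λ _ (); maxxs = λ _ (); los = λ _ () }) body)
    where
    body : ∀ u τ → u < n → Frame (foot parse) σ τ → (reg τ ptrᵛ ≡ ptrs u × Parsed u pts τ) →
           Spec parsePath (set uᵛ u τ) (70 + (b + 2) * 60) (λ τ → reg τ ptrᵛ ≡ ptrs (suc u) × Parsed (suc u) pts τ)
    body u τ u<n fr (ptr≡τ , parsed) = within time
        (first (andThen (scanPointsSpec m B τ₁ B≤τ (λ j → agreeτ {j}) bends≡ (len u u<n) (begins (pts u) (len u u<n) (proj₂ (reads u u<n)))) finish))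
      where
      τ₁ = ⟦ minxᵛ ≔ inp (var ptrᵛ ⊕ lit 1) ⨟ maxxᵛ ≔ inp (var ptrᵛ ⊕ lit 1) ⨟ loᵛ ≔ inp (var ptrᵛ ⊕ lit 2) ⟧ (set uᵛ u τ)
      time : 21 + (7 + (bds u + 2) * 60 + 39) ≤ 70 + (b + 2) * 60
      time = ≤-trans (+-monoʳ-≤ 21 (+-monoˡ-≤ 39 (+-monoʳ-≤ 7 (*-monoˡ-≤ 60 (+-monoˡ-≤ 2 (few u u<n))))))
        (≤-trans (≤-reflexive (arith ((b + 2) * 60))) (+-monoˡ-≤ ((b + 2) * 60) (by-computation {67} {70})))
        where
        arith : ∀ x → 21 + (7 + x + 39) ≡ 67 + x
        arith = solve-∀
      B≤τ : B ≤ reg τ 0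
      B≤τ = ≤-trans B≤ (≤-reflexive (sym (Frame.base fr refl)))
      agreeτ : ∀ {j} → j < B → mem τ j ≡ m j
      agreeτ {j} j< = trans (Frame.inps fr refl (<-≤-trans j< B≤)) (agree j j<)
      read : ∀ {a j v} → a ≡ j → j < B × m j ≡ v → mem τ a ≡ v
      read refl (j< , eq) = trans (agreeτ j<) eq
      bends≡ : mem τ (reg τ ptrᵛ) ≡ bds u
      bends≡ = read ptr≡τ (proj₁ (reads u u<n))
      begins : ∀ ps → bds u + 2 ≡ length ps → Reads m B (suc (ptrs u)) (concatMap encodePoint ps) → PointsInv m B ps ps (ptrs u) τ₁
      begins [] l _ = contradiction (trans (+-comm 2 (bds u)) l) λ ()
      begins ((x , y) ∷ ps) l rs = record
        { reads = subst (λ a → Reads m B (suc a) (concatMap encodePoint ((x , y) ∷ ps))) (sym ptr≡τ) rs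
        ; xmin = cong (λ a → scanMin proj₁ a ((x , y) ∷ ps)) x≡
        ; xmax = cong (λ a → scanMax proj₁ a ((x , y) ∷ ps)) x≡
        ; ymin = cong (λ a → scanMin proj₂ a ((x , y) ∷ ps)) y≡
        ; ptr = cong (_+ 2 * length ((x , y) ∷ ps)) ptr≡τ }
        where
        x≡ : mem τ (reg τ ptrᵛ + 1) ≡ x
        x≡ = read (trans (+-comm _ 1) (cong suc ptr≡τ)) (proj₁ rs)
        y≡ : mem τ (reg τ ptrᵛ + 2) ≡ y
        y≡ = read (trans (+-comm _ 2) (cong (2 +_) ptr≡τ)) (proj₁ (proj₂ rs))

      finish : ∀ τ₂ → Frame (foot scanPoints) τ₁ τ₂ → PointsInv m B (pts u) [] (ptrs u) τ₂ →
               Spec _ τ₂ 39 (λ τ → reg τ ptrᵛ ≡ ptrs (suc u) × Parsed (suc u) pts τ)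
      finish τ₂ fr₂ inv = within by-computation (now
          (trans (cong (_+ 1) (trans (sym (+-identityʳ _)) ptr)) (trans (arith (ptrs u) (length (pts u))) (sym (next u u<n))) ,
           record
             { minxs = λ v v<su → minx′ v (<suc⇒<⊎≡ v<su)
             ; maxxs = λ v v<su → maxx′ v (<suc⇒<⊎≡ v<su)
             ; los = λ v v<su → lo′ v (<suc⇒<⊎≡ v<su) }))
        where
        open PointsInv inv
        arith : ∀ p l → p + 2 * l + 1 ≡ p + 1 + 2 * l
        arith = solve-∀
        B₂ = reg τ₂ 0
        u₂ = reg τ₂ uᵛ
        u≡ : u₂ ≡ u
        u≡ = Frame.regs fr₂ uᵛ refl
        ≢u₂ : ∀ {v} → v < u → v ≢ u₂
        ≢u₂ v<u v≡ = <⇒≢ v<u (trans v≡ u≡)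
        m₁ = mem τ₂ [ cell B₂ Minx u₂ ↦ reg τ₂ minxᵛ ]
        m₂ = m₁ [ cell B₂ Maxx u₂ ↦ reg τ₂ maxxᵛ ]
        m₃ = m₂ [ cell B₂ Lo u₂ ↦ reg τ₂ loᵛ ]
        minx′ : ∀ v → v < u ⊎ v ≡ u → m₃ (cell B₂ Minx v) ≡ lowest proj₁ (pts v)
        minx′ v c = trans (store-array m₂ B₂ Lo u₂ v λ ()) (trans (store-array m₁ B₂ Maxx u₂ v λ ()) (go c))
          where
          go : v < u ⊎ v ≡ u → m₁ (cell B₂ Minx v) ≡ lowest proj₁ (pts v)
          go (inj₁ v<u) = trans (store-index (mem τ₂) B₂ Minx u₂ (≢u₂ v<u)) (trans (Frame.arrs fr₂ refl Minx refl v) (Parsed.minxs parsed v v<u))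
          go (inj₂ refl) = trans (store-same (mem τ₂) B₂ Minx u₂ (sym u≡)) xmin
        maxx′ : ∀ v → v < u ⊎ v ≡ u → m₃ (cell B₂ Maxx v) ≡ highest proj₁ (pts v)
        maxx′ v c = trans (store-array m₂ B₂ Lo u₂ v λ ()) (go c)
          where
          go : v < u ⊎ v ≡ u → m₂ (cell B₂ Maxx v) ≡ highest proj₁ (pts v)
          go (inj₁ v<u) = trans (store-index m₁ B₂ Maxx u₂ (≢u₂ v<u)) (trans (store-array (mem τ₂) B₂ Minx u₂ v λ ())
                            (trans (Frame.arrs fr₂ refl Maxx refl v) (Parsed.maxxs parsed v v<u)))
          go (inj₂ refl) = trans (store-same m₁ B₂ Maxx u₂ (sym u≡)) xmax
        lo′ : ∀ v → v < u ⊎ v ≡ u → m₃ (cell B₂ Lo v) ≡ lowest proj₂ (pts v)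
        lo′ v (inj₁ v<u) = trans (store-index m₂ B₂ Lo u₂ (≢u₂ v<u)) (trans (store-array m₁ B₂ Maxx u₂ v λ ())
                             (trans (store-array (mem τ₂) B₂ Minx u₂ v λ ()) (trans (Frame.arrs fr₂ refl Lo refl v) (Parsed.los parsed v v<u))))
        lo′ v (inj₂ refl) = trans (store-same m₂ B₂ Lo u₂ (sym u≡)) ymin

-- Cuts, keys for one offset, and output

scanCut : Cmd
scanCut = for uᵛ (var nᵛ)
  (if≤ (var gᵛ) (Maxx at var uᵛ)
    (cutᵛ ≔ var cutᵛ ⊖ (var cutᵛ ⊖ (var gᵛ ⊕ ((Minx at var uᵛ) ⊖ var gᵛ)))) skip)

-- 2n cuts suffice because the paths have 2n ends in total and every cut at an occupied column
-- leaves a further end behind; `covered` makes this precise.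
cutLoop : ℕ → Cmd
cutLoop c = for iᵛ (var nᵛ ⊕ var nᵛ)
  (cutᵛ ≔ var widthᵛ ⊕ var gᵛ ⨟ scanCut ⨟ (Cut [ var iᵛ ]≔ var cutᵛ ⨟ gᵛ ≔ var cutᵛ ⊕ lit c))

cuts : ℕ → Cmd
cuts c = gᵛ ≔ lit 0 ⨟ cutLoop c

countLeft : Cmd
countLeft = if≤ (Cut at var iᵛ) (Minx at var uᵛ) (keyᵛ ≔ var keyᵛ ⊕ var hᵛ) skip

-- `cntᵛ` counts down to the next cut in use, in place of computing remainders modulo k.
countCuts : Cmd
countCuts = for iᵛ (var nᵛ ⊕ var nᵛ)
  (if≤ (var cntᵛ) (lit 0)
    (countLeft ⨟
     if≤ (Cut at var iᵛ) (Maxx at var uᵛ) (key′ᵛ ≔ var key′ᵛ ⊕ var hᵛ) skip ⨟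
     cntᵛ ≔ var kᵛ ⊖ lit 1)
    (cntᵛ ≔ var cntᵛ ⊖ lit 1))

keysOf : Cmd
keysOf =
  (keyᵛ ≔ Lo at var uᵛ ⨟ key′ᵛ ≔ Lo at var uᵛ ⨟ cntᵛ ≔ var oᵛ) ⨟ countCuts ⨟
  (Key [ var uᵛ ]≔ var keyᵛ ⨟ infᵛ ≔ var infᵛ ⊕ (var keyᵛ ⊖ var infᵛ)) ⨟
  if≤ (var key′ᵛ) (var keyᵛ) (keptᵛ ≔ var keptᵛ ⊕ (Pow at var uᵛ)) skip

keys : Cmd
keys = keptᵛ ≔ lit 0 ⨟ infᵛ ≔ lit 0 ⨟ for uᵛ (var nᵛ) keysOf

output-loop : Cmd
output-loop = for dᵛ (var nᵛ)
  (bᵛ ≔ var nᵛ ⊖ (var dᵛ ⊕ lit 1) ⨟ powᵛ ≔ Pow at var bᵛ ⨟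
   if≤ (var powᵛ) (var bestᵛ) (bestᵛ ≔ var bestᵛ ⊖ var powᵛ ⨟ out (var bᵛ) (lit 1)) (out (var bᵛ) (lit 0)))

module Cuts (n W c : ℕ) (minx maxx : ℕ → ℕ) where

  -- The least column ≥ g occupied by one of the first u paths; W + g, beyond the grid, if there is none.
  next : ℕ → ℕ → ℕ
  next g zero    = W + g
  next g (suc u) = if g ≤ᵇ maxx u then next g u ∸ (next g u ∸ (g + (minx u ∸ g))) else next g u

  gapAt cutAt : ℕ → ℕ
  gapAt zero    = 0
  gapAt (suc i) = cutAt i + c
  cutAt i = next (gapAt i) n

  scanCutSpec : ∀ {g} σ → reg σ nᵛ ≡ n → reg σ gᵛ ≡ g → reg σ cutᵛ ≡ W + g →
                (∀ u → u < n → arr σ Minx u ≡ minx u) → (∀ u → u < n → arr σ Maxx u ≡ maxx u) →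
                Spec scanCut σ (4 + n * 50) (λ τ → reg τ cutᵛ ≡ next g n)
  scanCutSpec {g} σ n≡ g≡ cut≡ minxs maxxs = forSpec n 45 (λ u τ → reg τ cutᵛ ≡ next g u) n≡ cut≡ body
    where
    body : ∀ u τ → u < n → Frame (foot scanCut) σ τ → reg τ cutᵛ ≡ next g u → Spec _ (set uᵛ u τ) 45 (λ τ → reg τ cutᵛ ≡ next g (suc u))
    body u τ u<n fr cut≡τ = within by-computation (branch {t = 30}
        (λ le → within by-computation (now (trans
          (cong₂ (λ a b → a ∸ (a ∸ b)) cut≡τ (cong₂ (λ a b → a + (b ∸ a)) g≡τ (trans (Frame.arrs fr refl Minx refl u) (minxs u u<n))))
          (sym (cong (if_then next g u ∸ (next g u ∸ (g + (minx u ∸ g))) else next g u) (≤⇒≤ᵇ-true (subst₂ _≤_ g≡τ maxx≡ le)))))))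
        (λ gt → within by-computation (now (trans cut≡τ
          (sym (cong (if_then next g u ∸ (next g u ∸ (g + (minx u ∸ g))) else next g u) (>⇒≤ᵇ-false (subst₂ _<_ maxx≡ g≡τ gt))))))))
      where
      g≡τ : reg τ gᵛ ≡ g
      g≡τ = trans (Frame.regs fr gᵛ refl) g≡
      maxx≡ : arr τ Maxx u ≡ maxx u
      maxx≡ = trans (Frame.arrs fr refl Maxx refl u) (maxxs u u<n)

  cutsSpec : ∀ σ → reg σ nᵛ ≡ n → reg σ widthᵛ ≡ W →
             (∀ u → u < n → arr σ Minx u ≡ minx u) → (∀ u → u < n → arr σ Maxx u ≡ maxx u) →
             Spec (cuts c) σ (10 + (n + n) * (40 + n * 50)) (λ τ → ∀ i → i < n + n → arr τ Cut i ≡ cutAt i)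
  cutsSpec σ n≡ W≡ minxs maxxs = weaken ≤-refl (λ _ _ → proj₂)
    (first (forSpec (n + n) (35 + n * 50) (λ i τ → reg τ gᵛ ≡ gapAt i × (∀ j → j < i → arr τ Cut j ≡ cutAt j))
      (cong₂ _+_ n≡ n≡) (refl , λ _ ()) body))
    where
    σ₁ = ⟦ gᵛ ≔ lit 0 ⟧ σ
    body : ∀ i τ → i < n + n → Frame (foot (cutLoop c)) σ₁ τ → (reg τ gᵛ ≡ gapAt i × (∀ j → j < i → arr τ Cut j ≡ cutAt j)) →
           Spec _ (set iᵛ i τ) (35 + n * 50) (λ τ → reg τ gᵛ ≡ gapAt (suc i) × (∀ j → j < suc i → arr τ Cut j ≡ cutAt j))
    body i τ i< fr (g≡ , cut) = within (≤-trans (≤-reflexive (arith (n * 50))) (+-monoˡ-≤ (n * 50) (by-computation {28} {35})))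
        (first (andThen (scanCutSpec τ₁ (trans (Frame.regs fr nᵛ refl) n≡) g≡
          (cong₂ _+_ (trans (Frame.regs fr widthᵛ refl) W≡) g≡)
          (λ u u<n → trans (Frame.arrs fr refl Minx refl u) (minxs u u<n))
          (λ u u<n → trans (Frame.arrs fr refl Maxx refl u) (maxxs u u<n)))
          λ τ₂ fr₂ cut≡ → now (cong (_+ c) cut≡ , λ j j<si → stored τ₂ fr₂ cut≡ j (<suc⇒<⊎≡ j<si))))
      where
      arith : ∀ m → 7 + ((4 + m) + 17) ≡ 28 + m
      arith = solve-∀
      τ₁ = ⟦ cutᵛ ≔ var widthᵛ ⊕ var gᵛ ⟧ (set iᵛ i τ)
      stored : ∀ τ₂ → Frame (foot scanCut) τ₁ τ₂ → reg τ₂ cutᵛ ≡ cutAt i → ∀ j → j < i ⊎ j ≡ i →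
               (mem τ₂ [ cell (reg τ₂ 0) Cut (reg τ₂ iᵛ) ↦ reg τ₂ cutᵛ ]) (cell (reg τ₂ 0) Cut j) ≡ cutAt j
      stored τ₂ fr₂ cut≡ j (inj₁ j<i) = trans (store-index (mem τ₂) (reg τ₂ 0) Cut (reg τ₂ iᵛ) (λ eq → <⇒≢ j<i (trans eq (Frame.regs fr₂ iᵛ refl))))
        (trans (Frame.arrs fr₂ refl Cut refl j) (cut j j<i))
      stored τ₂ fr₂ cut≡ j (inj₂ refl) = trans (store-same (mem τ₂) (reg τ₂ 0) Cut (reg τ₂ iᵛ) (sym (Frame.regs fr₂ iᵛ refl))) cut≡

module Layout (n k H : ℕ) (minx maxx lo cut : ℕ → ℕ) where

  record Coordinates (τ : State) : Set where
    field
      n≡ : reg τ nᵛ ≡ n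
      k≡ : reg τ kᵛ ≡ k
      h≡ : reg τ hᵛ ≡ H
      minxs : ∀ u → u < n → arr τ Minx u ≡ minx u
      maxxs : ∀ u → u < n → arr τ Maxx u ≡ maxx u
      los   : ∀ u → u < n → arr τ Lo u ≡ lo u
      cutss : ∀ i → i < n + n → arr τ Cut i ≡ cut i
      pow   : ∀ u → u < n → arr τ Pow u ≡ 2 ^ u

  coordinates-frame : ∀ {F σ τ} → Frame F σ τ → clean F ≡ true → modifies F nᵛ ≡ false → modifies F kᵛ ≡ false → modifies F hᵛ ≡ false →
    stores F Minx ≡ false → stores F Maxx ≡ false → stores F Lo ≡ false → stores F Cut ≡ false → stores F Pow ≡ false →
    Coordinates σ → Coordinates τ
  coordinates-frame fr cl mn mk mh s₁ s₂ s₃ s₄ s₅ co = record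
    { n≡ = trans (regs nᵛ mn) n≡; k≡ = trans (regs kᵛ mk) k≡; h≡ = trans (regs hᵛ mh) h≡
    ; minxs = λ u u<n → trans (arrs cl Minx s₁ u) (minxs u u<n)
    ; maxxs = λ u u<n → trans (arrs cl Maxx s₂ u) (maxxs u u<n)
    ; los   = λ u u<n → trans (arrs cl Lo s₃ u) (los u u<n)
    ; cutss = λ i i< → trans (arrs cl Cut s₄ i) (cutss i i<)
    ; pow   = λ u u<n → trans (arrs cl Pow s₅ u) (pow u u<n) }
    where open Frame fr; open Coordinates co

module Keys (n k H : ℕ) (minx maxx lo cut : ℕ → ℕ) (o : ℕ) where

  open Layout n k H minx maxx lo cut

  -- Cut i is used for the offset o iff phase i ≡ 0, that is, iff i ≡ o modulo k.
  phase : ℕ → ℕ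
  phase zero    = o
  phase (suc i) = if phase i ≤ᵇ 0 then k ∸ 1 else phase i ∸ 1

  strip : ℕ → ℕ → ℕ
  strip zero    x = 0
  strip (suc i) x = encodeBool ((phase i ≤ᵇ 0) ∧ (cut i ≤ᵇ x)) + strip i x

  -- Strip and row are the two digits of a number in base `H`. Since rows are below `H`, ascending
  -- keys run through the strips one after the other and through each strip from below.
  key key′ : ℕ → ℕ
  key  u = lo u + strip (n + n) (minx u) * H
  key′ u = lo u + strip (n + n) (maxx u) * H

  -- Both keys share the summand `lo u`, so for positive `H` the test says that no cut in use
  -- separates the left end from the right end.
  kept : ℕ → Bool
  kept u = key′ u ≤ᵇ key u

  step-key : ∀ l i x → l + strip i x * H + H ≡ l + suc (strip i x) * H
  step-key l i x = arith l (strip i x) H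
    where
    arith : ∀ l s H → l + s * H + H ≡ l + (1 + s) * H
    arith = solve-∀

  record CountInv (u i : ℕ) (τ : State) : Set where
    field
      cnt≡  : reg τ cntᵛ ≡ phase i
      key≡  : reg τ keyᵛ ≡ lo u + strip i (minx u) * H
      key′≡ : reg τ key′ᵛ ≡ lo u + strip i (maxx u) * H

  countCutsSpec : ∀ u σ → u < n → Coordinates σ → reg σ uᵛ ≡ u → CountInv u 0 σ →
                  Spec countCuts σ (7 + (n + n) * 105) (CountInv u (n + n))
  countCutsSpec u σ u<n co u≡ init = forSpec (n + n) 100 (CountInv u) (cong₂ _+_ (Coordinates.n≡ co) (Coordinates.n≡ co)) init body
    where
    open Coordinates co
    body : ∀ i τ → i < n + n → Frame (foot countCuts) σ τ → CountInv u i τ → Spec _ (set iᵛ i τ) 100 (CountInv u (suc i))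
    body i τ i< fr inv = within by-computation (branch {t = 90}
        (λ le → within by-computation
          (andThen {t = 29} {Q = λ υ → reg υ keyᵛ ≡ lo u + strip′ (minx u) * H × reg υ key′ᵛ ≡ lo u + strip i (maxx u) * H}
            (branch {t = 10}
              (λ le₁ → within by-computation (now (trans (cong₂ _+_ key≡ h≡τ) (trans (step-key (lo u) i (minx u)) (sym (hits (minx u) (subst₂ _≤_ cut≡ minx≡ le₁)))) , key′≡)))
              (λ gt₁ → within by-computation (now (trans key≡ (sym (misses (minx u) (subst₂ _<_ minx≡ cut≡ gt₁))) , key′≡))))
            λ υ frυ (k₁ , k₂) →
            andThen {t = 29} {Q = λ φ → reg φ keyᵛ ≡ lo u + strip′ (minx u) * H × reg φ key′ᵛ ≡ lo u + strip′ (maxx u) * H}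
              (branch {t = 10}
                (λ le₂ → within by-computation (now (k₁ , trans (cong₂ _+_ k₂ (trans (Frame.regs frυ hᵛ refl) h≡τ))
                  (trans (step-key (lo u) i (maxx u)) (sym (hits (maxx u) (subst₂ _≤_ (cutυ υ frυ) (maxxυ υ frυ) le₂)))))))
                (λ gt₂ → within by-computation (now (k₁ , trans k₂ (sym (misses (maxx u) (subst₂ _<_ (maxxυ υ frυ) (cutυ υ frυ) gt₂)))))))
              λ φ frφ (k₁ , k₂) → now (record
                { cnt≡ = trans (cong (_∸ 1) (trans (Frame.regs frφ kᵛ refl) (trans (Frame.regs frυ kᵛ refl) (trans (Frame.regs fr kᵛ refl) k≡))))
                           (sym (cong (if_then k ∸ 1 else phase i ∸ 1) (on le)))
                ; key≡ = trans k₁ (cong (λ b → lo u + (encodeBool (b ∧ (cut i ≤ᵇ minx u)) + strip i (minx u)) * H) (sym (on le)))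
                ; key′≡ = trans k₂ (cong (λ b → lo u + (encodeBool (b ∧ (cut i ≤ᵇ maxx u)) + strip i (maxx u)) * H) (sym (on le))) })))
        (λ gt → within by-computation (now (record
          { cnt≡ = trans (cong (_∸ 1) cnt≡) (sym (cong (if_then k ∸ 1 else phase i ∸ 1) (off gt)))
          ; key≡ = trans key≡ (cong (λ b → lo u + (encodeBool (b ∧ (cut i ≤ᵇ minx u)) + strip i (minx u)) * H) (sym (off gt)))
          ; key′≡ = trans key′≡ (cong (λ b → lo u + (encodeBool (b ∧ (cut i ≤ᵇ maxx u)) + strip i (maxx u)) * H) (sym (off gt))) }))))
      where
      open CountInv inv
      strip′ : ℕ → ℕ
      strip′ x = encodeBool (cut i ≤ᵇ x) + strip i x
      hits : ∀ x → cut i ≤ x → lo u + strip′ x * H ≡ lo u + suc (strip i x) * H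
      hits x le = cong (λ b → lo u + (encodeBool b + strip i x) * H) (≤⇒≤ᵇ-true le)
      misses : ∀ x → x < cut i → lo u + strip′ x * H ≡ lo u + strip i x * H
      misses x gt = cong (λ b → lo u + (encodeBool b + strip i x) * H) (>⇒≤ᵇ-false gt)
      on : reg τ cntᵛ ≤ 0 → (phase i ≤ᵇ 0) ≡ true
      on le = ≤⇒≤ᵇ-true (subst (_≤ 0) cnt≡ le)
      off : 0 < reg τ cntᵛ → (phase i ≤ᵇ 0) ≡ false
      off gt = >⇒≤ᵇ-false (subst (0 <_) cnt≡ gt)
      h≡τ : reg τ hᵛ ≡ H
      h≡τ = trans (Frame.regs fr hᵛ refl) h≡
      u≡τ : reg τ uᵛ ≡ u
      u≡τ = trans (Frame.regs fr uᵛ refl) u≡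
      cut≡ : arr τ Cut i ≡ cut i
      cut≡ = trans (Frame.arrs fr refl Cut refl i) (cutss i i<)
      minx≡ : arr τ Minx (reg τ uᵛ) ≡ minx u
      minx≡ = trans (cong (arr τ Minx) u≡τ) (trans (Frame.arrs fr refl Minx refl u) (minxs u u<n))
      cutυ : ∀ υ → Frame (foot countLeft) (set iᵛ i τ) υ → arr υ Cut (reg υ iᵛ) ≡ cut i
      cutυ υ frυ = trans (cong (arr υ Cut) (Frame.regs frυ iᵛ refl)) (trans (Frame.arrs frυ refl Cut refl i) cut≡)
      maxxυ : ∀ υ → Frame (foot countLeft) (set iᵛ i τ) υ → arr υ Maxx (reg υ uᵛ) ≡ maxx u
      maxxυ υ frυ = trans (cong (arr υ Maxx) (trans (Frame.regs frυ uᵛ refl) u≡τ)) (trans (Frame.arrs frυ refl Maxx refl u)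
        (trans (Frame.arrs fr refl Maxx refl u) (maxxs u u<n)))

  record KeysInv (u : ℕ) (τ : State) : Set where
    field
      kept≡ : reg τ keptᵛ ≡ mask u kept
      keys≡ : ∀ v → v < u → arr τ Key v ≡ key v
      top   : ∀ v → v < u → key v ≤ reg τ infᵛ

  keysOfSpec : ∀ u σ → u < n → Coordinates σ → reg σ uᵛ ≡ u → reg σ oᵛ ≡ o → KeysInv u σ →
               Spec keysOf σ (73 + (n + n) * 105) (KeysInv (suc u))
  keysOfSpec u σ u<n co u≡ o≡ inv = within (≤-reflexive (arith ((n + n) * 105)))
      (first (andThen (countCutsSpec u σ₁ u<n co₁ u≡ (record { cnt≡ = o≡; key≡ = lo≡; key′≡ = lo≡ })) afterCount))
    where
    open KeysInv inv
    arith : ∀ m → 26 + ((7 + m) + (21 + 19)) ≡ 73 + m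
    arith = solve-∀
    σ₁ = ⟦ keyᵛ ≔ Lo at var uᵛ ⨟ key′ᵛ ≔ Lo at var uᵛ ⨟ cntᵛ ≔ var oᵛ ⟧ σ
    co₁ : Coordinates σ₁
    co₁ = coordinates-frame (frame (keyᵛ ≔ Lo at var uᵛ ⨟ key′ᵛ ≔ Lo at var uᵛ ⨟ cntᵛ ≔ var oᵛ) σ)
            refl refl refl refl refl refl refl refl refl co
    lo≡ : arr σ Lo (reg σ uᵛ) ≡ lo u + 0
    lo≡ = trans (cong (arr σ Lo) u≡) (trans (Coordinates.los co u u<n) (sym (+-identityʳ (lo u))))
    afterCount : ∀ τ → Frame (foot countCuts) σ₁ τ → CountInv u (n + n) τ → Spec _ τ (21 + 19) (KeysInv (suc u))
    afterCount τ fr counted = first (branch {t = 14} keep drop′)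
      where
      open CountInv counted
      τ₁ = ⟦ Key [ var uᵛ ]≔ var keyᵛ ⨟ infᵛ ≔ var infᵛ ⊕ (var keyᵛ ⊖ var infᵛ) ⟧ τ
      u≡τ : reg τ uᵛ ≡ u
      u≡τ = trans (Frame.regs fr uᵛ refl) u≡
      kept≡τ : reg τ keptᵛ ≡ mask u kept
      kept≡τ = trans (Frame.regs fr keptᵛ refl) kept≡
      inf≡τ : reg τ infᵛ ≡ reg σ infᵛ
      inf≡τ = Frame.regs fr infᵛ refl
      pow≡ : arr τ₁ Pow (reg τ uᵛ) ≡ 2 ^ u
      pow≡ = trans (store-array (mem τ) (reg τ 0) Key (reg τ uᵛ) (reg τ uᵛ) λ ())
        (trans (cong (arr τ Pow) u≡τ) (trans (Frame.arrs fr refl Pow refl u) (Coordinates.pow co u u<n)))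
      rest : ∀ {υ} → (∀ v → arr υ Key v ≡ arr τ₁ Key v) → reg υ infᵛ ≡ reg τ₁ infᵛ → reg υ keptᵛ ≡ mask (suc u) kept → KeysInv (suc u) υ
      rest {υ} arr≡ inf≡ kept≡′ = record
        { kept≡ = kept≡′
        ; keys≡ = λ v v<su → trans (arr≡ v) (key-at v (<suc⇒<⊎≡ v<su))
        ; top = λ v v<su → ≤-trans (below v (<suc⇒<⊎≡ v<su)) (≤-reflexive (sym inf≡)) }
        where
        key-at : ∀ v → v < u ⊎ v ≡ u → arr τ₁ Key v ≡ key v
        key-at v (inj₁ v<u) = trans (store-index (mem τ) (reg τ 0) Key (reg τ uᵛ) (λ eq → <⇒≢ v<u (trans eq u≡τ)))
          (trans (Frame.arrs fr refl Key refl v) (keys≡ v v<u))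
        key-at v (inj₂ refl) = trans (store-same (mem τ) (reg τ 0) Key (reg τ uᵛ) (sym u≡τ)) key≡
        below : ∀ v → v < u ⊎ v ≡ u → key v ≤ reg τ infᵛ + (reg τ keyᵛ ∸ reg τ infᵛ)
        below v (inj₁ v<u) = ≤-trans (top v v<u) (≤-trans (≤-reflexive (sym inf≡τ)) (m≤m+n _ _))
        below v (inj₂ refl) = ≤-trans (≤-reflexive (sym key≡)) (m≤n+m∸n (reg τ keyᵛ) (reg τ infᵛ))
      keep : reg τ key′ᵛ ≤ reg τ keyᵛ → Spec _ τ₁ 14 (KeysInv (suc u))
      keep le = now (rest (λ _ → refl) refl
        (trans (cong₂ _+_ kept≡τ pow≡) (cong (λ b → mask u kept + bit b u) (sym (≤⇒≤ᵇ-true (subst₂ _≤_ key′≡ key≡ le))))))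
      drop′ : reg τ keyᵛ < reg τ key′ᵛ → Spec skip τ₁ 14 (KeysInv (suc u))
      drop′ gt = within by-computation (now (rest (λ _ → refl) refl
        (trans kept≡τ (trans (sym (+-identityʳ _)) (cong (λ b → mask u kept + bit b u) (sym (>⇒≤ᵇ-false (subst₂ _<_ key≡ key′≡ gt))))))))

  keysTime : ℕ
  keysTime = 10 + n * (78 + (n + n) * 105)

  keysSpec : ∀ σ → Coordinates σ → reg σ oᵛ ≡ o →
             Spec keys σ keysTime (λ τ → reg τ keptᵛ ≡ mask n kept ×
               ∃[ inf ] (KeyState n key inf (λ _ → false) τ × (∀ u → u < n → key u ≤ inf)))
  keysSpec σ co o≡ = weaken ≤-refl (λ τ _ inv → KeysInv.kept≡ inv , reg τ infᵛ , (refl , KeysInv.keys≡ inv) , KeysInv.top inv)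
    (first (first (forSpec n (73 + (n + n) * 105) KeysInv (Coordinates.n≡ co)
      (record { kept≡ = refl; keys≡ = λ _ (); top = λ _ () })
      λ u τ u<n fr inv → keysOfSpec u (set uᵛ u τ) u<n
        (coordinates-frame (frame (uᵛ ≔ lit u) τ) refl refl refl refl refl refl refl refl refl
          (coordinates-frame fr refl refl refl refl refl refl refl refl refl
            (coordinates-frame (frame (keptᵛ ≔ lit 0 ⨟ infᵛ ≔ lit 0) σ) refl refl refl refl refl refl refl refl refl co)))
        refl (trans (Frame.regs fr oᵛ refl) o≡)
        (record { kept≡ = KeysInv.kept≡ inv; keys≡ = KeysInv.keys≡ inv; top = KeysInv.top inv }))))

-- The result overwrites the first n input cells. The only array still read is `Pow`, which begins
-- no lower than cell n. As `out` forfeits the frame of arrays, `pows` is carried in the invariant.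
outputSpec : ∀ {n S} σ → reg σ nᵛ ≡ n → n ≤ reg σ 0 → (∀ u → u < n → arr σ Pow u ≡ 2 ^ u) → reg σ bestᵛ ≡ mask n S →
             Spec output-loop σ (4 + n * 60) (λ τ → ∀ u → u < n → mem τ u ≡ encodeBool (S u))
outputSpec {n} {S} σ n≡ n≤ pow best≡ = weaken ≤-refl
    (λ τ _ inv u u<n → Inv.written inv u u<n (subst (_≤ u) (sym (n∸n≡0 n)) z≤n))
    (forSpec n 55 (λ d → Inv (n ∸ d)) n≡ (record { rest = best≡; written = λ u u<n n≤u → contradiction u<n (≤⇒≯ n≤u); pows = pow }) body)
  where
  record Inv (m : ℕ) (τ : State) : Set where
    field
      rest    : reg τ bestᵛ ≡ mask m S
      written : ∀ u → u < n → m ≤ u → mem τ u ≡ encodeBool (S u)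
      pows    : ∀ u → u < n → arr τ Pow u ≡ 2 ^ u
  body : ∀ d τ → d < n → Frame (foot output-loop) σ τ → Inv (n ∸ d) τ → Spec _ (set dᵛ d τ) 55 (Inv (n ∸ suc d))
  body d τ d<n fr inv = within by-computation (first (first (branch {t = 16} present absent)))
    where
    m = n ∸ suc d
    τ₁ = ⟦ bᵛ ≔ var nᵛ ⊖ (var dᵛ ⊕ lit 1) ⨟ powᵛ ≔ Pow at var bᵛ ⟧ (set dᵛ d τ)
    m<n : m < n
    m<n = subst (_≤ n) (∸-suc-suc d<n) (m∸n≤m n d)
    inv′ : Inv (suc m) τ
    inv′ = subst (λ k → Inv k τ) (∸-suc-suc d<n) inv
    open Inv inv′
    b≡ : reg τ₁ bᵛ ≡ m
    b≡ = cong₂ _∸_ (trans (Frame.regs fr nᵛ refl) n≡) (+-comm d 1)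
    pow≡ : reg τ₁ powᵛ ≡ 2 ^ m
    pow≡ = trans (cong (arr τ Pow) b≡) (pows m m<n)
    written′ : ∀ v → v ≡ encodeBool (S m) → ∀ u → u < n → m ≤ u → (mem τ [ reg τ₁ bᵛ ↦ v ]) u ≡ encodeBool (S u)
    written′ v v≡ u u<n m≤u with m≤n⇒m<n∨m≡n m≤u
    ... | inj₁ m<u = trans (upd-diff (mem τ) (λ eq → <⇒≢ m<u (sym (trans eq b≡)))) (written u u<n m<u)
    ... | inj₂ refl = trans (cong (mem τ [ reg τ₁ bᵛ ↦ v ]) (sym b≡)) (trans (upd-same (mem τ) (reg τ₁ bᵛ)) v≡)
    pows′ : ∀ v u → u < n → (mem τ [ reg τ₁ bᵛ ↦ v ]) (cell (reg τ 0) Pow u) ≡ 2 ^ u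
    pows′ v u u<n = trans (upd-diff (mem τ) (>⇒≢ (<-≤-trans (subst (_< n) (sym b≡) m<n)
      (≤-trans n≤ (≤-trans (≤-reflexive (sym (Frame.regs fr 0 refl))) (m≤m+n (reg τ 0) _)))))) (pows u u<n)
    present : reg τ₁ powᵛ ≤ reg τ bestᵛ → Spec _ τ₁ 16 (Inv m)
    present le = within by-computation (now (record
      { rest = trans (cong₂ _∸_ (trans rest (cong (λ b → mask m S + bit b m) Sm)) pow≡) (m+n∸n≡m (mask m S) (2 ^ m))
      ; written = written′ 1 (sym (cong encodeBool Sm)); pows = pows′ 1 }))
      where
      Sm : S m ≡ true
      Sm = top-bit m S (subst₂ _≤_ pow≡ rest le)
    absent : reg τ bestᵛ < reg τ₁ powᵛ → Spec _ τ₁ 16 (Inv m)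
    absent gt = within by-computation (now (record
      { rest = trans rest (trans (cong (λ b → mask m S + bit b m) Sm) (+-identityʳ _))
      ; written = written′ 0 (sym (cong encodeBool Sm)); pows = pows′ 0 }))
      where
      Sm : S m ≡ false
      Sm = no-top-bit m S (subst₂ _<_ rest pow≡ gt)

-- All offsets, and the whole program

optimise : Cmd
optimise = for oᵛ (var kᵛ) (keys ⨟ dp)

initBest : Cmd
initBest = bestᵛ ≔ lit 0 ⨟ best-wᵛ ≔ʷ wnil ⨟ tabᵛ ≔ lit 0 ⨟ tailᵛ ≔ lit 0

main : ℕ → ℕ → Cmd
main q c = setup q ⨟ powers ⨟ parse ⨟ cuts c ⨟ initBest ⨟ optimise ⨟ output-loop

module Main (n : ℕ) (A : ℕ → ℕ → Bool) (w : ℕ → ℚ) (sym-A : Symmetric A) (k H : ℕ)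
            (minx maxx lo cut : ℕ → ℕ) (M : ℕ)
            (narrow : ∀ o → o < k → Available.Narrow n A (Keys.kept n k H minx maxx lo cut o) M (Keys.key n k H minx maxx lo cut o)) where

  open Layout n k H minx maxx lo cut
  open Available n A (λ _ → true) using (IndependentSet)

  kept : ℕ → ℕ → Bool
  kept = Keys.kept n k H minx maxx lo cut

  roundTime : ℕ
  roundTime = 10 + n * (78 + (n + n) * 105) + dpTime n (n ^ M)

  record Rounds (i : ℕ) (τ : State) : Set where
    field
      best    : Best n A w τ
      fresh   : Fresh n A w τ
      optimal : ∀ o → o < i → ∀ I → IndependentSet I → (∀ s → s < n → I s ≡ true → kept o s ≡ true) →
                wsum w n I ℚ.≤ wreg τ best-wᵛ

  optimiseSpec : ∀ σ → Ctx n A w σ → Coordinates σ → Best n A w σ → Fresh n A w σ →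
                 Spec optimise σ (4 + k * (5 + roundTime)) (Rounds k)
  optimiseSpec σ ctx co best fresh = forSpec k roundTime Rounds (Coordinates.k≡ co)
      (record { best = best; fresh = fresh; optimal = λ _ () }) body
    where
    body : ∀ o τ → o < k → Frame (foot optimise) σ τ → Rounds o τ → Spec (keys ⨟ dp) (set oᵛ o τ) roundTime (Rounds (suc o))
    body o τ o<k fr inv = andThen (keysSpec (set oᵛ o τ) co₁ refl) afterKeys
      where
      open Keys n k H minx maxx lo cut o using (key; keysSpec)
      module R = Rounds inv
      co₁ : Coordinates (set oᵛ o τ)
      co₁ = coordinates-frame (frame (oᵛ ≔ lit o) τ) refl refl refl refl refl refl refl refl refl
              (coordinates-frame fr refl refl refl refl refl refl refl refl refl co)
      ctx₁ : Ctx n A w (set oᵛ o τ)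
      ctx₁ = ctx-frame (frame (oᵛ ≔ lit o) τ) refl refl refl refl (ctx-frame fr refl refl refl refl ctx)
      afterKeys : ∀ τ₂ → Frame (foot keys) (set oᵛ o τ) τ₂ →
                  (reg τ₂ keptᵛ ≡ mask n (kept o) × ∃[ inf ] (KeyState n key inf (λ _ → false) τ₂ × (∀ u → u < n → key u ≤ inf))) →
                  Spec dp τ₂ (dpTime n (n ^ M)) (Rounds (suc o))
      afterKeys τ₂ fr₂ (kept≡ , inf , ks , key≤) = weaken ≤-refl next
          (dpSpec n A w sym-A (kept o) key inf key≤ M (narrow o o<k) τ₂ (ctx-frame fr₂ refl refl refl refl ctx₁) kept≡ ks
            (λ z le → trans (Frame.arrs fr₂ refl Tab refl z) (R.fresh z (subst (_≤ z) (Frame.regs fr₂ tabᵛ refl) le)))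
            (record { S = Best.S R.best; independent = Best.independent R.best
                    ; best≡ = trans (Frame.regs fr₂ bestᵛ refl) (Best.best≡ R.best)
                    ; best-w≡ = trans (Frame.wregs fr₂ best-wᵛ refl) (Best.best-w≡ R.best) }))
        where
        next : ∀ υ → Frame (foot dp) τ₂ υ → Optimised n A w (kept o) τ₂ υ → Rounds (suc o) υ
        next υ _ opt = record { best = O.best; fresh = O.fresh; optimal = optimal′ }
          where
          module O = Optimised opt
          optimal′ : ∀ o′ → o′ < suc o → ∀ I → IndependentSet I → (∀ s → s < n → I s ≡ true → kept o′ s ≡ true) →
                     wsum w n I ℚ.≤ wreg υ best-wᵛ
          optimal′ o′ o′< I ind I⊆ with <suc⇒<⊎≡ o′<
          ... | inj₂ refl = O.optimal I ind I⊆
          ... | inj₁ o′<o = ℚₚ.≤-trans (R.optimal o′ o′<o I ind I⊆)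
                  (ℚₚ.≤-trans (ℚₚ.≤-reflexive (sym (Frame.wregs fr₂ best-wᵛ refl))) O.better)

record Solved (n : ℕ) (A : ℕ → ℕ → Bool) (w : ℕ → ℚ) (k : ℕ) (kept : ℕ → ℕ → Bool) (τ : State) : Set where
  field
    S           : ℕ → Bool
    independent : Available.IndependentSet n A (λ _ → true) S
    written     : ∀ u → u < n → mem τ u ≡ encodeBool (S u)
    optimal     : ∀ o → o < k → ∀ I → Available.IndependentSet n A (λ _ → true) I →
                  (∀ s → s < n → I s ≡ true → kept o s ≡ true) → wsum w n I ℚ.≤ wsum w n S

module Whole (n : ℕ) (A : ℕ → ℕ → Bool) (w : ℕ → ℚ) (sym-A : Symmetric A) (k W H b c M : ℕ)
  (B : ℕ) (bds ptrs : ℕ → ℕ) (pts : ℕ → List Point) where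

  minx maxx lo cut : ℕ → ℕ
  minx u = lowest proj₁ (pts u)
  maxx u = highest proj₁ (pts u)
  lo u   = lowest proj₂ (pts u)
  cut    = Cuts.cutAt n W c minx maxx

  -- A path with at most b bends is encoded in at most 2b + 5 cells.
  q : ℕ
  q = 2 * b + 5

  mainTime : ℕ
  mainTime = 27 + n * 23 + (7 + n * 25 + (4 + n * (5 + (70 + (b + 2) * 60)) + (10 + (n + n) * (40 + n * 50) +
    (12 + (4 + k * (5 + (10 + n * (78 + (n + n) * 105) + dpTime n (n ^ M))) + (4 + n * 60))))))

  mainSpec : ∀ σ →
    (narrow : ∀ o → o < k → Available.Narrow n A (Keys.kept n k H minx maxx lo cut o) M (Keys.key n k H minx maxx lo cut o)) →
    reg σ kᵛ ≡ k → mem σ 0 ≡ n → mem σ 4 ≡ W → mem σ 5 ≡ H →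
    (∀ v u → v < n → u < n → mem σ (6 + v * n + u) ≡ encodeBool (A v u)) →
    (∀ u → u < n → wmem σ u ≡ w u) →
    (∀ u → u < n → Reads (mem σ) B (ptrs u) (bds u ∷ concatMap encodePoint (pts u))) →
    (∀ u → u < n → bds u + 2 ≡ length (pts u)) → (∀ u → u < n → bds u ≤ b) →
    (∀ u → u < n → ptrs (suc u) ≡ ptrs u + 1 + 2 * length (pts u)) → ptrs 0 ≡ 6 + n * n →
    B ≤ 6 + n * n + n * q → (∀ j → B ≤ j → mem σ j ≡ 0) →
    Spec (main q c) σ mainTime (Solved n A w k (Keys.kept n k H minx maxx lo cut))
  mainSpec σ narrow k≡ n≡ W≡ H≡ adjs weights reads len few nexts ptr₀ B≤ zeros =
    andThen (setupSpec q σ n≡ W≡ H≡) λ τ₁ fr₁ ready →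
    let module Rd = Ready ready
        B≤₁ : B ≤ reg τ₁ 0
        B≤₁ = ≤-trans B≤ (≤-reflexive (sym Rd.base≡))
        room₁ : 6 + n * n ≤ reg τ₁ 0
        room₁ = ≤-trans (m≤m+n (6 + n * n) (n * q)) (≤-reflexive (sym Rd.base≡))
    in
    andThen (powersSpec τ₁ Rd.n≡) λ τ₂ fr₂ (2ⁿ≡ , pow) →
    andThen (parseSpec (mem σ) B b n bds ptrs pts reads len few nexts τ₂
        (trans (Frame.regs fr₂ nᵛ refl) Rd.n≡) (trans (Frame.regs fr₂ ptrᵛ refl) (trans Rd.ptr≡ (sym ptr₀)))
        (≤-trans B≤₁ (≤-reflexive (sym (Frame.base fr₂ refl))))
        (λ j j< → trans (Frame.inps fr₂ refl (<-≤-trans j< B≤₁)) (cong (λ m → m j) Rd.mem≡))) λ τ₃ fr₃ parsed →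
    andThen (Cuts.cutsSpec n W c minx maxx τ₃
        (trans (Frame.regs fr₃ nᵛ refl) (trans (Frame.regs fr₂ nᵛ refl) Rd.n≡))
        (trans (Frame.regs fr₃ widthᵛ refl) (trans (Frame.regs fr₂ widthᵛ refl) Rd.W≡))
        (Parsed.minxs parsed) (Parsed.maxxs parsed)) λ τ₄ fr₄ cut≡ →
    let τ₅ = ⟦ initBest ⟧ τ₄
        regs₄ : ∀ x → modifies (foot powers) x ≡ false → modifies (foot parse) x ≡ false → modifies (foot (cuts c)) x ≡ false → reg τ₄ x ≡ reg τ₁ x
        regs₄ x p₂ p₃ p₄ = trans (Frame.regs fr₄ x p₄) (trans (Frame.regs fr₃ x p₃) (Frame.regs fr₂ x p₂))
        ctx₂ : Ctx n A w τ₂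
        ctx₂ = record
          { n≡ = trans (Frame.regs fr₂ nᵛ refl) Rd.n≡
          ; 2ⁿ≡ = 2ⁿ≡
          ; pow = pow
          ; room = ≤-trans room₁ (≤-reflexive (sym (Frame.base fr₂ refl)))
          ; roomʷ = ≤-trans (n≤6+n*n n) (≤-trans room₁ (≤-reflexive (sym (Frame.base fr₂ refl))))
          ; adjs = λ v u v<n u<n → trans (Frame.inps fr₂ refl (<-≤-trans (cell< v u v<n u<n) room₁)) (trans (cong (λ m → m (6 + v * n + u)) Rd.mem≡) (adjs v u v<n u<n))
          ; weights = λ u u<n → trans (Frame.winps fr₂ refl (<-≤-trans u<n (≤-trans (n≤6+n*n n) room₁))) (trans (cong (λ m → m u) Rd.wmem≡) (weights u u<n)) }
        ctx₄ : Ctx n A w τ₄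
        ctx₄ = ctx-frame fr₄ refl refl refl refl (ctx-frame fr₃ refl refl refl refl ctx₂)
        ctx₅ : Ctx n A w τ₅
        ctx₅ = ctx-frame (frame initBest τ₄) refl refl refl refl ctx₄
        co₅ : Layout.Coordinates n k H minx maxx lo cut τ₅
        co₅ = record
          { n≡ = Ctx.n≡ ctx₅
          ; k≡ = trans (regs₄ kᵛ refl refl refl) (trans (Frame.regs fr₁ kᵛ refl) k≡)
          ; h≡ = trans (regs₄ hᵛ refl refl refl) Rd.H≡
          ; minxs = λ u u<n → trans (Frame.arrs fr₄ refl Minx refl u) (Parsed.minxs parsed u u<n)
          ; maxxs = λ u u<n → trans (Frame.arrs fr₄ refl Maxx refl u) (Parsed.maxxs parsed u u<n)
          ; los = λ u u<n → trans (Frame.arrs fr₄ refl Lo refl u) (Parsed.los parsed u u<n)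
          ; cutss = cut≡
          ; pow = Ctx.pow ctx₅ }
        -- The arrays begin behind the input, where memory is 0, and no command up to this point
        -- stores into `Tab`.
        fresh₅ : Fresh n A w τ₅
        fresh₅ z _ = trans (Frame.arrs fr₄ refl Tab refl z) (trans (Frame.arrs fr₃ refl Tab refl z) (trans (Frame.arrs fr₂ refl Tab refl z)
          (trans (cong (λ m → m (cell (reg τ₁ 0) Tab z)) Rd.mem≡) (zeros _ (≤-trans B≤₁ (m≤m+n (reg τ₁ 0) _))))))
        best₅ : Best n A w τ₅
        best₅ = record { S = λ _ → false; independent = λ _ _ _ _ (); best≡ = sym (mask-empty n (λ _ _ → refl)); best-w≡ = sym (wsum-empty w n (λ _ _ → refl)) }
    in
    first (andThen (Main.optimiseSpec n A w sym-A k H minx maxx lo cut M narrow τ₅ ctx₅ co₅ best₅ fresh₅) λ τ₆ fr₆ rounds →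
    let module R = Main.Rounds rounds
        ctx₆ : Ctx n A w τ₆
        ctx₆ = ctx-frame fr₆ refl refl refl refl ctx₅
    in
    weaken ≤-refl (λ τ₇ _ written → record
      { S = Best.S R.best; independent = Best.independent R.best; written = written
      ; optimal = λ o o<k I ind I⊆ → ℚₚ.≤-trans (R.optimal o o<k I ind I⊆) (ℚₚ.≤-reflexive (Best.best-w≡ R.best)) })
      (outputSpec τ₆ (Ctx.n≡ ctx₆) (Ctx.roomʷ ctx₆) (Ctx.pow ctx₆) (Best.best≡ R.best)))
    where
    n≤6+n*n : ∀ n → n ≤ 6 + n * n
    n≤6+n*n zero = z≤n
    n≤6+n*n (suc n) = ≤-trans (m≤m*n (suc n) (suc n)) (m≤n+m (suc n * suc n) 6)
    cell< : ∀ v u → v < n → u < n → 6 + v * n + u < 6 + n * n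
    cell< v u v<n u<n = ≤-trans (+-monoʳ-< (6 + v * n) u<n)
      (≤-trans (≤-reflexive (trans (+-assoc 6 (v * n) n) (cong (6 +_) (+-comm (v * n) n)))) (+-monoʳ-≤ 6 (*-monoˡ-≤ n v<n)))

-- Cuts and strips

min-formula≤ˡ : ∀ a b → a ∸ (a ∸ b) ≤ a
min-formula≤ˡ a b = m∸n≤m a (a ∸ b)

min-formula : ∀ a b → (b ≤ a × a ∸ (a ∸ b) ≡ b) ⊎ (a < b × a ∸ (a ∸ b) ≡ a)
min-formula a b with b ≤? a
... | yes b≤a = inj₁ (b≤a , m∸[m∸n]≡n b≤a)
... | no b≰a = inj₂ (≰⇒> b≰a , cong (a ∸_) (m≤n⇒m∸n≡0 (<⇒≤ (≰⇒> b≰a))))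

min-formula≤ʳ : ∀ a b → a ∸ (a ∸ b) ≤ b
min-formula≤ʳ a b with min-formula a b
... | inj₁ (_ , eq) = ≤-reflexive eq
... | inj₂ (a<b , eq) = ≤-trans (≤-reflexive eq) (<⇒≤ a<b)

count-mono : ∀ m {f g : ℕ → Bool} → (∀ u → u < m → f u ≡ true → g u ≡ true) → count m f ≤ count m g
count-mono zero _ = z≤n
count-mono (suc m) {f} {g} imp = +-mono-≤ (count-mono m (λ u u<m → imp u (m<n⇒m<1+n u<m))) last
  where
  last : encodeBool (f m) ≤ encodeBool (g m)
  last with f m in fm
  ... | false = z≤n
  ... | true rewrite imp m (n<1+n m) fm = ≤-refl

count-strict : ∀ m {f g : ℕ → Bool} {v} → v < m → (∀ u → u < m → f u ≡ true → g u ≡ true) → f v ≡ false → g v ≡ true → count m f < count m g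
count-strict (suc m) {f} {g} {v} v<m imp fv gv with <suc⇒<⊎≡ v<m
... | inj₂ refl rewrite fv | gv = ≤-trans (s≤s (≤-trans (≤-reflexive (+-identityʳ _)) (count-mono m (λ u u<m → imp u (m<n⇒m<1+n u<m))))) (≤-reflexive (+-comm 1 _))
... | inj₁ v<m′ = +-mono-≤ (count-strict m v<m′ (λ u u<m → imp u (m<n⇒m<1+n u<m)) fv gv) last
  where
  last : encodeBool (f m) ≤ encodeBool (g m)
  last with f m in fm
  ... | false = z≤n
  ... | true rewrite imp m (n<1+n m) fm = ≤-refl

count-positive : ∀ {m v} (f : ℕ → Bool) → v < m → f v ≡ true → 1 ≤ count m f
count-positive {suc m} {v} f v<m fv with <suc⇒<⊎≡ v<m
... | inj₂ refl rewrite fv = m≤n+m 1 (count v f)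
... | inj₁ v<m′ = ≤-trans (count-positive f v<m′ fv) (m≤m+n _ _)

module Cutting (n W c : ℕ) (minx maxx : ℕ → ℕ) (c≥1 : 1 ≤ c)
               (minx≤maxx : ∀ u → u < n → minx u ≤ maxx u) (short : ∀ u → u < n → maxx u ≤ minx u + c)
               (minx<W : ∀ u → u < n → minx u < W) where

  open Cuts n W c minx maxx

  Occupied : ℕ → Set
  Occupied x = ∃[ u ] (u < n × minx u ≤ x × x ≤ maxx u)

  next≤ : ∀ g m {u x} → u < m → minx u ≤ x → x ≤ maxx u → g ≤ x → next g m ≤ x
  next≤ g (suc m) {u} {x} u<m lo≤ ≤hi g≤x with <suc⇒<⊎≡ u<m
  ... | inj₂ refl rewrite ≤⇒≤ᵇ-true (≤-trans g≤x ≤hi) = ≤-trans (min-formula≤ʳ (next g u) _) g⊔minx≤x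
    where
    g⊔minx≤x : g + (minx u ∸ g) ≤ x
    g⊔minx≤x with ≤-total g (minx u)
    ... | inj₁ g≤m = ≤-trans (≤-reflexive (m+[n∸m]≡n g≤m)) lo≤
    ... | inj₂ m≤g = ≤-trans (≤-reflexive (trans (cong (g +_) (m≤n⇒m∸n≡0 m≤g)) (+-identityʳ g))) g≤x
  ... | inj₁ u<m′ with g ≤ᵇ maxx m
  ...   | true  = ≤-trans (min-formula≤ˡ (next g m) (g + (minx m ∸ g))) (next≤ g m u<m′ lo≤ ≤hi g≤x)
  ...   | false = next≤ g m u<m′ lo≤ ≤hi g≤x

  next≥ : ∀ g m → g ≤ next g m
  next≥ g zero = m≤n+m g W
  next≥ g (suc m) with g ≤ᵇ maxx m
  ... | false = next≥ g m
  ... | true with min-formula (next g m) (g + (minx m ∸ g))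
  ...   | inj₁ (_ , eq) = ≤-trans (m≤m+n g _) (≤-reflexive (sym eq))
  ...   | inj₂ (_ , eq) = ≤-trans (next≥ g m) (≤-reflexive (sym eq))

  next-occupied : ∀ g m → m ≤ n → (next g m ≡ W + g × (∀ u → u < m → maxx u < g)) ⊎ Occupied (next g m)
  next-occupied g zero _ = inj₁ (refl , λ _ ())
  next-occupied g (suc m) m<n with g ≤ᵇ maxx m in eq
  ... | false with next-occupied g m (<⇒≤ m<n)
  ...   | inj₂ occ = inj₂ occ
  ...   | inj₁ (val , none) = inj₁ (val , λ u u<m → none′ u (<suc⇒<⊎≡ u<m))
    where
    none′ : ∀ u → u < m ⊎ u ≡ m → maxx u < g
    none′ u (inj₁ u<m) = none u u<m
    none′ u (inj₂ refl) = ≤ᵇ-false⇒> eq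
  next-occupied g (suc m) m<n | true with min-formula (next g m) (g + (minx m ∸ g))
  ... | inj₁ (_ , val) rewrite val = inj₂ (m , m<n , m≤n+m∸n (minx m) g , x≤maxx)
    where
    x≤maxx : g + (minx m ∸ g) ≤ maxx m
    x≤maxx with ≤-total g (minx m)
    ... | inj₁ g≤m = ≤-trans (≤-reflexive (m+[n∸m]≡n g≤m)) (minx≤maxx m m<n)
    ... | inj₂ m≤g = ≤-trans (≤-reflexive (trans (cong (g +_) (m≤n⇒m∸n≡0 m≤g)) (+-identityʳ g))) (≤ᵇ-true⇒≤ eq)
  ... | inj₂ (lt , val) rewrite val with next-occupied g m (<⇒≤ m<n)
  ...   | inj₂ occ = inj₂ occ
  -- The default `W + g` is never smaller than a candidate, since left ends lie inside the grid; so
  -- it cannot win the minimum against path m.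
  ...   | inj₁ (val′ , _) = contradiction (subst (_< g + (minx m ∸ g)) val′ lt) (≤⇒≯ g⊔minx≤)
    where
    g⊔minx≤ : g + (minx m ∸ g) ≤ W + g
    g⊔minx≤ = ≤-trans (+-monoʳ-≤ g (≤-trans (m∸n≤m (minx m) g) (<⇒≤ (minx<W m m<n)))) (≤-reflexive (+-comm g W))

  cut-step : ∀ i → cutAt i + c ≤ cutAt (suc i)
  cut-step i = next≥ (cutAt i + c) n

  cut-far : ∀ {i j} → i < j → cutAt i + c ≤ cutAt j
  cut-far {i} {suc j} i<j with <suc⇒<⊎≡ i<j
  ... | inj₂ refl = cut-step i
  ... | inj₁ i<j′ = ≤-trans (cut-far i<j′) (≤-trans (m≤m+n (cutAt j) c) (cut-step j))

  cut-mono : ∀ {i j} → i ≤ j → cutAt i ≤ cutAt j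
  cut-mono {i} i≤j with m≤n⇒m<n∨m≡n i≤j
  ... | inj₂ refl = ≤-refl
  ... | inj₁ i<j = ≤-trans (m≤m+n (cutAt i) c) (cut-far i<j)

  -- A path meets at most two cuts, so every cut decreases this number of path ends not yet passed.
  Φ : ℕ → ℕ
  Φ g = count n (λ u → g ≤ᵇ maxx u) + count n (λ u → g ≤ᵇ minx u)

  -- If the path occupying g begins left of g, its length of at most c ends it before g′. If it
  -- begins at g itself, then `c≥1` puts its left end before g′.
  Φ-decreases : ∀ {g g′} → Occupied g → g + c ≤ g′ → Φ g′ < Φ g
  Φ-decreases {g} {g′} (u , u<n , lo≤ , ≤hi) far = go (m≤n⇒m<n∨m≡n lo≤)
    where
    g≤g′ : g ≤ g′
    g≤g′ = ≤-trans (m≤m+n g c) far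
    later : ∀ {z} → (g′ ≤ᵇ z) ≡ true → (g ≤ᵇ z) ≡ true
    later eq = ≤⇒≤ᵇ-true (≤-trans g≤g′ (≤ᵇ-true⇒≤ eq))
    go : minx u < g ⊎ minx u ≡ g → Φ g′ < Φ g
    go (inj₁ lt) = +-mono-<-≤
      (count-strict n u<n (λ _ _ → later) (>⇒≤ᵇ-false (≤-<-trans (short u u<n) (<-≤-trans (+-monoˡ-< c lt) far))) (≤⇒≤ᵇ-true ≤hi))
      (count-mono n (λ _ _ → later))
    go (inj₂ refl) = +-mono-≤-<
      (count-mono n (λ _ _ → later))
      (count-strict n u<n (λ _ _ → later) (>⇒≤ᵇ-false (≤-trans (≤-reflexive (+-comm 1 (minx u))) (≤-trans (+-monoʳ-≤ (minx u) c≥1) far))) (≤⇒≤ᵇ-true {minx u} ≤-refl))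

  -- As long as x is at least c to the right of the current cut, x itself is a candidate for the
  -- next cut, which is therefore at most x. Each step lowers `Φ`, initially at most 2n, and `Φ` is
  -- positive while x is not passed; so the search ends among the first 2n cuts.
  covered : ∀ {x} → Occupied x → ∃[ j ] ∃[ e ] (j < n + n × e < c × x ≡ cutAt j + e)
  covered {x} occ@(u₀ , u₀<n , lo≤ , ≤hi) = search (n + n) 0 refl (next≤ 0 n u₀<n lo≤ ≤hi z≤n) (+-mono-≤ (count≤ n _) (count≤ n _))
    where
    search : ∀ f i → i + f ≡ n + n → cutAt i ≤ x → i + Φ (cutAt i) ≤ n + n → ∃[ j ] ∃[ e ] (j < n + n × e < c × x ≡ cutAt j + e)
    search f i i+f≡ cut≤x bound with x <? cutAt i + c
    ... | yes x< = i , x ∸ cutAt i , <-≤-trans (≤-trans (≤-reflexive (+-comm 1 i)) (+-monoʳ-≤ i positive)) bound ,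
                   offset<c , sym (m+[n∸m]≡n cut≤x)
      where
      positive : 1 ≤ Φ (cutAt i)
      positive = ≤-trans (count-positive (λ u → cutAt i ≤ᵇ maxx u) u₀<n (≤⇒≤ᵇ-true (≤-trans cut≤x ≤hi))) (m≤m+n _ _)
      offset<c : x ∸ cutAt i < c
      offset<c = +-cancelˡ-< (cutAt i) _ _ (subst (_< cutAt i + c) (sym (m+[n∸m]≡n cut≤x)) x<)
    ... | no x≮ with next-occupied (gapAt i) n ≤-refl
    ...   | inj₁ (_ , none) = contradiction (≤-trans (next≥ (gapAt i) n) (≤-trans cut≤x ≤hi)) (<⇒≱ (none u₀ u₀<n))
    ...   | inj₂ occ′ = advance f i+f≡
      where
      drop′ : suc i + Φ (cutAt (suc i)) ≤ n + n
      drop′ = ≤-trans (≤-reflexive (sym (+-suc i _))) (≤-trans (+-monoʳ-≤ i (Φ-decreases occ′ (cut-step i))) bound)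
      advance : ∀ f → i + f ≡ n + n → ∃[ j ] ∃[ e ] (j < n + n × e < c × x ≡ cutAt j + e)
      advance zero eq = contradiction (≤-trans drop′ (≤-reflexive (sym (trans (sym (+-identityʳ i)) eq)))) (<⇒≱ (s≤s (m≤m+n i _)))
      advance (suc f) eq = search f (suc i) (trans (sym (+-suc i f)) eq) (next≤ (cutAt i + c) n u₀<n lo≤ ≤hi (≮⇒≥ x≮)) drop′

module Phases (n k H : ℕ) (minx maxx lo cut : ℕ → ℕ) (o : ℕ) where

  open Keys n k H minx maxx lo cut o

  phase<k : o < k → ∀ i → phase i < k
  phase<k o<k zero = o<k
  phase<k o<k (suc i) with phase i ≤ᵇ 0 in eq
  ... | true  = pred< o<k
    where
    pred< : ∀ {o k} → o < k → k ∸ 1 < k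
    pred< {k = suc k} _ = n<1+n k
  ... | false = ≤-<-trans (m∸n≤m (phase i) 1) (phase<k o<k i)

  active : ℕ → Bool
  active i = phase i ≤ᵇ 0

  actives : ℕ → ℕ
  actives zero    = 0
  actives (suc i) = encodeBool (active i) + actives i

  actives-mono : ∀ i d → actives i ≤ actives (i + d)
  actives-mono i zero rewrite +-identityʳ i = ≤-refl
  actives-mono i (suc d) rewrite +-suc i d = ≤-trans (actives-mono i d) (m≤n+m _ (encodeBool (active (i + d))))

  -- Without a cut in use in between, the countdown is never reset.
  phase-decreases : ∀ j d → actives (suc (j + d)) ≡ actives (suc j) → phase (suc (j + d)) + d ≡ phase (suc j)
  phase-decreases j zero _ rewrite +-identityʳ j = +-identityʳ _
  phase-decreases j (suc d) eq rewrite +-suc j d with active (suc (j + d)) in a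
  ... | true  = contradiction (≤-trans (s≤s (actives-mono (suc j) d)) (≤-reflexive eq)) (<⇒≱ (n<1+n _))
  ... | false with phase (suc (j + d)) | phase-decreases j d eq
  ...   | zero  | _  = contradiction a λ ()
  ...   | suc p | ih = trans (+-suc p d) ih

  no-gap : ∀ {j j′} → j ≤ j′ → actives (suc j′) ≡ actives (suc j) → phase (suc j) ≡ phase (suc j′) → j ≡ j′
  no-gap {j} {j′} j≤j′ eqa eqp = trans (sym (+-identityʳ j)) (trans (cong (j +_) (sym gap≡0)) (m+[n∸m]≡n j≤j′))
    where
    gap≡0 : j′ ∸ j ≡ 0
    gap≡0 = +-cancelˡ-≡ (phase (suc j′)) _ _ (trans
      (subst (λ i → phase (suc i) + (j′ ∸ j) ≡ phase (suc j)) (m+[n∸m]≡n j≤j′)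
        (phase-decreases j (j′ ∸ j) (trans (cong (actives ∘ suc) (m+[n∸m]≡n j≤j′)) eqa)))
      (trans eqp (sym (+-identityʳ _))))

  -- Thus the phase identifies a window inside its strip. It is taken at `suc j`, behind the reset
  -- at the cut that opens the strip, so that no wrap-around can occur within the strip.
  same-phase : ∀ {j j′} → actives (suc j) ≡ actives (suc j′) → phase (suc j) ≡ phase (suc j′) → j ≡ j′
  same-phase {j} {j′} eqa eqp with ≤-total j j′
  ... | inj₁ j≤j′ = no-gap j≤j′ (sym eqa) eqp
  ... | inj₂ j′≤j = sym (no-gap j′≤j eqa (sym eqp))

  strip-mono : ∀ i {x y} → x ≤ y → strip i x ≤ strip i y
  strip-mono zero _ = z≤n
  strip-mono (suc i) {x} {y} x≤y = +-mono-≤ here′ (strip-mono i x≤y)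
    where
    here′ : encodeBool (active i ∧ (cut i ≤ᵇ x)) ≤ encodeBool (active i ∧ (cut i ≤ᵇ y))
    here′ with active i
    ... | false = z≤n
    ... | true with cut i ≤ᵇ x in eq
    ...   | false = z≤n
    ...   | true rewrite ≤⇒≤ᵇ-true (≤-trans (≤ᵇ-true⇒≤ {cut i} eq) x≤y) = ≤-refl

  crossing : ∀ m {x y} → strip m x < strip m y → ∃[ i ] (i < m × active i ≡ true × x < cut i × cut i ≤ y)
  crossing zero ()
  crossing (suc m) {x} {y} lt with active m in am | cut m ≤ᵇ x in cx | cut m ≤ᵇ y in cy
  ... | true | false | true = m , n<1+n m , am , ≤ᵇ-false⇒> cx , ≤ᵇ-true⇒≤ cy
  ... | true | true | true = let i , i< , rest = crossing m (+-cancelˡ-< 1 _ _ lt) in i , m<n⇒m<1+n i< , rest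
  ... | true | true | false = let i , i< , rest = crossing m (≤-trans (n≤1+n _) lt) in i , m<n⇒m<1+n i< , rest
  ... | true | false | false = let i , i< , rest = crossing m lt in i , m<n⇒m<1+n i< , rest
  ... | false | _ | _ = let i , i< , rest = crossing m lt in i , m<n⇒m<1+n i< , rest

module Strips (n k H W c : ℕ) (minx maxx lo : ℕ → ℕ) (c≥1 : 1 ≤ c)
              (minx≤maxx : ∀ u → u < n → minx u ≤ maxx u) (short : ∀ u → u < n → maxx u ≤ minx u + c)
              (minx<W : ∀ u → u < n → minx u < W) (lo<H : ∀ u → u < n → lo u < H) where

  open Cuts n W c minx maxx using (cutAt)
  open Cutting n W c minx maxx c≥1 minx≤maxx short minx<W

  module _ (o : ℕ) where

    open Keys n k H minx maxx lo cutAt o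
    open Phases n k H minx maxx lo cutAt o

    -- The cuts up to j are at or left of this column, and all later ones are at least c away from
    -- cut j, hence to the right of it.
    strip-cut : ∀ {j e} → j < n + n → e < c → strip (n + n) (cutAt j + e) ≡ actives (suc j)
    strip-cut {j} {e} j< e<c = trans (cong (λ m → strip m (cutAt j + e)) (sym (m+[n∸m]≡n j<))) (after (n + n ∸ suc j))
      where
      before : ∀ m → m ≤ suc j → strip m (cutAt j + e) ≡ actives m
      before zero _ = refl
      before (suc m) (s≤s m≤j) rewrite ≤⇒≤ᵇ-true (≤-trans (cut-mono m≤j) (m≤m+n (cutAt j) e)) =
        cong₂ (λ b s → encodeBool b + s) (Boolₚ.∧-identityʳ (active m)) (before m (m≤n⇒m≤1+n m≤j))
      after : ∀ d → strip (suc j + d) (cutAt j + e) ≡ actives (suc j)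
      after zero = trans (cong (λ m → strip m (cutAt j + e)) (+-identityʳ (suc j))) (before (suc j) ≤-refl)
      after (suc d) = trans (cong (λ m → strip m (cutAt j + e)) (+-suc (suc j) d))
        (trans (cong (λ b → encodeBool (active (suc j + d) ∧ b) + strip (suc j + d) (cutAt j + e))
                 (>⇒≤ᵇ-false (<-≤-trans (+-monoʳ-< (cutAt j) e<c) (cut-far (s≤s (m≤m+n j d))))))
          (trans (cong (λ b → encodeBool b + strip (suc j + d) (cutAt j + e)) (Boolₚ.∧-zeroʳ (active (suc j + d)))) (after d)))

    H>0 : ∀ {u} → u < n → NonZero H
    H>0 u<n = >-nonZero (≤-<-trans z≤n (lo<H _ u<n))

    -- The strip number is monotone in the column and agrees at both ends of a kept path; cancelling
    -- `H` is possible because some row exists.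
    kept-strip : ∀ {u x} → u < n → kept u ≡ true → minx u ≤ x → x ≤ maxx u → strip (n + n) x ≡ strip (n + n) (minx u)
    kept-strip {u} {x} u<n ku lo≤ ≤hi = ≤-antisym
      (≤-trans (strip-mono (n + n) ≤hi) (*-cancelʳ-≤ _ _ H {{H>0 u<n}} (+-cancelˡ-≤ (lo u) _ _ (≤ᵇ-true⇒≤ ku))))
      (strip-mono (n + n) lo≤)

    dropped-strip : ∀ {u} → kept u ≡ false → strip (n + n) (minx u) < strip (n + n) (maxx u)
    dropped-strip {u} ku = *-cancelʳ-< H _ _ (+-cancelˡ-< (lo u) _ _ (≤ᵇ-false⇒> ku))

    -- The common form of both modes. A mark is a grid-point, or a grid-edge given by a point and a
    -- direction; `exclusive` says that within an independent set it belongs to one vertex only.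
    module _ (A : ℕ → ℕ → Bool) (dirs : List Bool) (Mark : ℕ → Point → Bool → Set)
      (mark-column : ∀ {s x y d} → s < n → Mark s (x , y) d → minx s ≤ x × x ≤ maxx s)
      (marked : ∀ {s t r} → s < n → t < n → A s t ≡ true → lo s ≤ r → r ≤ lo t → ∃[ x ] ∃[ d ] (d ∈ dirs × Mark s (x , r) d))
      (exclusive : ∀ {s t p d} → s < n → t < n → Mark s p d → Mark t p d → A s t ≡ false → s ≡ t)
      (common : ∀ {s t} → s < n → t < n → A s t ≡ true → ∃[ x ] (minx s ≤ x × x ≤ maxx s × minx t ≤ x × x ≤ maxx t)) where

      -- The digits of θ in base `H` are a strip and a row. A front vertex and its neighbour beyond
      -- θ share a column, hence a strip, and θ lies between their keys, so the first path has a
      -- mark in that row. A slot records the phase of the window of this mark, the offset in the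
      -- window, and the direction.
      narrow : o < k → Available.Narrow n A kept (k * (c * length dirs)) key
      narrow o<k θ xs unique props indep = ≤-trans
          (pigeonhole R xs slots unique assign injective)
          (≤-reflexive (trans (length-cartesianProductWith _,_ (upTo k) _)
            (cong₂ _*_ (length-upTo k) (trans (length-cartesianProductWith _,_ (upTo c) dirs) (cong (_* length dirs) (length-upTo c))))))
        where
        slots : List (ℕ × ℕ × Bool)
        slots = cartesianProduct (upTo k) (cartesianProduct (upTo c) dirs)
        a : ℕ → ℕ
        a s = strip (n + n) (minx s)

        record R (s : ℕ) (slot : ℕ × ℕ × Bool) : Set where
          field
            s∈xs   : s ∈ xs
            r j    : ℕ
            r<H    : r < H
            θ≡     : θ ≡ r + a s * H
            phase≡ : proj₁ slot ≡ phase (suc j)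
            strip≡ : a s ≡ actives (suc j)
            mark   : Mark s (cutAt j + proj₁ (proj₂ slot) , r) (proj₂ (proj₂ slot))

        assign : ∀ {s} → s ∈ xs → ∃[ slot ] (slot ∈ slots × R s slot)
        assign {s} s∈ with props s∈
        ... | s<n , Ks , key≤θ , t , t<n , Kt , Ast , θ≤key with common s<n t<n Ast
        ...   | x₀ , s≤x₀ , x₀≤s , t≤x₀ , x₀≤t with marked {r = r} s<n t<n Ast lo≤r r≤lo
          where
          same-strip : a s ≡ a t
          same-strip = trans (sym (kept-strip s<n Ks s≤x₀ x₀≤s)) (kept-strip t<n Kt t≤x₀ x₀≤t)
          -- The low digit of θ. Both keys have the same high digit, so removing it leaves the row
          -- between the lowest rows of the two paths.
          r = θ ∸ a s * H
          lo≤r : lo s ≤ r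
          lo≤r = ≤-trans (≤-reflexive (sym (m+n∸n≡m (lo s) (a s * H)))) (∸-monoˡ-≤ (a s * H) key≤θ)
          r≤lo : r ≤ lo t
          r≤lo = ≤-trans (∸-monoˡ-≤ (a s * H) θ≤key) (≤-reflexive (trans (cong (λ z → lo t + a t * H ∸ z * H) same-strip) (m+n∸n≡m (lo t) (a t * H))))
        ...     | x , d , d∈ , mark with mark-column s<n mark
        ...       | s≤x , x≤s with covered (s , s<n , s≤x , x≤s)
        ...         | j , e , j< , e<c , refl = (phase (suc j) , e , d) ,
                        ∈-cartesianProduct⁺ (∈-upTo⁺ (phase<k o<k (suc j))) (∈-cartesianProduct⁺ (∈-upTo⁺ e<c) d∈) ,
                        record
                          { s∈xs = s∈; r = θ ∸ a s * H; j = j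
                          ; r<H = ≤-<-trans (≤-trans (∸-monoˡ-≤ (a s * H) θ≤key) (≤-reflexive (trans (cong (λ z → lo t + a t * H ∸ z * H)
                              (trans (sym (kept-strip s<n Ks s≤x₀ x₀≤s)) (kept-strip t<n Kt t≤x₀ x₀≤t))) (m+n∸n≡m (lo t) (a t * H))))) (lo<H t t<n)
                          ; θ≡ = sym (m∸n+n≡m (≤-trans (m≤n+m (a s * H) (lo s)) key≤θ))
                          ; phase≡ = refl
                          ; strip≡ = trans (sym (kept-strip s<n Ks s≤x x≤s)) (strip-cut j< e<c)
                          ; mark = mark }

        injective : ∀ {s s′ slot} → R s slot → R s′ slot → s ≡ s′
        injective {s} {s′} {φ , e , d} p q = exclusive (proj₁ (props P.s∈xs)) (proj₁ (props Q.s∈xs)) P.mark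
            (subst₂ (λ j r → Mark s′ (cutAt j + e , r) d) (sym j≡) (sym r≡) Q.mark) (indep P.s∈xs Q.s∈xs)
          where
          module P = R p
          module Q = R q
          a≡ : a s ≡ a s′
          -- Both fronts decompose the same θ with rows below `H`, so strip and row agree; the equal
          -- phase then forces the same window, and the two marks coincide.
          a≡ = digits-injective (a s) (a s′) P.r<H Q.r<H (trans (sym P.θ≡) Q.θ≡)
          r≡ : P.r ≡ Q.r
          r≡ = +-cancelʳ-≡ (a s * H) _ _ (trans (sym P.θ≡) (trans Q.θ≡ (cong (λ z → Q.r + z * H) (sym a≡))))
          j≡ : P.j ≡ Q.j
          j≡ = same-phase (trans (sym P.strip≡) (trans a≡ Q.strip≡)) (trans (sym P.phase≡) Q.phase≡)

  open Keys n k H minx maxx lo cutAt using (kept; phase)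

  -- One step of the countdown permutes the numbers below k, so distinct offsets stay distinct. In
  -- particular a cut is in use for at most one offset.
  phase-injective : ∀ {o o′} → o < k → o′ < k → ∀ i → phase o i ≡ phase o′ i → o ≡ o′
  phase-injective o<k o′<k zero eq = eq
  phase-injective {o} {o′} o<k o′<k (suc i) eq
    with phase o i | phase o′ i | phase-injective o<k o′<k i | Phases.phase<k n k H minx maxx lo cutAt o o<k i | Phases.phase<k n k H minx maxx lo cutAt o′ o′<k i
  ... | zero  | zero  | ih | _ | _ = ih refl
  ... | suc p | suc q | ih | _ | _ = ih (cong suc eq)
  ... | zero  | suc q | _ | _ | q< = contradiction (sym eq) (<⇒≢ (∸-monoˡ-≤ 1 q<))
  ... | suc p | zero  | _ | p< | _ = contradiction eq (<⇒≢ (∸-monoˡ-≤ 1 p<))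

  -- Two distinct cuts to the right of `minx u` and not beyond `maxx u` would make the path longer
  -- than c. So the crossed cut is the same for both offsets, and it is in use for one only.
  dropped-once : ∀ {o o′ u} → o < k → o′ < k → u < n → kept o u ≡ false → kept o′ u ≡ false → o ≡ o′
  dropped-once {o} {o′} {u} o<k o′<k u<n d d′
    with Phases.crossing n k H minx maxx lo cutAt o (n + n) (dropped-strip o d) | Phases.crossing n k H minx maxx lo cutAt o′ (n + n) (dropped-strip o′ d′)
  ... | i , _ , act , lt , le | i′ , _ , act′ , lt′ , le′ =
    phase-injective o<k o′<k i (trans (n≤0⇒n≡0 (≤ᵇ-true⇒≤ act))
      (sym (n≤0⇒n≡0 (≤ᵇ-true⇒≤ (subst (λ j → (phase o′ j ≤ᵇ 0) ≡ true) (sym i≡i′) act′)))))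
    where
    apart : ∀ {i i′} → i < i′ → minx u < cutAt i → cutAt i′ ≤ maxx u → ⊥
    apart {i} {i′} i<i′ lt le = <⇒≱ (<-≤-trans (+-monoˡ-< c lt) (≤-trans (cut-far i<i′) le)) (short u u<n)
    i≡i′ : i ≡ i′
    i≡i′ with <-cmp i i′
    ... | tri< i<i′ _ _ = ⊥-elim (apart i<i′ lt le′)
    ... | tri≈ _ eq _ = eq
    ... | tri> _ _ i>i′ = ⊥-elim (apart i>i′ lt′ le)

-- Geometry of grid paths

scanMin≤ : ∀ f a ps → scanMin f a ps ≤ a × (∀ {p} → p ∈ ps → scanMin f a ps ≤ f p)
scanMin≤ f a [] = ≤-refl , λ ()
scanMin≤ f a (q ∷ ps) with scanMin≤ f (a ∸ (a ∸ f q)) ps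
... | ≤a , ≤ps = ≤-trans ≤a (min-formula≤ˡ a (f q)) , λ { (here refl) → ≤-trans ≤a (min-formula≤ʳ a (f q)) ; (there p∈) → ≤ps p∈ }

scanMin-attained : ∀ f a ps → scanMin f a ps ≡ a ⊎ ∃[ p ] (p ∈ ps × scanMin f a ps ≡ f p)
scanMin-attained f a [] = inj₁ refl
scanMin-attained f a (q ∷ ps) with scanMin-attained f (a ∸ (a ∸ f q)) ps | min-formula a (f q)
... | inj₂ (p , p∈ , eq) | _ = inj₂ (p , there p∈ , eq)
... | inj₁ eq | inj₁ (_ , eq′) = inj₂ (q , here refl , trans eq eq′)
... | inj₁ eq | inj₂ (_ , eq′) = inj₁ (trans eq eq′)

max-formula : ∀ a b → (a ≤ b × a + (b ∸ a) ≡ b) ⊎ (b ≤ a × a + (b ∸ a) ≡ a)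
max-formula a b with ≤-total a b
... | inj₁ a≤b = inj₁ (a≤b , m+[n∸m]≡n a≤b)
... | inj₂ b≤a = inj₂ (b≤a , trans (cong (a +_) (m≤n⇒m∸n≡0 b≤a)) (+-identityʳ a))

scanMax≥ : ∀ f a ps → a ≤ scanMax f a ps × (∀ {p} → p ∈ ps → f p ≤ scanMax f a ps)
scanMax≥ f a [] = ≤-refl , λ ()
scanMax≥ f a (q ∷ ps) with scanMax≥ f (a + (f q ∸ a)) ps
... | ≥a , ≥ps = ≤-trans (m≤m+n a _) ≥a , λ { (here refl) → ≤-trans (m≤n+m∸n (f q) a) ≥a ; (there p∈) → ≥ps p∈ }

scanMax-attained : ∀ f a ps → scanMax f a ps ≡ a ⊎ ∃[ p ] (p ∈ ps × scanMax f a ps ≡ f p)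
scanMax-attained f a [] = inj₁ refl
scanMax-attained f a (q ∷ ps) with scanMax-attained f (a + (f q ∸ a)) ps | max-formula a (f q)
... | inj₂ (p , p∈ , eq) | _ = inj₂ (p , there p∈ , eq)
... | inj₁ eq | inj₁ (_ , eq′) = inj₂ (q , here refl , trans eq eq′)
... | inj₁ eq | inj₂ (_ , eq′) = inj₁ (trans eq eq′)

lowest≤ : ∀ f {p ps} → p ∈ ps → lowest f ps ≤ f p
lowest≤ f {ps = q ∷ ps} p∈ = proj₂ (scanMin≤ f (f q) (q ∷ ps)) p∈

≤highest : ∀ f {p ps} → p ∈ ps → f p ≤ highest f ps
≤highest f {ps = q ∷ ps} p∈ = proj₂ (scanMax≥ f (f q) (q ∷ ps)) p∈

lowest-attained : ∀ f q ps → ∃[ p ] (p ∈ q ∷ ps × lowest f (q ∷ ps) ≡ f p)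
lowest-attained f q ps with scanMin-attained f (f q) (q ∷ ps)
... | inj₁ eq = q , here refl , eq
... | inj₂ found = found

highest-attained : ∀ f q ps → ∃[ p ] (p ∈ q ∷ ps × highest f (q ∷ ps) ≡ f p)
highest-attained f q ps with scanMax-attained f (f q) (q ∷ ps)
... | inj₁ eq = q , here refl , eq
... | inj₂ found = found

Unit : ℕ → ℕ → Set
Unit a b = b ≡ suc a ⊎ a ≡ suc b

Step : ℕ → ℕ → ℕ → ℕ → Set
Step x y x′ y′ = (x ≡ x′ × Unit y y′) ⊎ (y ≡ y′ × Unit x x′)

distance-one : ∀ a b → ∣ a - b ∣ ≡ 1 → Unit a b
distance-one zero    b       eq = inj₁ eq
distance-one (suc a) zero    eq = inj₂ eq
distance-one (suc a) (suc b) eq with distance-one a b eq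
... | inj₁ e = inj₁ (cong suc e)
... | inj₂ e = inj₂ (cong suc e)

adjacent-step : ∀ {x y x′ y′} → GridAdjacent (x , y) (x′ , y′) → Step x y x′ y′
adjacent-step {x} {y} {x′} {y′} eq with ∣ x - x′ ∣ in dx
... | zero = inj₁ (∣m-n∣≡0⇒m≡n dx , distance-one y y′ eq)
... | suc zero = inj₂ (∣m-n∣≡0⇒m≡n (suc-injective eq) , distance-one x x′ dx)

-- Two unit steps without a turn run along one axis, and distinct ends exclude a reversal. Only x is
-- followed here; `straight₂` obtains y by exchanging the axes.
straight-step : ∀ {x y x′ y′ x″ y″} → Step x y x′ y′ → Step x′ y′ x″ y″ → x ≡ x″ ⊎ y ≡ y″ → ¬ (x ≡ x″ × y ≡ y″) →
                (x < x′ → x′ < x″) × (x′ < x → x″ < x′)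
straight-step (inj₁ (refl , _)) _ _ _ = (λ lt → contradiction lt (<-irrefl refl)) , (λ lt → contradiction lt (<-irrefl refl))
straight-step {x} (inj₂ (refl , inj₁ refl)) (inj₁ (refl , unit)) straight _ = ⊥-elim (bad straight unit)
  where
  bad : ∀ {y y″} → x ≡ suc x ⊎ y ≡ y″ → Unit y y″ → ⊥
  bad (inj₂ refl) (inj₁ ())
  bad (inj₂ refl) (inj₂ ())
straight-step {x} (inj₂ (refl , inj₁ refl)) (inj₂ (refl , inj₁ refl)) _ _ =
  (λ _ → n<1+n _) , (λ lt → contradiction (≤-trans (n≤1+n _) lt) (<-irrefl refl))
straight-step (inj₂ (refl , inj₁ refl)) (inj₂ (refl , inj₂ refl)) _ back = contradiction (refl , refl) back
straight-step {x′ = x′} (inj₂ (refl , inj₂ refl)) (inj₁ (refl , unit)) straight _ = ⊥-elim (bad straight unit)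
  where
  bad : ∀ {y y″} → suc x′ ≡ x′ ⊎ y ≡ y″ → Unit y y″ → ⊥
  bad (inj₂ refl) (inj₁ ())
  bad (inj₂ refl) (inj₂ ())
straight-step (inj₂ (refl , inj₂ refl)) (inj₂ (refl , inj₂ refl)) _ _ =
  (λ lt → contradiction (≤-trans (n≤1+n _) lt) (<-irrefl refl)) , (λ _ → n<1+n _)
straight-step (inj₂ (refl , inj₂ refl)) (inj₂ (refl , inj₁ refl)) _ back = contradiction (refl , refl) back

no-turn : ∀ p r → isTurn p r ≡ false → proj₁ p ≡ proj₁ r ⊎ proj₂ p ≡ proj₂ r
no-turn (x , y) (x″ , y″) eq with x ≡ᵇ x″ in ex | y ≡ᵇ y″ in ey
... | true  | _    = inj₁ (≡ᵇ-true⇒≡ ex)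
... | false | true = inj₂ (≡ᵇ-true⇒≡ {y} ey)

Straight : (Point → ℕ) → Set
Straight f = ∀ {p q r} → GridAdjacent p q → GridAdjacent q r → isTurn p r ≡ false → p ≢ r →
             (f p < f q → f q < f r) × (f q < f p → f r < f q)

straight₁ : Straight proj₁
straight₁ {p} {q} {r} pq qr nt p≢r = straight-step (adjacent-step pq) (adjacent-step qr) (no-turn p r nt) λ { (refl , refl) → p≢r refl }

straight₂ : Straight proj₂
straight₂ {p} {q} {r} pq qr nt p≢r = straight-step (swap (adjacent-step pq)) (swap (adjacent-step qr)) (swap (no-turn p r nt)) λ { (refl , refl) → p≢r refl }

lastOf : Point → List Point → Point
lastOf p []       = p
lastOf p (q ∷ ps) = lastOf q ps

last≡lastOf : ∀ p ps → List⁺.last (p ∷ ps) ≡ lastOf p ps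
last≡lastOf p ps with initLast ps
... | [] = refl
... | xs ∷ʳ′ y = sym (snoc p xs)
  where
  snoc : ∀ p xs → lastOf p (xs ++ y ∷ []) ≡ y
  snoc p []       = refl
  snoc p (x ∷ xs) = snoc x xs

lastOf∈ : ∀ p ps → lastOf p ps ∈ p ∷ ps
lastOf∈ p []       = here refl
lastOf∈ p (q ∷ ps) = there (lastOf∈ q ps)

turningPoints⊆ : ∀ ps {q} → q ∈ turningPoints ps → q ∈ ps
turningPoints⊆ (p ∷ q ∷ r ∷ ps) {z} t∈ with isTurn p r | turningPoints⊆ (q ∷ r ∷ ps) {z}
turningPoints⊆ (p ∷ q ∷ r ∷ ps) (here refl) | true  | _   = there (here refl)
turningPoints⊆ (p ∷ q ∷ r ∷ ps) (there t∈)  | true  | rec = there (rec t∈)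
turningPoints⊆ (p ∷ q ∷ r ∷ ps) t∈          | false | rec = there (rec t∈)

module Hull (f : Point → ℕ) (straight : Straight f) where

  Between : Point → Point → Point → Set
  Between p q e = (f p ≤ f q × f q ≤ f e) ⊎ (f e ≤ f q × f q ≤ f p)

  later : Point → Point → List Point → List Point
  later p q ps = turningPoints (p ∷ q ∷ ps) ++ lastOf q ps ∷ []

  later⊆ : ∀ p q r ps {e} → e ∈ later q r ps → e ∈ later p q (r ∷ ps)
  later⊆ p q r ps e∈ with isTurn p r
  ... | true  = there e∈
  ... | false = e∈

  -- Between two consecutive corners a path is straight.
  next-corner : ∀ p q ps → Linked GridAdjacent (p ∷ q ∷ ps) → Unique (p ∷ q ∷ ps) → ∃[ e ] (e ∈ later p q ps × Between p q e)
  next-corner p q [] _ _ = q , here refl , both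
    where
    both : Between p q q
    both with ≤-total (f p) (f q)
    ... | inj₁ le = inj₁ (le , ≤-refl)
    ... | inj₂ ge = inj₂ (≤-refl , ge)
  next-corner p q (r ∷ ps) (pq ∷ qr ∷ linked) ((_ ∷ p≢r ∷ _) ∷ unique) with isTurn p r in turn
  ... | true = q , here refl , both
    where
    both : Between p q q
    both with ≤-total (f p) (f q)
    ... | inj₁ le = inj₁ (le , ≤-refl)
    ... | inj₂ ge = inj₂ (≤-refl , ge)
  ... | false with next-corner q r ps (qr ∷ linked) unique
  ...   | e , e∈ , qre = e , e∈ , extend (<-cmp (f p) (f q)) qre
    where
    extend : _ → Between q r e → Between p q e
    extend (tri≈ _ eq _) _ with ≤-total (f q) (f e)
    ... | inj₁ le = inj₁ (≤-reflexive eq , le)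
    ... | inj₂ ge = inj₂ (ge , ≤-reflexive (sym eq))
    extend (tri< lt _ _) (inj₁ (qr≤ , re≤)) = inj₁ (<⇒≤ lt , ≤-trans qr≤ re≤)
    extend (tri< lt _ _) (inj₂ (_ , rq≤)) = contradiction rq≤ (<⇒≱ (proj₁ (straight pq qr turn p≢r) lt))
    extend (tri> _ _ gt) (inj₁ (qr≤ , _)) = contradiction qr≤ (<⇒≱ (proj₂ (straight pq qr turn p≢r) gt))
    extend (tri> _ _ gt) (inj₂ (er≤ , rq≤)) = inj₂ (≤-trans er≤ rq≤ , <⇒≤ gt)

  -- The encoded corners attain the extremes of the whole path. When the first point is removed, its
  -- successor q becomes a corner of the rest although it may be none of the path; `next-corner`
  -- then replaces it by p or by the next true corner, whichever is more extreme.
  hull : ∀ p ps → Linked GridAdjacent (p ∷ ps) → Unique (p ∷ ps) → ∀ {z} → z ∈ p ∷ ps →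
         ∃[ a ] ∃[ b ] (a ∈ p ∷ turningPoints (p ∷ ps) ++ lastOf p ps ∷ [] × b ∈ p ∷ turningPoints (p ∷ ps) ++ lastOf p ps ∷ [] ×
                        f a ≤ f z × f z ≤ f b)
  hull p ps _ _ (here refl) = p , p , here refl , here refl , ≤-refl , ≤-refl
  hull p (q ∷ ps) (pq ∷ linked) (p∉ ∷ unique) (there z∈) with hull q ps linked unique z∈ | next-corner p q ps (pq ∷ linked) (p∉ ∷ unique)
  ... | a , b , a∈ , b∈ , fa≤ , ≤fb | e , e∈ , between =
    let a′ , a′∈ , ≤a = lower a∈ between; b′ , b′∈ , b≤ = upper b∈ between
    in a′ , b′ , a′∈ , b′∈ , ≤-trans ≤a fa≤ , ≤-trans ≤fb b≤
    where
    weaken′ : ∀ {a} ps → a ∈ turningPoints (q ∷ ps) ++ lastOf q ps ∷ [] → a ∈ p ∷ later p q ps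
    weaken′ []       (here refl) = there (here refl)
    weaken′ (r ∷ ps) a∈ = there (later⊆ p q r ps a∈)
    lower : ∀ {a} → a ∈ q ∷ turningPoints (q ∷ ps) ++ lastOf q ps ∷ [] → Between p q e → ∃[ a′ ] (a′ ∈ p ∷ later p q ps × f a′ ≤ f a)
    lower (there a∈) _ = _ , weaken′ ps a∈ , ≤-refl
    lower (here refl) (inj₁ (le , _)) = p , here refl , le
    lower (here refl) (inj₂ (le , _)) = e , there e∈ , le
    upper : ∀ {b} → b ∈ q ∷ turningPoints (q ∷ ps) ++ lastOf q ps ∷ [] → Between p q e → ∃[ b′ ] (b′ ∈ p ∷ later p q ps × f b ≤ f b′)
    upper (there b∈) _ = _ , weaken′ ps b∈ , ≤-refl
    upper (here refl) (inj₁ (_ , le)) = e , there e∈ , le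
    upper (here refl) (inj₂ (_ , le)) = p , here refl , le

steps : List Point → List (Point × Point)
steps ps = zip ps (drop 1 ps)

steps-points : ∀ ps {p q} → Linked GridAdjacent ps → (p , q) ∈ steps ps → p ∈ ps × q ∈ ps × GridAdjacent p q
steps-points (p ∷ q ∷ ps) (pq ∷ _) (here refl) = here refl , there (here refl) , pq
steps-points (p ∷ q ∷ ps) (_ ∷ linked) (there e∈) with steps-points (q ∷ ps) linked e∈
... | p∈ , q∈ , adj = there p∈ , there q∈ , adj

-- A discrete intermediate value theorem: the row changes by at most one per step, so passing from
-- row r or below to above r uses an edge between rows r and r + 1.
climb : ∀ {r} h t → Linked GridAdjacent (h ∷ t) → proj₂ h ≤ r → ∀ {z} → z ∈ h ∷ t → r < proj₂ z →
        ∃[ x ] ((x , r) , (x , suc r)) ∈ steps (h ∷ t)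
climb h t _ h≤r (here refl) r<z = contradiction h≤r (<⇒≱ r<z)
climb {r} (x , y) ((x′ , y′) ∷ t) (adj ∷ linked) h≤r (there z∈) r<z with y′ ≤? r
... | yes y′≤r = let x , e∈ = climb (x′ , y′) t linked y′≤r z∈ r<z in x , there e∈
... | no y′≰r with adjacent-step {x} {y} {x′} {y′} adj
...   | inj₁ (refl , inj₁ refl) with ≤-antisym h≤r (≤-pred (≰⇒> y′≰r))
...     | refl = x , here refl
climb {r} (x , y) ((x′ , y′) ∷ t) (adj ∷ linked) h≤r (there z∈) r<z | no y′≰r | inj₁ (refl , inj₂ refl) =
  contradiction (≤-trans (n≤1+n y′) h≤r) y′≰r
climb {r} (x , y) ((x′ , y′) ∷ t) (adj ∷ linked) h≤r (there z∈) r<z | no y′≰r | inj₂ (refl , _) = contradiction h≤r y′≰r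

descend : ∀ {r} h t → Linked GridAdjacent (h ∷ t) → r < proj₂ h → ∀ {z} → z ∈ h ∷ t → proj₂ z ≤ r →
          ∃[ x ] ((x , suc r) , (x , r)) ∈ steps (h ∷ t)
descend h t _ r<h (here refl) z≤r = contradiction z≤r (<⇒≱ r<h)
descend {r} (x , y) ((x′ , y′) ∷ t) (adj ∷ linked) r<h (there z∈) z≤r with r <? y′
... | yes r<y′ = let x , e∈ = descend (x′ , y′) t linked r<y′ z∈ z≤r in x , there e∈
... | no r≮y′ with adjacent-step {x} {y} {x′} {y′} adj
...   | inj₁ (refl , inj₂ refl) with ≤-antisym (≮⇒≥ r≮y′) (≤-pred r<h)
...     | refl = x , here refl
descend {r} (x , y) ((x′ , y′) ∷ t) (adj ∷ linked) r<h (there z∈) z≤r | no r≮y′ | inj₁ (refl , inj₁ refl) =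
  contradiction (≤-trans r<h (n≤1+n y)) r≮y′
descend {r} (x , y) ((x′ , y′) ∷ t) (adj ∷ linked) r<h (there z∈) z≤r | no r≮y′ | inj₂ (refl , _) = contradiction r<h r≮y′

module PathFacts {𝒢 : Grid} (P : GridPath 𝒢) where

  open GridPath P using (linked; simple; onGrid)
  open Grid 𝒢

  corners : List Point
  corners = start P ∷ bendPoints P ++ end P ∷ []

  private
    h = List⁺.head (GridPath.points⁺ P)
    t = List⁺.tail (GridPath.points⁺ P)

  corners≡ : corners ≡ h ∷ turningPoints (h ∷ t) ++ lastOf h t ∷ []
  corners≡ = cong (λ e → h ∷ turningPoints (h ∷ t) ++ e ∷ []) (last≡lastOf h t)

  corner∈points : ∀ {z} → z ∈ corners → z ∈ points P
  corner∈points {z} z∈ with subst (z ∈_) corners≡ z∈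
  ... | here refl = here refl
  ... | there z∈′ with ∈-++⁻ (turningPoints (h ∷ t)) z∈′
  ...   | inj₁ t∈ = turningPoints⊆ (h ∷ t) t∈
  ...   | inj₂ (here refl) = lastOf∈ h t

  hull : ∀ f → Straight f → ∀ {z} → z ∈ points P → lowest f corners ≤ f z × f z ≤ highest f corners
  hull f straight z∈ with Hull.hull f straight h t linked simple z∈
  ... | a , b , a∈ , b∈ , fa≤ , ≤fb =
    ≤-trans (lowest≤ f (subst (a ∈_) (sym corners≡) a∈)) fa≤ , ≤-trans ≤fb (≤highest f (subst (b ∈_) (sym corners≡) b∈))

  lowest∈ : ∀ f → ∃[ p ] (p ∈ points P × lowest f corners ≡ f p)
  lowest∈ f = let p , p∈ , eq = lowest-attained f (start P) _ in p , corner∈points p∈ , eq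

  highest∈ : ∀ f → ∃[ p ] (p ∈ points P × highest f corners ≡ f p)
  highest∈ f = let p , p∈ , eq = highest-attained f (start P) _ in p , corner∈points p∈ , eq

  lowest≤highest : lowest proj₁ corners ≤ highest proj₁ corners
  lowest≤highest = ≤-trans (lowest≤ proj₁ {start P} {corners} (here refl)) (≤highest proj₁ {start P} {corners} (here refl))

  highest≤ : ∀ {c} → horizontalLength P ≤ c → highest proj₁ corners ≤ lowest proj₁ corners + c
  highest≤ {c} len≤ = let a , a∈ , eqa = lowest∈ proj₁; b , b∈ , eqb = highest∈ proj₁ in
    subst₂ (λ lo hi → hi ≤ lo + c) (sym eqa) (sym eqb)
      (spread (All.lookup (Extrema.min≤xs (proj₁ (start P)) (map proj₁ (points P))) (∈-map⁺ proj₁ a∈))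
              (All.lookup (Extrema.xs≤max (proj₁ (start P)) (map proj₁ (points P))) (∈-map⁺ proj₁ b∈)) len≤)
    where
    spread : ∀ {a b lo hi} → lo ≤ a → b ≤ hi → hi ∸ lo ≤ c → b ≤ a + c
    spread {lo = lo} {hi} lo≤ ≤hi len≤ = ≤-trans ≤hi (≤-trans (m≤n+m∸n hi lo) (+-mono-≤ lo≤ len≤))

  lowest₁<width : lowest proj₁ corners < width
  lowest₁<width = let p , p∈ , eq = lowest∈ proj₁ in subst (_< width) (sym eq) (proj₁ (All.lookup onGrid p∈))

  lowest₂<height : lowest proj₂ corners < height
  lowest₂<height = let p , p∈ , eq = lowest∈ proj₂ in subst (_< height) (sym eq) (proj₂ (All.lookup onGrid p∈))

  -- The order of a and b on the path is unknown, but only the row of the starting point matters: it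
  -- decides whether the path must climb to b or descend to a.
  crossing-edge : ∀ {r a b} → a ∈ points P → proj₂ a ≤ r → b ∈ points P → r < proj₂ b →
                  ∃[ x ] (((x , r) , (x , suc r)) onEdgesOf P)
  crossing-edge {r} a∈ a≤r b∈ r<b with proj₂ h ≤? r
  ... | yes h≤r = let x , e∈ = climb h t linked h≤r b∈ r<b in x , inj₁ e∈
  ... | no h≰r = let x , e∈ = descend h t linked (≰⇒> h≰r) a∈ a≤r in x , inj₂ e∈

  edge-points : ∀ {p q} → (p , q) onEdgesOf P → p ∈ points P × q ∈ points P
  edge-points (inj₁ e∈) = let p∈ , q∈ , _ = steps-points (points P) linked e∈ in p∈ , q∈
  edge-points (inj₂ e∈) = let q∈ , p∈ , _ = steps-points (points P) linked e∈ in p∈ , q∈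

  row-point : ∀ {r b} → lowest proj₂ corners ≤ r → b ∈ points P → r ≤ proj₂ b → ∃[ x ] ((x , r) ∈ points P)
  row-point {r} {x , y} lo≤ b∈ r≤b with m≤n⇒m<n∨m≡n r≤b | lowest∈ proj₂
  ... | inj₂ refl | _ = x , b∈
  ... | inj₁ r<b | a , a∈ , eq = let x , e = crossing-edge a∈ (≤-trans (≤-reflexive (sym eq)) lo≤) b∈ r<b in x , proj₁ (edge-points e)

  edgeAt : Point → Bool → Point × Point
  edgeAt (x , y) true  = (x , y) , (x , suc y)
  edgeAt (x , y) false = (x , y) , (suc x , y)

  -- If an end of the given edge lies above row r, the path also has a point at or below r and hence
  -- an edge going up from that row. Otherwise the given edge lies in row r and points to the right
  -- from one of its ends. Two directions therefore suffice.
  row-edge : ∀ {r p q} → lowest proj₂ corners ≤ r → (p , q) onEdgesOf P → r ≤ proj₂ p → r ≤ proj₂ q →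
             ∃[ x ] ∃[ d ] (edgeAt (x , r) d onEdgesOf P)
  row-edge {r} {x , y} {x′ , y′} lo≤ e r≤p r≤q with m≤n⇒m<n∨m≡n r≤p | m≤n⇒m<n∨m≡n r≤q | lowest∈ proj₂
  ... | inj₁ r<p | _ | a , a∈ , eq = let x , e′ = crossing-edge a∈ (≤-trans (≤-reflexive (sym eq)) lo≤) (proj₁ (edge-points e)) r<p in x , true , e′
  ... | inj₂ _ | inj₁ r<q | a , a∈ , eq = let x , e′ = crossing-edge a∈ (≤-trans (≤-reflexive (sym eq)) lo≤) (proj₂ (edge-points e)) r<q in x , true , e′
  ... | inj₂ refl | inj₂ refl | _ = horizontal e (unit e)
    where
    unit : ((x , r) , (x′ , r)) onEdgesOf P → Unit x x′
    unit (inj₁ e∈) = level (adjacent-step (proj₂ (proj₂ (steps-points (points P) linked e∈))))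
      where
      level : ∀ {x x′} → Step x r x′ r → Unit x x′
      level (inj₁ (_ , inj₁ ()))
      level (inj₁ (_ , inj₂ ()))
      level (inj₂ (_ , u)) = u
    unit (inj₂ e∈) = swap (level (adjacent-step (proj₂ (proj₂ (steps-points (points P) linked e∈)))))
      where
      level : ∀ {x x′} → Step x r x′ r → Unit x x′
      level (inj₁ (_ , inj₁ ()))
      level (inj₁ (_ , inj₂ ()))
      level (inj₂ (_ , u)) = u
    horizontal : ((x , r) , (x′ , r)) onEdgesOf P → Unit x x′ → ∃[ x ] ∃[ d ] (edgeAt (x , r) d onEdgesOf P)
    horizontal e (inj₁ refl) = x , false , e
    horizontal e (inj₂ refl) = x′ , false , swap e

-- From the instance to vertices and coordinates in the natural numbers

ext : {A : Set} → A → ∀ {n} → (Fin n → A) → ℕ → A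
ext d {zero}  f i       = d
ext d {suc n} f zero    = f zero
ext d {suc n} f (suc i) = ext d (f ∘ suc) i

ext-toℕ : ∀ {A : Set} (d : A) {n} (f : Fin n → A) u → ext d f (toℕ u) ≡ f u
ext-toℕ d f zero    = refl
ext-toℕ d f (suc u) = ext-toℕ d (f ∘ suc) u

ext-outside : ∀ {A : Set} (d : A) {n} (f : Fin n → A) {i} → n ≤ i → ext d f i ≡ d
ext-outside d {zero}  f         _        = refl
ext-outside d {suc n} f {suc i} (s≤s le) = ext-outside d (f ∘ suc) le

index : ∀ {n s} → s < n → ∃[ u ] (s ≡ toℕ {n} u)
index s<n = fromℕ< s<n , sym (Finₚ.toℕ-fromℕ< s<n)

forFin : ∀ {n} (P : ℕ → Set) → (∀ (u : Fin n) → P (toℕ u)) → ∀ s → s < n → P s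
forFin P f s s<n = subst P (Finₚ.toℕ-fromℕ< s<n) (f (fromℕ< s<n))

module _ {n : ℕ} (G : Graph n) where

  -- The default `false` outside the vertex set makes symmetry and irreflexivity hold for all
  -- naturals, free of side conditions.
  adjℕ : ℕ → ℕ → Bool
  adjℕ s t = ext false (λ u → ext false (adj G u) t) s

  adjℕ-toℕ : ∀ u v → adjℕ (toℕ u) (toℕ v) ≡ adj G u v
  adjℕ-toℕ u v = trans (ext-toℕ false (λ u → ext false (adj G u) (toℕ v)) u) (ext-toℕ false (adj G u) v)

  adjℕ-left : ∀ {s t} → n ≤ s → adjℕ s t ≡ false
  adjℕ-left {t = t} le = ext-outside false (λ u → ext false (adj G u) t) le

  adjℕ-right : ∀ {s t} → n ≤ t → adjℕ s t ≡ false
  adjℕ-right {s} {t} le with s <? n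
  ... | no s≮n = adjℕ-left (≮⇒≥ s≮n)
  ... | yes s<n with index s<n
  ...   | u , refl = trans (ext-toℕ false (λ u → ext false (adj G u) t) u) (ext-outside false (adj G u) le)

  adjℕ-symmetric : Symmetric adjℕ
  adjℕ-symmetric = record { symmetric = symmetric; irreflexive = irreflexive }
    where
    symmetric : ∀ s t → adjℕ s t ≡ adjℕ t s
    symmetric s t with s <? n | t <? n
    ... | no s≮n | _ = trans (adjℕ-left (≮⇒≥ s≮n)) (sym (adjℕ-right {t} (≮⇒≥ s≮n)))
    ... | yes _ | no t≮n = trans (adjℕ-right {s} (≮⇒≥ t≮n)) (sym (adjℕ-left (≮⇒≥ t≮n)))
    ... | yes s<n | yes t<n with index s<n | index t<n
    ...   | u , refl | v , refl = trans (adjℕ-toℕ u v) (trans (adj-sym G u v) (sym (adjℕ-toℕ v u)))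
    irreflexive : ∀ s → adjℕ s s ≡ false
    irreflexive s with s <? n
    ... | no s≮n = adjℕ-left (≮⇒≥ s≮n)
    ... | yes s<n with index s<n
    ...   | u , refl = trans (adjℕ-toℕ u u) (adj-irr G u)

directions : Mode → List Bool
directions x=v = true ∷ []
directions x=e = true ∷ false ∷ []

module Geometry {n : ℕ} (I : Instance n) (k c : ℕ) (c≥1 : 1 ≤ c) (short : ∀ u → horizontalLength (path I u) ≤ c) where

  open Grid (grid I) using (width; height)
  open PathFacts using (corners)

  A : ℕ → ℕ → Bool
  A = adjℕ (graph I)

  pts : ℕ → List Point
  pts = ext [] (corners ∘ path I)

  pts-toℕ : ∀ u → pts (toℕ u) ≡ corners (path I u)
  pts-toℕ = ext-toℕ [] (corners ∘ path I)

  minx maxx lo : ℕ → ℕ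
  minx s = lowest proj₁ (pts s)
  maxx s = highest proj₁ (pts s)
  lo s   = lowest proj₂ (pts s)

  minx≤maxx : ∀ s → s < n → minx s ≤ maxx s
  minx≤maxx = forFin (λ s → minx s ≤ maxx s) λ u →
    subst (λ ps → lowest proj₁ ps ≤ highest proj₁ ps) (sym (pts-toℕ u)) (PathFacts.lowest≤highest (path I u))

  maxx≤ : ∀ s → s < n → maxx s ≤ minx s + c
  maxx≤ = forFin (λ s → maxx s ≤ minx s + c) λ u →
    subst (λ ps → highest proj₁ ps ≤ lowest proj₁ ps + c) (sym (pts-toℕ u)) (PathFacts.highest≤ (path I u) (short u))

  minx<width : ∀ s → s < n → minx s < width
  minx<width = forFin (λ s → minx s < width) λ u →
    subst (λ ps → lowest proj₁ ps < width) (sym (pts-toℕ u)) (PathFacts.lowest₁<width (path I u))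

  lo<height : ∀ s → s < n → lo s < height
  lo<height = forFin (λ s → lo s < height) λ u →
    subst (λ ps → lowest proj₂ ps < height) (sym (pts-toℕ u)) (PathFacts.lowest₂<height (path I u))

  open Strips n k height width c minx maxx lo c≥1 minx≤maxx maxx≤ minx<width lo<height public
  open Cuts n width c minx maxx using (cutAt) public

  point-column : ∀ u {z} → z ∈ points (path I u) → minx (toℕ u) ≤ proj₁ z × proj₁ z ≤ maxx (toℕ u)
  point-column u {z} z∈ = subst (λ ps → lowest proj₁ ps ≤ proj₁ z × proj₁ z ≤ highest proj₁ ps) (sym (pts-toℕ u))
    (PathFacts.hull (path I u) proj₁ straight₁ z∈)

  point-row : ∀ u {z} → z ∈ points (path I u) → lo (toℕ u) ≤ proj₂ z
  point-row u {z} z∈ = subst (λ ps → lowest proj₂ ps ≤ proj₂ z) (sym (pts-toℕ u))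
    (proj₁ (PathFacts.hull (path I u) proj₂ straight₂ z∈))

  -- The mode is a parameter of its own, so that case distinctions on it do not have to abstract
  -- over `mode I`.
  MeetsBy : Mode → Set
  MeetsBy m = ∀ u v → u ≢ v → Adjacent (graph I) u v ⇔ Meet m (path I u) (path I v)

  adjacent⇒meet : ∀ m → MeetsBy m → ∀ u v → A (toℕ u) (toℕ v) ≡ true → Meet m (path I u) (path I v)
  adjacent⇒meet m meets u v Auv = Equivalence.to (meets u v (λ { refl → true≢false adj-uv (adj-irr (graph I) u) })) adj-uv
    where
    adj-uv : Adjacent (graph I) u v
    adj-uv = trans (sym (adjℕ-toℕ (graph I) u v)) Auv

  meet⇒≡ : ∀ m → MeetsBy m → ∀ u v → Meet m (path I u) (path I v) → A (toℕ u) (toℕ v) ≡ false → u ≡ v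
  meet⇒≡ m meets u v meet Auv with u Fin.≟ v
  ... | yes u≡v = u≡v
  ... | no u≢v = contradiction (trans (sym (adjℕ-toℕ (graph I) u v)) Auv) (true≢false (Equivalence.from (meets u v u≢v) meet))

  shared-point : ∀ m u v → Meet m (path I u) (path I v) → ∃[ p ] (p ∈ points (path I u) × p ∈ points (path I v))
  shared-point x=v u v meet = meet
  shared-point x=e u v ((p , q) , on-u , on-v) = p , proj₁ (PathFacts.edge-points (path I u) on-u) , proj₁ (PathFacts.edge-points (path I v) on-v)

  Marks : Mode → Fin n → Point → Bool → Set
  Marks x=v u p d = p ∈ points (path I u)
  Marks x=e u p d = PathFacts.edgeAt (path I u) p d onEdgesOf path I u

  Mark : Mode → ℕ → Point → Bool → Set
  Mark m s p d = ∃[ u ] (toℕ u ≡ s × Marks m u p d)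

  marks-point : ∀ m u {p d} → Marks m u p d → p ∈ points (path I u)
  marks-point x=v u mk = mk
  marks-point x=e u {x , y} {true}  mk = proj₁ (PathFacts.edge-points (path I u) mk)
  marks-point x=e u {x , y} {false} mk = proj₁ (PathFacts.edge-points (path I u) mk)

  marks-meet : ∀ m u v {p d} → Marks m u p d → Marks m v p d → Meet m (path I u) (path I v)
  marks-meet x=v u v {p} mu mv = p , mu , mv
  marks-meet x=e u v {p} {true}  mu mv = _ , mu , mv
  marks-meet x=e u v {p} {false} mu mv = _ , mu , mv

  -- The path of v stays at or above row r, and so does everything it shares with the path of u. The
  -- latter reaches row r or lower as well, hence leaves a mark in that row.
  meets-in-row : ∀ m u v {r} → Meet m (path I u) (path I v) → lo (toℕ u) ≤ r → r ≤ lo (toℕ v) →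
                 ∃[ x ] ∃[ d ] (d ∈ directions m × Marks m u (x , r) d)
  meets-in-row x=v u v (p , p∈u , p∈v) lo≤ r≤ = let x , x∈ = PathFacts.row-point (path I u) (subst (λ ps → lowest proj₂ ps ≤ _) (pts-toℕ u) lo≤) p∈u (≤-trans r≤ (point-row v p∈v))
    in x , true , here refl , x∈
  meets-in-row x=e u v ((p , q) , on-u , on-v) lo≤ r≤ =
    let p∈ , q∈ = PathFacts.edge-points (path I v) on-v
        x , d , e = PathFacts.row-edge (path I u) (subst (λ ps → lowest proj₂ ps ≤ _) (pts-toℕ u) lo≤) on-u (≤-trans r≤ (point-row v p∈)) (≤-trans r≤ (point-row v q∈))
    in x , d , all d , e
    where
    all : ∀ d → d ∈ directions x=e
    all true  = here refl
    all false = there (here refl)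

  narrow-strips : ∀ m → MeetsBy m → ∀ o → o < k →
    Available.Narrow n A (Keys.kept n k height minx maxx lo cutAt o) (k * (c * length (directions m))) (Keys.key n k height minx maxx lo cutAt o)
  narrow-strips m meets o = narrow o A (directions m) (Mark m) mark-column marked exclusive common
    where
    mark-column : ∀ {s x y d} → s < n → Mark m s (x , y) d → minx s ≤ x × x ≤ maxx s
    mark-column _ (u , refl , mk) = point-column u (marks-point m u mk)
    marked : ∀ {s t r} → s < n → t < n → A s t ≡ true → lo s ≤ r → r ≤ lo t → ∃[ x ] ∃[ d ] (d ∈ directions m × Mark m s (x , r) d)
    marked {s} {t} {r} s<n t<n = forFin (λ s → ∀ t → t < n → A s t ≡ true → lo s ≤ r → r ≤ lo t → ∃[ x ] ∃[ d ] (d ∈ directions m × Mark m s (x , r) d))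
      (λ u → forFin (λ t → A (toℕ u) t ≡ true → lo (toℕ u) ≤ r → r ≤ lo t → ∃[ x ] ∃[ d ] (d ∈ directions m × Mark m (toℕ u) (x , r) d)) λ v Ast lo≤ r≤ →
        let x , d , d∈ , mk = meets-in-row m u v (adjacent⇒meet m meets u v Ast) lo≤ r≤ in x , d , d∈ , u , refl , mk)
      s s<n t t<n
    exclusive : ∀ {s t p d} → s < n → t < n → Mark m s p d → Mark m t p d → A s t ≡ false → s ≡ t
    exclusive _ _ (u , refl , mu) (v , refl , mv) Ast = cong toℕ (meet⇒≡ m meets u v (marks-meet m u v mu mv) Ast)
    common : ∀ {s t} → s < n → t < n → A s t ≡ true → ∃[ x ] (minx s ≤ x × x ≤ maxx s × minx t ≤ x × x ≤ maxx t)
    common {s} {t} s<n t<n = forFin (λ s → ∀ t → t < n → A s t ≡ true → ∃[ x ] (minx s ≤ x × x ≤ maxx s × minx t ≤ x × x ≤ maxx t))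
      (λ u → forFin (λ t → A (toℕ u) t ≡ true → ∃[ x ] (minx (toℕ u) ≤ x × x ≤ maxx (toℕ u) × minx t ≤ x × x ≤ maxx t)) λ v Ast →
        let p , p∈u , p∈v = shared-point m u v (adjacent⇒meet m meets u v Ast); a , b = point-column u p∈u; a′ , b′ = point-column v p∈v
        in proj₁ p , a , b , a′ , b′)
      s s<n t t<n

-- The encoded input, and ⌈1/ε⌉

reads-shift : ∀ {m : ℕ → ℕ} {B} p xs → Reads (m ∘ suc) B p xs → Reads m (suc B) (suc p) xs
reads-shift p []       _                = tt
reads-shift p (x ∷ xs) ((p< , eq) , rs) = (s≤s p< , eq) , reads-shift (suc p) xs rs

reads-contents : ∀ xs → Reads (contents 0 xs) (length xs) 0 xs
reads-contents []       = tt
reads-contents (x ∷ xs) = (s≤s z≤n , refl) , reads-shift 0 xs (reads-contents xs)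

contents-outside : ∀ xs {j} → length xs ≤ j → contents 0 xs j ≡ 0
contents-outside []       {zero}  _        = refl
contents-outside []       {suc j} _        = refl
contents-outside (x ∷ xs) {suc j} (s≤s le) = contents-outside xs le

module _ {m : ℕ → ℕ} {B : ℕ} where

  reads-++ : ∀ p xs {ys} → Reads m B p (xs ++ ys) → Reads m B p xs × Reads m B (p + length xs) ys
  reads-++ p [] {ys} rs = tt , subst (λ p → Reads m B p ys) (sym (+-identityʳ p)) rs
  reads-++ p (x ∷ xs) {ys} (r , rs) with reads-++ (suc p) xs rs
  ... | left , right = (r , left) , subst (λ p → Reads m B p ys) (sym (+-suc p (length xs))) right

  reads-map : ∀ {A : Set} {n} (f : A → ℕ) (g : Fin n → A) p → Reads m B p (map f (tabulate g)) → ∀ i → m (p + toℕ i) ≡ f (g i)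
  reads-map f g p ((_ , eq) , rs) zero = trans (cong m (+-identityʳ p)) eq
  reads-map f g p (_ , rs) (suc i) = trans (cong m (+-suc p (toℕ i))) (reads-map f (g ∘ suc) (suc p) rs i)

prefix : ∀ {n} → (Fin n → ℕ) → ℕ → ℕ
prefix {zero}  h i       = 0
prefix {suc n} h zero    = 0
prefix {suc n} h (suc i) = h zero + prefix (h ∘ suc) i

prefix-suc : ∀ {n} (h : Fin n → ℕ) u → prefix h (suc (toℕ u)) ≡ prefix h (toℕ u) + h u
prefix-suc {suc zero}    h zero = +-identityʳ (h zero)
prefix-suc {suc (suc n)} h zero = +-identityʳ (h zero)
prefix-suc {suc n} h (suc u) = trans (cong (h zero +_) (prefix-suc (h ∘ suc) u)) (sym (+-assoc (h zero) _ _))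

prefix-const : ∀ {n q} (h : Fin n → ℕ) → (∀ u → h u ≡ q) → ∀ i → i ≤ n → prefix h i ≡ i * q
prefix-const {zero}  h eq zero    _        = refl
prefix-const {suc n} h eq zero    _        = refl
prefix-const {suc n} h eq (suc i) (s≤s le) = cong₂ _+_ (eq zero) (prefix-const (h ∘ suc) (eq ∘ suc) i le)

prefix-≤ : ∀ {n q} (h : Fin n → ℕ) → (∀ u → h u ≤ q) → prefix h n ≤ n * q
prefix-≤ {zero}  h le = z≤n
prefix-≤ {suc n} h le = +-mono-≤ (le zero) (prefix-≤ (h ∘ suc) (le ∘ suc))

length-concatMap : ∀ {A : Set} {n} (f : A → List ℕ) (g : Fin n → A) → length (concatMap f (tabulate g)) ≡ prefix (length ∘ f ∘ g) n
length-concatMap {n = zero}  f g = refl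
length-concatMap {n = suc n} f g = trans (length-++ (f (g zero))) (cong (length (f (g zero)) +_) (length-concatMap f (g ∘ suc)))

reads-concatMap : ∀ {m : ℕ → ℕ} {B} {A : Set} {n} (f : A → List ℕ) (g : Fin n → A) p → Reads m B p (concatMap f (tabulate g)) →
                  ∀ u → Reads m B (p + prefix (length ∘ f ∘ g) (toℕ u)) (f (g u))
reads-concatMap {m} {B} f g p rs zero = subst (λ p → Reads m B p (f (g zero))) (sym (+-identityʳ p)) (proj₁ (reads-++ p (f (g zero)) rs))
reads-concatMap {m} {B} f g p rs (suc u) = subst (λ p → Reads m B p (f (g (suc u)))) (+-assoc p _ _)
  (reads-concatMap f (g ∘ suc) _ (proj₂ (reads-++ p (f (g zero)) rs)) u)

length-points : ∀ ps → length (concatMap encodePoint ps) ≡ 2 * length ps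
length-points []       = refl
length-points (p ∷ ps) = trans (cong (2 +_) (length-points ps)) (arith (length ps))
  where
  arith : ∀ l → 2 + 2 * l ≡ 2 * (1 + l)
  arith = solve-∀

module Input {n : ℕ} (I : Instance n) (ε : ℚ) (b : ℕ) (few : ∀ u → bends (path I u) ≤ b) where

  open PathFacts using (corners)

  input : ℕ → ℕ
  input = contents 0 (encode I ε)

  B : ℕ
  B = length (encode I ε)

  header rows paths : List ℕ
  header = n ∷ ℤ.∣ ℚ.↥ ε ∣ ∷ ℚ.↧ₙ ε ∷ encodeMode (mode I) ∷ Grid.width (grid I) ∷ Grid.height (grid I) ∷ []
  rows   = concatMap (λ u → map (λ w → encodeBool (adj (graph I) u w)) (allFin n)) (allFin n)
  paths  = concatMap (λ u → encodePath (path I u)) (allFin n)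

  bds ptrs : ℕ → ℕ
  bds    = ext 0 (bends ∘ path I)
  ptrs s = 6 + n * n + prefix (λ u → length (encodePath (path I u))) s

  length-corners : ∀ u → length (corners (path I u)) ≡ bends (path I u) + 2
  length-corners u = trans (cong suc (length-++ (bendPoints (path I u)))) (sym (+-suc (bends (path I u)) 1))

  length-path : ∀ u → length (encodePath (path I u)) ≡ 1 + 2 * length (corners (path I u))
  length-path u = cong suc (length-points (corners (path I u)))

  private
    row-length : ∀ u → length (map (λ w → encodeBool (adj (graph I) u w)) (allFin n)) ≡ n
    row-length u = trans (length-map _ (allFin n)) (length-tabulate (λ i → i))

    rows-length : length rows ≡ n * n
    rows-length = trans (length-concatMap (λ u → map (λ w → encodeBool (adj (graph I) u w)) (allFin n)) (λ i → i))
      (prefix-const {n} {n} _ row-length n ≤-refl)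

    rest : Reads input B 6 rows × Reads input B (6 + length rows) paths
    rest = reads-++ 6 rows (proj₂ (reads-++ 0 header {rows ++ paths} (reads-contents (encode I ε))))

  adjs : ∀ v u → v < n → u < n → input (6 + v * n + u) ≡ encodeBool (adjℕ (graph I) v u)
  adjs s t s<n t<n with index s<n | index t<n
  ... | v , refl | u , refl = trans
    (cong (λ p → input (6 + p + toℕ u)) (sym (prefix-const {n} {n} _ row-length (toℕ v) (<⇒≤ s<n))))
    (trans (reads-map (λ w → encodeBool (adj (graph I) v w)) (λ i → i) _ (reads-concatMap (λ u → map (λ w → encodeBool (adj (graph I) u w)) (allFin n)) (λ i → i) 6 (proj₁ rest) v) u)
      (cong encodeBool (sym (adjℕ-toℕ (graph I) v u))))

  reads-path : ∀ s → s < n → Reads input B (ptrs s) (bds s ∷ concatMap encodePoint (ext [] (corners ∘ path I) s))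
  reads-path s s<n with index s<n
  ... | u , refl = subst₂ (λ p xs → Reads input B p xs)
    (cong (λ l → 6 + l + prefix (λ u → length (encodePath (path I u))) (toℕ u)) rows-length)
    (cong₂ (λ b ps → b ∷ concatMap encodePoint ps) (sym (ext-toℕ 0 (bends ∘ path I) u)) (sym (ext-toℕ [] (corners ∘ path I) u)))
    (reads-concatMap (λ u → encodePath (path I u)) (λ i → i) _ (proj₂ rest) u)

  bds+2 : ∀ s → s < n → bds s + 2 ≡ length (ext [] (corners ∘ path I) s)
  bds+2 s s<n with index s<n
  ... | u , refl rewrite ext-toℕ 0 (bends ∘ path I) u | ext-toℕ [] (corners ∘ path I) u = sym (length-corners u)

  bds≤ : ∀ s → s < n → bds s ≤ b
  bds≤ s s<n with index s<n
  ... | u , refl rewrite ext-toℕ 0 (bends ∘ path I) u = few u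

  ptrs-suc : ∀ s → s < n → ptrs (suc s) ≡ ptrs s + 1 + 2 * length (ext [] (corners ∘ path I) s)
  ptrs-suc s s<n with index s<n
  ... | u , refl rewrite ext-toℕ [] (corners ∘ path I) u = trans (cong (6 + n * n +_) (prefix-suc (λ u → length (encodePath (path I u))) u))
    (trans (sym (+-assoc (6 + n * n) _ _)) (trans (cong (ptrs (toℕ u) +_) (length-path u)) (sym (+-assoc (ptrs (toℕ u)) 1 _))))

  ptrs-0 : ptrs 0 ≡ 6 + n * n
  ptrs-0 = trans (cong (6 + n * n +_) (prefix-0 {n} _)) (+-identityʳ _)
    where
    prefix-0 : ∀ {n} (h : Fin n → ℕ) → prefix h 0 ≡ 0
    prefix-0 {zero}  h = refl
    prefix-0 {suc n} h = refl

  B≤ : B ≤ 6 + n * n + n * (2 * b + 5)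
  B≤ = ≤-trans (≤-reflexive (cong (6 +_) (trans (length-++ rows) (cong₂ _+_ rows-length (length-concatMap (λ u → encodePath (path I u)) (λ i → i))))))
      (≤-trans (+-monoʳ-≤ 6 (+-monoʳ-≤ (n * n) (prefix-≤ {n} {2 * b + 5} _ path≤))) (≤-reflexive (sym (+-assoc 6 (n * n) _))))
    where
    path≤ : ∀ u → length (encodePath (path I u)) ≤ 2 * b + 5
    path≤ u = ≤-trans (≤-reflexive (trans (length-path u) (cong (λ l → 1 + 2 * l) (length-corners u))))
      (≤-trans (s≤s (*-monoʳ-≤ 2 (+-monoˡ-≤ 2 (few u)))) (≤-reflexive (arith b)))
      where
      arith : ∀ b → 1 + 2 * (b + 2) ≡ 2 * b + 5
      arith = solve-∀

contents-map : ∀ {n} {A : Set} (d : ℚ) (f : A → ℚ) (g : Fin n → A) u → contents d (map f (tabulate g)) (toℕ u) ≡ f (g u)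
contents-map d f g zero    = refl
contents-map d f g (suc u) = contents-map d f (g ∘ suc) u

-- Cells 1 and 2 hold numerator and denominator of ε. Repeated truncated subtraction of the
-- numerator from the denominator counts the ceiling of 1/ε in register 4, the image of `kᵛ`. All
-- other registers used here are odd, that is, temporaries of the compiler.
prologue : Program
prologue = instr (const 7 1) ⨾ instr (load 3 7) ⨾ instr (const 9 2) ⨾ instr (load 1 9) ⨾
  while (leq 7 1) (instr (sub 1 1 3) ⨾ instr (add 4 4 7))

record Divided (k : ℕ) (s s′ : State) : Set where
  field
    quotient : reg s′ 4 ≡ reg s 4 + k
    mem≡     : mem s′ ≡ mem s
    wmem≡    : wmem s′ ≡ wmem s

-- The ceiling of r/d expressed without division: k is large enough, and its predecessor, if there
-- is one, is not.
Ceiling : ℕ → ℕ → ℕ → Set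
Ceiling r d k = r ≤ k * d × (∀ j → suc j ≡ k → j * d < r)

divide : ∀ k s → reg s 7 ≡ 1 → Ceiling (reg s 1) (reg s 3) k →
         Σ State λ s′ → Run (while (leq 7 1) (instr (sub 1 1 3) ⨾ instr (add 4 4 7))) s (1 + k * 3) s′ × Divided k s s′
divide zero s one (r≤ , _) = s , run-done (trans (cong (_≤ᵇ reg s 1) one) (>⇒≤ᵇ-false (s≤s r≤))) ,
  record { quotient = sym (+-identityʳ _); mem≡ = refl; wmem≡ = refl }
divide (suc k) s one (r≤ , >r) with divide k s₁ one (upper , lower)
  where
  s₁ = step (add 4 4 7) (step (sub 1 1 3) s)
  upper : reg s 1 ∸ reg s 3 ≤ k * reg s 3
  upper = ≤-trans (∸-monoˡ-≤ (reg s 3) r≤) (≤-reflexive (m+n∸m≡n (reg s 3) _))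
  lower : ∀ j → suc j ≡ k → j * reg s 3 < reg s 1 ∸ reg s 3
  lower j refl = ≤-trans (≤-reflexive (sym (m+n∸m≡n (reg s 3) _))) (∸-monoˡ-≤ (reg s 3) (≤-trans (≤-reflexive (+-suc (reg s 3) _)) (>r (suc j) refl)))
... | s′ , run , d = s′ ,
  run-loop (trans (cong (_≤ᵇ reg s 1) one) (≤⇒≤ᵇ-true (≤-<-trans z≤n (>r k refl)))) (run-seq run-instr run-instr) run ,
  record { quotient = trans (Divided.quotient d) (trans (+-assoc (reg s 4) (reg s 7) k) (cong (λ z → reg s 4 + (z + k)) one))
         ; mem≡ = Divided.mem≡ d; wmem≡ = Divided.wmem≡ d }

-- The ceiling is minus the floor of the negative, and flooring a negative quotient depends on
-- whether the remainder vanishes. Hence the two cases.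
ceiling-inverse : ∀ ε .{{_ : Positive ε}} → Ceiling (ℚ.↧ₙ ε) ℤ.∣ ℚ.↥ ε ∣ ⌈1/ ε ⌉
ceiling-inverse (ℚ.mkℚ (ℤ.+ suc a) d prf) = subst (Ceiling (suc d) (suc a)) (sym abs) quotient
  where
  i = ℤ.-[1+ d ] ℤ./ℕ suc a
  abs : ⌈1/ ℚ.mkℚ (ℤ.+ suc a) d prf ⌉ ≡ ℤ.∣ i ∣
  abs = trans (ℤₚ.∣-i∣≡∣i∣ (ℤ.1ℤ ℤ.* i)) (cong ℤ.∣_∣ (ℤₚ.*-identityˡ i))
  q = suc d / suc a
  quotient : Ceiling (suc d) (suc a) ℤ.∣ i ∣
  quotient with suc d % suc a in eq
  ... | zero = subst (Ceiling (suc d) (suc a)) (sym (ℤₚ.∣-i∣≡∣i∣ (ℤ.+ q)))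
      (≤-reflexive exact , λ j sj≡ → subst (j * suc a <_) (trans (cong (_* suc a) sj≡) (sym exact)) (s≤s (m≤n+m (j * suc a) a)))
    where
    exact : suc d ≡ q * suc a
    exact = trans (m≡m%n+[m/n]*n (suc d) (suc a)) (cong (_+ q * suc a) eq)
  ... | suc r = ≤-trans (≤-reflexive split) (+-monoˡ-≤ (q * suc a) (<⇒≤ (subst (_< suc a) eq (m%n<n (suc d) (suc a))))) ,
      λ { j refl → ≤-trans (s≤s (m≤n+m (q * suc a) r)) (≤-reflexive (sym split)) }
    where
    split : suc d ≡ suc r + q * suc a
    split = trans (m≡m%n+[m/n]*n (suc d) (suc a)) (cong (_+ q * suc a) eq)

-- The approximation ratio

natural : ℕ → ℚ
natural m = ℚ.mkℚ (ℤ.+ m) 0 (coprime-sym (1-coprimeTo m))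

natural-suc : ∀ m → natural (suc m) ≡ 1ℚ ℚ.+ natural m
natural-suc m = ℚₚ.toℚᵘ-injective (ℚᵘₚ.≃-sym (ℚᵘₚ.≃-trans (ℚₚ.toℚᵘ-homo-+ 1ℚ (natural m)) (ℚᵘ.*≡* (cong (ℤ._* ℤ.1ℤ) (cong (λ z → ℤ.1ℤ ℤ.+ z) (ℤₚ.*-identityʳ (ℤ.+ m)))))))

natural-suc-* : ∀ m q → natural (suc m) ℚ.* q ≡ q ℚ.+ natural m ℚ.* q
natural-suc-* m q = trans (cong (ℚ._* q) (natural-suc m))
  (trans (ℚₚ.*-distribʳ-+ q 1ℚ (natural m)) (cong (ℚ._+ natural m ℚ.* q) (ℚₚ.*-identityˡ q)))

1≤natural* : ∀ ε .{{_ : Positive ε}} {k} → ℚ.↧ₙ ε ≤ k * ℤ.∣ ℚ.↥ ε ∣ → 1ℚ ℚ.≤ natural k ℚ.* ε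
1≤natural* ε@(ℚ.mkℚ (ℤ.+ suc a) d prf) {k} le = ℚₚ.toℚᵘ-cancel-≤ (ℚᵘₚ.≤-trans (ℚᵘ.*≤* ineq) (ℚᵘₚ.≤-reflexive (ℚᵘₚ.≃-sym (ℚₚ.toℚᵘ-homo-* (natural k) ε))))
  where
  ineq : ℤ.1ℤ ℤ.* (ℤ.1ℤ ℤ.* ℤ.+ suc d) ℤ.≤ (ℤ.+ k ℤ.* ℤ.+ suc a) ℤ.* ℤ.1ℤ
  ineq = subst₂ ℤ._≤_ (sym (trans (ℤₚ.*-identityˡ _) (ℤₚ.*-identityˡ _))) (sym (trans (ℤₚ.*-identityʳ _) (sym (ℤₚ.pos-* k (suc a))))) (ℤ.+≤+ le)

module _ (n : ℕ) (w : ℕ → ℚ) (w≥0 : ∀ u → u < n → 0ℚ ℚ.≤ w u) (k : ℕ) (kept : ℕ → ℕ → Bool)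
         (dropped-once : ∀ {o o′ u} → o < k → o′ < k → u < n → kept o u ≡ false → kept o′ u ≡ false → o ≡ o′)
         (T : ℕ → Bool) (best : ℚ)
         (best≥ : ∀ o → o < k → wsum w n (λ u → T u ∧ kept o u) ℚ.≤ best) where

  dropped< : ℕ → ℕ → Bool
  dropped< m u = any< m (λ o → not (kept o u))

  lost : ℕ → ℚ
  lost m = wsum w n (λ u → T u ∧ dropped< m u)

  split-kept : ∀ o → wsum w n T ≡ wsum w n (λ u → T u ∧ kept o u) ℚ.+ wsum w n (λ u → T u ∧ not (kept o u))
  split-kept o = sym (trans (total-+ n _ _) (total-cong n (λ u _ → pointwise u)))
    where
    pointwise : ∀ u → part w (λ u → T u ∧ kept o u) u ℚ.+ part w (λ u → T u ∧ not (kept o u)) u ≡ part w T u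
    pointwise u with T u | kept o u
    ... | false | _     = ℚₚ.+-identityˡ 0ℚ
    ... | true  | true  = ℚₚ.+-identityʳ (w u)
    ... | true  | false = ℚₚ.+-identityˡ (w u)

  -- A vertex dropped for offset m cannot have been dropped for a smaller one, by `dropped-once`; so
  -- no weight is counted twice.
  split-lost : ∀ m → m < k → wsum w n (λ u → T u ∧ not (kept m u)) ℚ.+ lost m ≡ lost (suc m)
  split-lost m m<k = trans (total-+ n _ _) (total-cong n pointwise)
    where
    pointwise : ∀ u → u < n → part w (λ u → T u ∧ not (kept m u)) u ℚ.+ part w (λ u → T u ∧ dropped< m u) u ≡ part w (λ u → T u ∧ dropped< (suc m) u) u
    pointwise u u<n with T u | kept m u in km | dropped< m u in dm
    ... | false | _     | _     = ℚₚ.+-identityˡ 0ℚ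
    ... | true  | true  | true  = ℚₚ.+-identityˡ (w u)
    ... | true  | true  | false = ℚₚ.+-identityˡ 0ℚ
    ... | true  | false | false = ℚₚ.+-identityʳ (w u)
    ... | true  | false | true with any<-elim m _ dm
    ...   | o , o<m , ko = contradiction (dropped-once (<-trans o<m m<k) m<k u<n (not-true⇒false ko) km) (<⇒≢ o<m)

  -- Every vertex of T is dropped for at most one offset, so on average the offsets lose 1/k of its weight.
  averaged : ∀ m → m ≤ k → natural m ℚ.* wsum w n T ℚ.≤ natural m ℚ.* best ℚ.+ lost m
  averaged zero _ = ℚₚ.≤-reflexive (trans (ℚₚ.*-zeroˡ (wsum w n T)) (sym (trans (cong₂ ℚ._+_ (ℚₚ.*-zeroˡ best) (wsum-empty w n (λ u _ → Boolₚ.∧-zeroʳ (T u)))) (ℚₚ.+-identityˡ 0ℚ))))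
  averaged (suc m) m<k = begin
    natural (suc m) ℚ.* wT ≡⟨ natural-suc-* m wT ⟩
    wT ℚ.+ natural m ℚ.* wT ≤⟨ ℚₚ.+-mono-≤ first-part (averaged m (<⇒≤ m<k)) ⟩
    (best ℚ.+ d) ℚ.+ (natural m ℚ.* best ℚ.+ lost m) ≡⟨ +-interchange best d (natural m ℚ.* best) (lost m) ⟩
    (best ℚ.+ natural m ℚ.* best) ℚ.+ (d ℚ.+ lost m) ≡⟨ cong₂ ℚ._+_ (sym (natural-suc-* m best)) (split-lost m m<k) ⟩
    natural (suc m) ℚ.* best ℚ.+ lost (suc m) ∎
    where
    open ℚₚ.≤-Reasoning hiding (start)
    wT = wsum w n T
    d = wsum w n (λ u → T u ∧ not (kept m u))
    first-part : wT ℚ.≤ best ℚ.+ d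
    first-part = ℚₚ.≤-trans (ℚₚ.≤-reflexive (split-kept m)) (ℚₚ.+-monoˡ-≤ d (best≥ m m<k))

  lost≤ : ∀ m → lost m ℚ.≤ wsum w n T
  lost≤ m = total-mono n pointwise
    where
    pointwise : ∀ u → u < n → part w (λ u → T u ∧ dropped< m u) u ℚ.≤ part w T u
    pointwise u u<n with T u | dropped< m u
    ... | false | _     = ℚₚ.≤-refl
    ... | true  | true  = ℚₚ.≤-refl
    ... | true  | false = w≥0 u u<n

  wT≥0 : 0ℚ ℚ.≤ wsum w n T
  wT≥0 = ℚₚ.≤-trans (ℚₚ.≤-reflexive (sym (wsum-empty w n {λ u → T u ∧ false} (λ u _ → Boolₚ.∧-zeroʳ (T u))))) (lost≤ 0)

  -- Averaging gives k w(T) ≤ k best + w(T), and kε ≥ 1 bounds the last term by kε w(T). Subtracting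
  -- it and cancelling k yields the claim without dividing.
  approximation : ∀ ε .{{_ : Positive ε}} → 1 ≤ k → ℚ.↧ₙ ε ≤ k * ℤ.∣ ℚ.↥ ε ∣ → (1ℚ ℚ.- ε) ℚ.* wsum w n T ℚ.≤ best
  approximation ε (s≤s {n = k′} _) le = ℚₚ.*-cancelˡ-≤-pos κ (begin
    κ ℚ.* ((1ℚ ℚ.- ε) ℚ.* wT) ≡⟨ cong (κ ℚ.*_) (trans (ℚₚ.*-distribʳ-+ wT 1ℚ (ℚ.- ε)) (cong₂ ℚ._+_ (ℚₚ.*-identityˡ wT) (sym (ℚₚ.neg-distribˡ-* ε wT)))) ⟩
    κ ℚ.* (wT ℚ.+ ℚ.- e) ≡⟨ ℚₚ.*-distribˡ-+ κ wT (ℚ.- e) ⟩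
    κ ℚ.* wT ℚ.+ κ ℚ.* (ℚ.- e) ≤⟨ ℚₚ.+-monoˡ-≤ (κ ℚ.* (ℚ.- e)) (averaged k ≤-refl) ⟩
    (κ ℚ.* best ℚ.+ lost k) ℚ.+ κ ℚ.* (ℚ.- e) ≤⟨ ℚₚ.+-monoˡ-≤ (κ ℚ.* (ℚ.- e)) (ℚₚ.+-monoʳ-≤ (κ ℚ.* best) (ℚₚ.≤-trans (lost≤ k) wT≤)) ⟩
    (κ ℚ.* best ℚ.+ κ ℚ.* e) ℚ.+ κ ℚ.* (ℚ.- e) ≡⟨ ℚₚ.+-assoc (κ ℚ.* best) (κ ℚ.* e) (κ ℚ.* (ℚ.- e)) ⟩
    κ ℚ.* best ℚ.+ (κ ℚ.* e ℚ.+ κ ℚ.* (ℚ.- e)) ≡⟨ cong (κ ℚ.* best ℚ.+_) (trans (sym (ℚₚ.*-distribˡ-+ κ e (ℚ.- e))) (trans (cong (κ ℚ.*_) (ℚₚ.+-inverseʳ e)) (ℚₚ.*-zeroʳ κ))) ⟩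
    κ ℚ.* best ℚ.+ 0ℚ ≡⟨ ℚₚ.+-identityʳ (κ ℚ.* best) ⟩
    κ ℚ.* best ∎)
    where
    open ℚₚ.≤-Reasoning hiding (start)
    κ = natural (suc k′)
    wT = wsum w n T
    e = ε ℚ.* wT
    wT≤ : wT ℚ.≤ κ ℚ.* e
    wT≤ = begin
      wT ≡⟨ sym (ℚₚ.*-identityˡ wT) ⟩
      1ℚ ℚ.* wT ≤⟨ ℚₚ.*-monoʳ-≤-nonNeg wT {{ℚ.nonNegative wT≥0}} (1≤natural* ε {suc k′} le) ⟩
      (κ ℚ.* ε) ℚ.* wT ≡⟨ ℚₚ.*-assoc κ ε wT ⟩
      κ ℚ.* e ∎

-- Correctness and running time

totalWeight≡ : ∀ {n} {A : Set} (h : A → ℚ) (g : Fin n → A) → foldr ℚ._+_ 0ℚ (map h (tabulate g)) ≡ total n (ext 0ℚ (h ∘ g))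
totalWeight≡ {zero}  h g = refl
totalWeight≡ {suc n} h g = trans (cong (h (g zero) ℚ.+_) (totalWeight≡ h (g ∘ suc))) (sym (total-head n (ext 0ℚ (h ∘ g))))

module _ {n : ℕ} (I : Instance n) where

  weightℕ : ℕ → ℚ
  weightℕ = ext 0ℚ (weight I)

  memberℕ : Subset n → ℕ → Bool
  memberℕ T = ext false (lookup T)

  totalWeight≡wsum : ∀ T → totalWeight (weight I) T ≡ wsum weightℕ n (memberℕ T)
  totalWeight≡wsum T = trans (totalWeight≡ (λ u → if lookup T u then weight I u else 0ℚ) (λ i → i)) (total-cong n pointwise)
    where
    pointwise : ∀ s → s < n → ext 0ℚ (λ u → if lookup T u then weight I u else 0ℚ) s ≡ part weightℕ (memberℕ T) s
    pointwise s s<n with index s<n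
    ... | u , refl = trans (ext-toℕ 0ℚ _ u) (sym (cong₂ (λ b q → if b then q else 0ℚ) (ext-toℕ false (lookup T) u) (ext-toℕ 0ℚ (weight I) u)))

  weightℕ≥0 : ∀ s → s < n → 0ℚ ℚ.≤ weightℕ s
  weightℕ≥0 s s<n with index s<n
  ... | u , refl = ℚₚ.≤-trans (weight≥0 I u) (ℚₚ.≤-reflexive (sym (ext-toℕ 0ℚ (weight I) u)))

program : ℕ → ℕ → Program
program b c = prologue ⨾ comp 0 (main (2 * b + 5) c)

width : Mode → ℕ → ℕ → ℕ
width m k c = k * (c * length (directions m))

abstract

  -- 1323 + 60b is the sum of the coefficients of the collected running time, each of whose
  -- monomials is at most k (n+1)² (X+1).
  factor : ℕ → ℕ
  factor b = 1323 + 60 * b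

  total-time : ∀ n b k X → 1 ≤ k →
    5 + k * 3 + (27 + n * 23 + (7 + n * 25 + (4 + n * (5 + (70 + (b + 2) * 60)) + (10 + (n + n) * (40 + n * 50) +
      (12 + (4 + k * (5 + (10 + n * (78 + (n + n) * 105) + dpTime n X)) + (4 + n * 60)))))))
    ≤ factor b * (k * (suc n * (suc n * suc X)))
  total-time n b k X k≥1 = begin
    5 + k * 3 + (27 + n * 23 + (7 + n * 25 + (4 + n * (5 + (70 + (b + 2) * 60)) + (10 + (n + n) * (40 + n * 50) +
      (12 + (4 + k * (5 + (10 + n * (78 + (n + n) * 105) + dpTime n X)) + (4 + n * 60)))))))
      ≡⟨ collect n b k (suc n * (suc n * suc X)) (dpTime≡ n X) ⟩
    73 * 1 + (383 + 60 * b) * n + 100 * (n * n) + 18 * k + 78 * (k * n) + 210 * (k * (n * n)) + 461 * Z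
      ≤⟨ +-monoˡ-≤ (461 * Z) (+-mono-≤ (+-mono-≤ (+-mono-≤ (+-mono-≤ (+-mono-≤
           (*-monoʳ-≤ 73 (times k≥1 1≤Y)) (*-monoʳ-≤ (383 + 60 * b) (times k≥1 n≤Y))) (*-monoʳ-≤ 100 (times k≥1 nn≤Y)))
           (*-monoʳ-≤ 18 (≤-trans (≤-reflexive (sym (*-identityʳ k))) (*-monoʳ-≤ k 1≤Y)))) (*-monoʳ-≤ 78 (*-monoʳ-≤ k n≤Y))) (*-monoʳ-≤ 210 (*-monoʳ-≤ k nn≤Y))) ⟩
    73 * Z + (383 + 60 * b) * Z + 100 * Z + 18 * Z + 78 * Z + 210 * Z + 461 * Z
      ≡⟨ sum b Z ⟩
    factor b * Z ∎
    where
    open ≤-Reasoning hiding (start)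
    Y Z : ℕ
    Y = suc n * (suc n * suc X)
    Z = k * Y
    N≤Y : suc n * suc n ≤ Y
    N≤Y = *-monoʳ-≤ (suc n) (m≤m*n (suc n) (suc X))
    nn≤Y : n * n ≤ Y
    nn≤Y = ≤-trans (*-mono-≤ (n≤1+n n) (n≤1+n n)) N≤Y
    n≤Y : n ≤ Y
    n≤Y = ≤-trans (n≤1+n n) (≤-trans (m≤m*n (suc n) (suc n)) N≤Y)
    1≤Y : 1 ≤ Y
    1≤Y = ≤-trans (s≤s z≤n) (≤-trans (m≤m*n (suc n) (suc n)) N≤Y)
    times : ∀ {x} → 1 ≤ k → x ≤ Y → x ≤ Z
    times {x} k≥1 x≤Y = ≤-trans (≤-reflexive (sym (+-identityʳ x))) (*-mono-≤ k≥1 x≤Y)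
    collect : ∀ n b k Y {D} → D ≡ 461 * Y → 5 + k * 3 + (27 + n * 23 + (7 + n * 25 + (4 + n * (5 + (70 + (b + 2) * 60)) + (10 + (n + n) * (40 + n * 50) +
      (12 + (4 + k * (5 + (10 + n * (78 + (n + n) * 105) + D)) + (4 + n * 60)))))))
      ≡ 73 * 1 + (383 + 60 * b) * n + 100 * (n * n) + 18 * k + 78 * (k * n) + 210 * (k * (n * n)) + 461 * (k * Y)
    collect n b k Y refl = ring n b k Y
      where
      ring : ∀ n b k Y → 5 + k * 3 + (27 + n * 23 + (7 + n * 25 + (4 + n * (5 + (70 + (b + 2) * 60)) + (10 + (n + n) * (40 + n * 50) +
        (12 + (4 + k * (5 + (10 + n * (78 + (n + n) * 105) + 461 * Y)) + (4 + n * 60)))))))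
        ≡ 73 * 1 + (383 + 60 * b) * n + 100 * (n * n) + 18 * k + 78 * (k * n) + 210 * (k * (n * n)) + 461 * (k * Y)
      ring = solve-∀
    sum : ∀ b Z → 73 * Z + (383 + 60 * b) * Z + 100 * Z + 18 * Z + 78 * Z + 210 * Z + 461 * Z ≡ (1323 + 60 * b) * Z
    sum = solve-∀

compiled : ∀ {p σ t Q} s → Sim σ s → Spec p σ t Q →
           ∃[ t′ ] Σ State λ s′ → Run (comp 0 p) s t′ s′ × t′ ≤ t × Σ State λ σ′ → Sim σ′ s′ × Q σ′
compiled {p} {σ} s S (spec c q) with comp-correct 0 p S
... | simulates {s′} r S′ _ = cost p σ , s′ , r , c , ⟦ p ⟧ σ , S′ , q

module Correctness {n : ℕ} (I : Instance n) (b c : ℕ) (c≥1 : 1 ≤ c) (few : FewBendsShort b c I) (ε : ℚ) .{{ε>0 : Positive ε}} where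

  k : ℕ
  k = ⌈1/ ε ⌉

  private
    ceil : Ceiling (ℚ.↧ₙ ε) ℤ.∣ ℚ.↥ ε ∣ k
    ceil = ceiling-inverse ε

  k≥1 : 1 ≤ k
  k≥1 = positive k (proj₁ ceil)
    where
    positive : ∀ k → ℚ.↧ₙ ε ≤ k * ℤ.∣ ℚ.↥ ε ∣ → 1 ≤ k
    positive (suc k) _ = s≤s z≤n

  open Geometry I k c c≥1 (proj₂ ∘ few)
  open Input I ε b (proj₁ ∘ few)

  M : ℕ
  M = width (mode I) k c

  w : ℕ → ℚ
  w = weightℕ I

  open Whole n A w (adjℕ-symmetric (graph I)) k (Grid.width (grid I)) (Grid.height (grid I)) b c M B bds ptrs pts using (mainTime; mainSpec)

  kept : ℕ → ℕ → Bool
  kept = Keys.kept n k (Grid.height (grid I)) minx maxx lo cutAt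

  Result : State → Set
  Result = Solved n A w k kept

  execute : ∀ s → reg s (vr kᵛ) ≡ k → mem s ≡ input → wmem s ≡ contents 0ℚ (map (weight I) (allFin n)) →
            ∃[ t ] Σ State λ s′ → Run (comp 0 (main (2 * b + 5) c)) s t s′ × t ≤ mainTime × Σ State λ σ′ → Sim σ′ s′ × Result σ′
  execute s k≡ refl refl = compiled s (record { vars = λ _ → refl; mems = refl; wvars = λ _ → refl; wmems = refl })
    -- The source state is read off the even registers, which makes the simulation hold by
    -- definition.
    (mainSpec (state (λ x → reg s (vr x)) (mem s) (λ x → wreg s (vr x)) (wmem s))
      (narrow-strips (mode I) (adj⇔meet I)) k≡ refl refl refl adjs weights reads-path bds+2 bds≤ ptrs-suc ptrs-0 B≤
      (λ j le → contents-outside (encode I ε) le))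
    where
    weights : ∀ u → u < n → contents 0ℚ (map (weight I) (allFin n)) u ≡ w u
    weights = forFin (λ s → contents 0ℚ (map (weight I) (allFin n)) s ≡ w s) λ u →
      trans (contents-map 0ℚ (weight I) (λ i → i) u) (sym (ext-toℕ 0ℚ (weight I) u))

  module _ {σ τ : State} (sim : Sim σ τ) (result : Result σ) where

    private
      module Sol = Solved result
      R : Subset n
      R = output n τ

    R≡S : ∀ u → lookup R u ≡ Sol.S (toℕ u)
    R≡S u = trans (Vecₚ.lookup∘tabulate _ u) (trans (cong (λ m → 0 <ᵇ m (toℕ u)) (Sim.mems sim))
      (trans (cong (0 <ᵇ_) (Sol.written (toℕ u) (Finₚ.toℕ<n u))) (decode-bool (Sol.S (toℕ u)))))
      where
      decode-bool : ∀ b → (0 <ᵇ encodeBool b) ≡ b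
      decode-bool true  = refl
      decode-bool false = refl

    output-independent : Independent (graph I) R
    output-independent u v u∈ v∈ = trans (sym (adjℕ-toℕ (graph I) u v)) (Sol.independent (toℕ u) (toℕ v) (Finₚ.toℕ<n u) (Finₚ.toℕ<n v)
      (trans (sym (R≡S u)) (Vecₚ.[]=⇒lookup u∈)) (trans (sym (R≡S v)) (Vecₚ.[]=⇒lookup v∈)))

    approximates : ∀ T → IsMaxWeightIndependent (graph I) (weight I) T →
                   (1ℚ ℚ.- ε) ℚ.* totalWeight (weight I) T ℚ.≤ totalWeight (weight I) R
    approximates T (ind , _) = subst₂ (λ x y → (1ℚ ℚ.- ε) ℚ.* x ℚ.≤ y) (sym (totalWeight≡wsum I T)) (sym weightR)
        (approximation n w (weightℕ≥0 I) k kept dropped-once T′ (wsum w n Sol.S) best≥ ε k≥1 (proj₁ ceil))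
      where
      T′ : ℕ → Bool
      T′ = memberℕ I T
      weightR : totalWeight (weight I) R ≡ wsum w n Sol.S
      weightR = trans (totalWeight≡wsum I R) (wsum-cong w n same)
        where
        same : ∀ s → s < n → memberℕ I R s ≡ Sol.S s
        same = forFin (λ s → memberℕ I R s ≡ Sol.S s) λ u → trans (ext-toℕ false (lookup R) u) (R≡S u)
      T′-member : ∀ u → T′ (toℕ u) ≡ true → T [ u ]= true
      T′-member u Tu = Vecₚ.lookup⇒[]= u T (trans (sym (ext-toℕ false (lookup T) u)) Tu)
      T′-independent : ∀ s t → s < n → t < n → T′ s ≡ true → T′ t ≡ true → A s t ≡ false
      T′-independent s t s<n t<n = forFin (λ s → ∀ t → t < n → T′ s ≡ true → T′ t ≡ true → A s t ≡ false)
        (λ u → forFin (λ t → T′ (toℕ u) ≡ true → T′ t ≡ true → A (toℕ u) t ≡ false) λ v Tu Tv →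
          trans (adjℕ-toℕ (graph I) u v) (ind u v (T′-member u Tu) (T′-member v Tv)))
        s s<n t t<n
      best≥ : ∀ o → o < k → wsum w n (λ u → T′ u ∧ kept o u) ℚ.≤ wsum w n Sol.S
      best≥ o o<k = Sol.optimal o o<k (λ u → T′ u ∧ kept o u)
        (λ s t s<n t<n Is It → T′-independent s t s<n t<n (∧-trueˡ Is) (∧-trueˡ It)) (λ s _ Is → ∧-trueʳ {T′ s} Is)

    output-approximates : IsApproxSolution I ε R
    output-approximates = output-independent , approximates

  private
    s₀ : State
    s₀ = step (load 1 9) (step (const 9 2) (step (load 3 7) (step (const 7 1) (initial I ε))))

  abstract

    solution : ∃[ t ] (SolvesInTime (program b c) I ε t × t ≤ factor b * (k * (suc n * (suc n * suc (n ^ M)))))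
    solution with divide k s₀ refl ceil
    ... | s₁ , run₁ , d with execute s₁ (Divided.quotient d) (Divided.mem≡ d) (Divided.wmem≡ d)
    ...   | t , τ , run₂ , t≤ , σ′ , sim , result = 5 + k * 3 + t ,
      (τ , run-seq (run-seq run-instr (run-seq run-instr (run-seq run-instr (run-seq run-instr run₁)))) run₂ , output-approximates sim result) ,
      ≤-trans (+-monoʳ-≤ (5 + k * 3) t≤) (total-time n b k (n ^ M) k≥1)

  time : ℕ
  time = proj₁ solution

  solves : SolvesInTime (program b c) I ε time
  solves = proj₁ (proj₂ solution)

  -- For positive n, each factor n+1 is at most 2n and n^M + 1 is at most 2 n^M; the three factors 2
  -- give the 8.
  time≤power : 1 ≤ n → time ≤ 8 * factor b * (k * n ^ (2 + M))
  time≤power n≥1 = ≤-trans (proj₂ (proj₂ solution)) (≤-trans (*-monoʳ-≤ (factor b) (*-monoʳ-≤ k (*-mono-≤ N≤2n (*-mono-≤ N≤2n X≤2X)))) (≤-reflexive (arith (factor b) k n (n ^ M))))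
    where
    N≤2n : suc n ≤ 2 * n
    N≤2n = ≤-trans (+-monoˡ-≤ n n≥1) (≤-reflexive (cong (n +_) (sym (+-identityʳ n))))
    X≥1 : 1 ≤ n ^ M
    X≥1 = m^n>0 n {{>-nonZero n≥1}} M
    X≤2X : suc (n ^ M) ≤ 2 * n ^ M
    X≤2X = ≤-trans (+-monoˡ-≤ (n ^ M) X≥1) (≤-reflexive (cong (n ^ M +_) (sym (+-identityʳ (n ^ M)))))
    arith : ∀ C k n X → C * (k * ((2 * n) * ((2 * n) * (2 * X)))) ≡ 8 * C * (k * (n * (n * X)))
    arith = solve-∀

-- For c = 0 consecutive cuts would coincide.
atLeastOne : ℕ → ℕ
atLeastOne zero    = 1
atLeastOne (suc c) = suc c

atLeastOne≥1 : ∀ c → 1 ≤ atLeastOne c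
atLeastOne≥1 zero    = ≤-refl
atLeastOne≥1 (suc c) = s≤s z≤n

c≤atLeastOne : ∀ c → c ≤ atLeastOne c
c≤atLeastOne zero    = z≤n
c≤atLeastOne (suc c) = ≤-refl

relax : ∀ {b c n} {I : Instance n} → FewBendsShort b c I → FewBendsShort b (atLeastOne c) I
relax {c = c} few u = proj₁ (few u) , ≤-trans (proj₂ (few u)) (c≤atLeastOne c)

-- The two time bounds

m≤2^m : ∀ m → m ≤ 2 ^ m
m≤2^m zero    = z≤n
m≤2^m (suc m) = ≤-trans (+-mono-≤ (m^n>0 2 m) (m≤2^m m)) (≤-reflexive (cong (2 ^ m +_) (sym (+-identityʳ (2 ^ m)))))

width≤ : ∀ m k c → width m k c ≤ k * (c * 2)
width≤ x=v k c = *-monoʳ-≤ k (*-monoʳ-≤ c (s≤s z≤n))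
width≤ x=e k c = ≤-refl

-- The exponent 2 + M is 2 + kc or 2 + 2kc, leaving a margin of 1 or of kc; the factor c is at least
-- 1.
power≤timeBound : ∀ m k c n → 1 ≤ c → 1 ≤ n → k * n ^ (2 + width m k c) ≤ timeBound m c k n
power≤timeBound m k c n c≥1 n≥1 = bound m
  where
  larger : ∀ {i j} → i ≤ j → k * n ^ i ≤ c * k * n ^ j
  larger i≤j = *-mono-≤ (≤-trans (≤-reflexive (sym (+-identityʳ k))) (*-monoˡ-≤ k c≥1)) (^-monoʳ-≤ n {{>-nonZero n≥1}} i≤j)
  bound : ∀ m → k * n ^ (2 + width m k c) ≤ timeBound m c k n
  bound x=v = larger (subst (2 + width x=v k c ≤_) (arith k c) (n≤1+n _))
    where
    arith : ∀ k c → 1 + (2 + k * (c * 1)) ≡ k * c + 3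
    arith = solve-∀
  bound x=e = larger (subst (2 + width x=e k c ≤_) (arith k c) (m≤n+m _ (k * c)))
    where
    arith : ∀ k c → k * c + (2 + k * (c * 2)) ≡ 3 * k * c + 2
    arith = solve-∀

-- ε is read from the input, so one program serves every accuracy; c enters the program as the
-- distance of the cuts. The number b fixes the space reserved for a path and the time for parsing
-- it, so the constant depends on b alone.
theorem7p8 : (b : ℕ) → ∃[ C ] ((c : ℕ) → ∃[ prog ]
    ( IsPTAS (FewBendsShort b c) prog
    × ( .{{_ : NonZero c}} →
    (ε : ℚ) → .{{_ : Positive ε}} → ε ℚ.< 1ℚ →
    (n : ℕ) → .{{_ : NonZero n}} →
    (I : Instance n) → FewBendsShort b c I →
    ∃[ t ] ( SolvesInTime prog I ε t
    × t ≤ C * timeBound (mode I) c ⌈1/ ε ⌉ n ))))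
theorem7p8 b = C , λ c → program b (atLeastOne c) , (exponent c , ptas c) , bounded c
  where
  C : ℕ
  C = 8 * factor b

  -- For n ≥ 2 the factor C k is at most 2^(C k), hence at most n^(C k), which moves it into the
  -- exponent. The other summand is 2 + M for the wider of the two modes, so that one function of
  -- 1/ε serves both.
  exponent : ℕ → ℚ → ℕ
  exponent c 1/ε = C * k + (2 + k * (atLeastOne c * 2))
    where k = ℤ.∣ ℚ.ceiling 1/ε ∣

  ptas : ∀ c → (ε : ℚ) → .{{_ : Positive ε}} → ∀ {n} (I : Instance n) → FewBendsShort b c I →
         ∃[ t ] (SolvesInTime (program b (atLeastOne c)) I ε t × (2 ≤ n → t ≤ n ^ exponent c (inverse ε)))
  ptas c ε {n} I few = time , solves , bound
    where
    open Correctness I b (atLeastOne c) (atLeastOne≥1 c) (relax {I = I} few) ε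
    bound : 2 ≤ n → time ≤ n ^ exponent c (inverse ε)
    bound n≥2 = begin
      time ≤⟨ time≤power n≥1 ⟩
      C * (k * n ^ (2 + M)) ≡⟨ sym (*-assoc C k _) ⟩
      C * k * n ^ (2 + M) ≤⟨ *-mono-≤ (≤-trans (m≤2^m (C * k)) (^-monoˡ-≤ (C * k) n≥2)) (^-monoʳ-≤ n {{>-nonZero n≥1}} (+-monoʳ-≤ 2 (width≤ (mode I) k (atLeastOne c)))) ⟩
      n ^ (C * k) * n ^ (2 + k * (atLeastOne c * 2)) ≡⟨ sym (^-distribˡ-+-* n (C * k) _) ⟩
      n ^ exponent c (inverse ε) ∎
      where
      open ≤-Reasoning hiding (start)
      n≥1 : 1 ≤ n
      n≥1 = ≤-trans (s≤s z≤n) n≥2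

  bounded : ∀ c → .{{_ : NonZero c}} → (ε : ℚ) → .{{_ : Positive ε}} → ε ℚ.< 1ℚ → (n : ℕ) → .{{_ : NonZero n}} →
            (I : Instance n) → FewBendsShort b c I →
            ∃[ t ] (SolvesInTime (program b (atLeastOne c)) I ε t × t ≤ C * timeBound (mode I) c ⌈1/ ε ⌉ n)
  bounded (suc c) ε _ n@(suc _) I few = time , solves , ≤-trans (time≤power (s≤s z≤n)) (*-monoʳ-≤ C (power≤timeBound (mode I) k (suc c) n (s≤s z≤n) (s≤s z≤n)))
    where open Correctness I b (suc c) (s≤s z≤n) few ε
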